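{- Let $d\ge 1$ and let $K\subseteq\mathbb{R}^d$ be a convex body. (1) If $\mathrm{width}(K)\ge 2\,\mathrm{Flt}(d)\,d$, then $K$ contains a unimodular copy of the standard simplex $\Delta_d$. (2) If $\mathrm{width}(K)\ge \mathrm{Flt}(d)\,d$, then $K$ contains an $\mathbb{R}$-unimodular copy of $\Delta_d$.
   Context: A convex body is a non-empty compact convex subset of $\mathbb{R}^d$. For a non-zero linear functional $u$, $\mathrm{width}_u(K)=\max_{x,y\in K}|u(x)-u(y)|$, and the lattice width is $\mathrm{width}(K)=\min_{u\in(\mathbb{Z}^d)^*\setminus\{0\}}\mathrm{width}_u(K)$, where $(\mathbb{Z}^d)^*=\mathrm{Hom}(\mathbb{Z}^d,\mathbb{Z})$. The flatness constant is $\mathrm{Flt}(d)=\sup\{\mathrm{width}(K): K\subseteq\mathbb{R}^d \text{ convex body}, K\cap\mathbb{Z}^d=\emptyset\}$ (a finite real number). A unimodular transformation is a map $x\mapsto Ax+b$ with $A\in\mathrm{GL}(d,\mathbb{Z})$ (integer matrix of determinant $\pm1$) and $b\in\mathbb{Z}^d$; an $\mathbb{R}$-unimodular transformation is the same with $b\in\mathbb{R}^d$. For $X\subseteq\mathbb{R}^d$, $T(X)$ is called a unimodular (resp. $\mathbb{R}$-unimodular) copy of $X$ for $T$ unimodular (resp. $\mathbb{R}$-unimodular). The standard simplex is $\Delta_d=\mathrm{conv}(0,e_1,\dots,e_d)$. -}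

module Defs where

open import Level using (0ℓ) renaming (suc to lsuc)
open import Algebra.Bundles using (CommutativeRing)
open import Algebra.Structures using (IsCommutativeRing)
import Algebra.Definitions.RawMonoid as RawMonoidDefs
import Algebra.Construct.NaturalChoice.Max as NaturalMax
open import Data.Bool.Base using (if_then_else_)
open import Data.Fin.Base using (Fin; zero; suc; toℕ; punchIn)
open import Data.Fin.Properties using (_≟_)
open import Data.Integer.Base as ℤ using (ℤ; +_; -[1+_])
import Data.Integer.Properties as ℤₚ
open import Data.List.Base using (List)
open import Data.List.Relation.Unary.Any using (Any)
open import Data.Nat.Base using (ℕ; zero; suc)
open import Data.Product.Base using (Σ-syntax; ∃; ∃-syntax; _×_)
open import Data.Sum.Base using (_⊎_)
open import Data.Vec.Functional using (Vector; _∷_)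
open import Data.Vec.Functional.Relation.Binary.Pointwise using (Pointwise)
open import Relation.Binary.Bundles using (TotalOrder)
open import Relation.Binary.Core using (Rel)
open import Relation.Binary.Definitions using (_Respects_)
import Relation.Binary.Construct.NonStrictToStrict as ToStrict
open import Relation.Binary.PropositionalEquality.Core using (_≡_)
open import Relation.Binary.Structures using (IsTotalOrder)
open import Relation.Nullary using (¬_)
open import Relation.Nullary.Decidable.Core using (does)
open import Relation.Unary using (Pred; _∈_; _⊆_; ⋃; Satisfiable)

module _ {a ℓ₁ ℓ₂} {A : Set a} (_≤_ : Rel A ℓ₁) (S : Pred A ℓ₂) where

  IsUpperBound : Pred A _
  IsUpperBound b = ∀ x → x ∈ S → x ≤ b

  IsLowerBound : Pred A _
  IsLowerBound b = ∀ x → x ∈ S → b ≤ x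

  IsSupremum : Pred A _
  IsSupremum s = IsUpperBound s × (∀ b → IsUpperBound b → s ≤ b)

  IsMaximum : Pred A _
  IsMaximum m = m ∈ S × IsUpperBound m

  IsMinimum : Pred A _
  IsMinimum m = m ∈ S × IsLowerBound m

-- The real numbers, given by their categorical axioms: a Dedekind-complete
-- totally ordered field.  Equality is a setoid equality, since Agda has no
-- quotient types.  Under excluded middle any two models are isomorphic.

record CompleteOrderedField : Set₁ where
  infix  8 -_
  infixl 7 _*_
  infixl 6 _+_
  infix  4 _≈_ _≤_
  field
    Carrier           : Set
    _≈_               : Rel Carrier 0ℓ
    _≤_               : Rel Carrier 0ℓ
    _+_ _*_           : Carrier → Carrier → Carrier
    -_                : Carrier → Carrier
    0# 1#             : Carrier
    isCommutativeRing : IsCommutativeRing _≈_ _+_ _*_ -_ 0# 1#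
    0≉1               : ¬ (0# ≈ 1#)
    *-inverse         : ∀ x → ¬ (x ≈ 0#) → ∃[ y ] x * y ≈ 1#
    isTotalOrder      : IsTotalOrder _≈_ _≤_
    +-mono-≤          : ∀ {x y} z → x ≤ y → x + z ≤ y + z
    *-nonNegative     : ∀ {x y} → 0# ≤ x → 0# ≤ y → 0# ≤ x * y
    supremum          : (S : Pred Carrier 0ℓ) → Satisfiable S →
                        ∃ (IsUpperBound _≤_ S) → ∃ (IsSupremum _≤_ S)

  commutativeRing : CommutativeRing 0ℓ 0ℓ
  commutativeRing = record { isCommutativeRing = isCommutativeRing }

  totalOrder : TotalOrder 0ℓ 0ℓ 0ℓ
  totalOrder = record { isTotalOrder = isTotalOrder }

Matrix : ℕ → Set
Matrix d = Fin d → Fin d → ℤ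

sumℤ : ∀ {n} → Vector ℤ n → ℤ
sumℤ = RawMonoidDefs.sum (CommutativeRing.+-rawMonoid ℤₚ.+-*-commutativeRing)

-- Laplace expansion along the first row.
det : ∀ {d} → Matrix d → ℤ
det {zero}  A = ℤ.1ℤ
det {suc d} A = sumℤ λ j →
  (ℤ.-1ℤ ℤ.^ toℕ j) ℤ.* A zero j ℤ.* det (λ i k → A (suc i) (punchIn j k))

GL : (d : ℕ) → Pred (Matrix d) 0ℓ
GL d A = det A ≡ ℤ.1ℤ ⊎ det A ≡ ℤ.-1ℤ

module Geometry (ℝ : CompleteOrderedField) where

  open CompleteOrderedField ℝ public
  open RawMonoidDefs (CommutativeRing.+-rawMonoid commutativeRing) public
    using (sum) renaming (_×_ to _·_)
  open NaturalMax totalOrder public using () renaming (_⊔_ to max)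
  open ToStrict _≈_ _≤_ public using (_<_)

  fromℕ : ℕ → Carrier
  fromℕ n = n · 1#

  fromℤ : ℤ → Carrier
  fromℤ (+ n)    = fromℕ n
  fromℤ -[1+ n ] = - fromℕ (suc n)

  ∣_∣ : Carrier → Carrier
  ∣ x ∣ = max x (- x)

  Point : ℕ → Set
  Point d = Vector Carrier d

  Subset : ℕ → Set₁
  Subset d = Pred (Point d) 0ℓ

  module _ {d : ℕ} where

    infix  4 _≋_
    infixl 6 _⊕_
    infixr 7 _⊙_

    _≋_ : Rel (Point d) 0ℓ
    _≋_ = Pointwise _≈_

    _⊕_ : Point d → Point d → Point d
    (x ⊕ y) i = x i + y i

    _⊙_ : Carrier → Point d → Point d
    (t ⊙ x) i = t * x i

    origin : Point d
    origin _ = 0#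

    basis : Fin d → Point d
    basis i j = if does (i ≟ j) then 1# else 0#

    lattice : Vector ℤ d → Point d
    lattice z i = fromℤ (z i)

    Convex : Pred (Subset d) 0ℓ
    Convex K = ∀ {x y t} → x ∈ K → y ∈ K → 0# ≤ t → t ≤ 1# →
               t ⊙ x ⊕ (1# + - t) ⊙ y ∈ K

    -- The balls are those of the maximum norm, which induces the usual
    -- topology of ℝᵈ.
    Open : Pred (Subset d) 0ℓ
    Open U = ∀ x → x ∈ U →
      ∃[ ε ] 0# < ε × (∀ y → (∀ i → ∣ y i + - x i ∣ < ε) → y ∈ U)

    Compact : Pred (Subset d) (lsuc 0ℓ)
    Compact K = ∀ {I : Set} (U : I → Subset d) → (∀ i → Open (U i)) →
      K ⊆ ⋃ I U → Σ[ is ∈ List I ] (K ⊆ λ x → Any (λ i → x ∈ U i) is)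

    record IsConvexBody (K : Subset d) : Set₁ where
      field
        -- K is a subset of ℝᵈ as a setoid.
        respects : K Respects _≋_
        nonEmpty : Satisfiable K
        convex   : Convex K
        compact  : Compact K

    -- A functional u ∈ Hom(ℤᵈ, ℤ), given by its values on the standard
    -- basis and extended linearly to ℝᵈ.
    ⟨_,_⟩ : Vector ℤ d → Point d → Carrier
    ⟨ u , x ⟩ = sum λ i → fromℤ (u i) * x i

    NonZero : Pred (Vector ℤ d) 0ℓ
    NonZero u = ¬ (∀ i → u i ≡ ℤ.0ℤ)

    -- Maxima, minima and suprema are expressed as relations: "w is the width"
    -- rather than "width K = w".
    IsWidthAlong : Vector ℤ d → Subset d → Pred Carrier 0ℓ
    IsWidthAlong u K = IsMaximum _≤_ λ r →
      ∃[ x ] ∃[ y ] x ∈ K × y ∈ K × r ≈ ∣ ⟨ u , x ⟩ + - ⟨ u , y ⟩ ∣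

    IsLatticeWidth : Subset d → Pred Carrier 0ℓ
    IsLatticeWidth K = IsMinimum _≤_ λ r →
      ∃[ u ] NonZero u × IsWidthAlong u K r

    Hollow : Pred (Subset d) 0ℓ
    Hollow K = ∀ z → ¬ (lattice z ∈ K)

    conv : ∀ {n} → Vector (Point d) n → Subset d
    conv {n} p x = Σ[ λs ∈ Vector Carrier n ]
      (∀ k → 0# ≤ λs k) × sum λs ≈ 1# × x ≋ (λ i → sum λ k → λs k * p k i)

    affine : Matrix d → Point d → Point d → Point d
    affine A b x i = sum (λ j → fromℤ (A i j) * x j) + b i

    Image : (Point d → Point d) → Subset d → Subset d
    Image T X y = ∃[ x ] x ∈ X × y ≋ T x

    ContainsUnimodularCopy : Subset d → Subset d → Set
    ContainsUnimodularCopy K X =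
      ∃[ A ] ∃[ b ] GL d A × Image (affine A (lattice b)) X ⊆ K

    ContainsℝUnimodularCopy : Subset d → Subset d → Set
    ContainsℝUnimodularCopy K X =
      ∃[ A ] ∃[ b ] GL d A × Image (affine A b) X ⊆ K

  IsFlatnessConstant : ℕ → Pred Carrier (lsuc 0ℓ)
  IsFlatnessConstant d = IsSupremum _≤_ λ w →
    Σ[ K ∈ Subset d ] IsConvexBody K × Hollow K × IsLatticeWidth K w

  Δ : (d : ℕ) → Subset d
  Δ d = conv (origin ∷ basis)

{-# OPTIONS --safe #-}

-- If s · width(K) > Flt(d), every translate of s K meets ℤᵈ.  Hence the set of
-- lattice vectors in s (K − K) is killed by no nonzero integral functional u:
-- otherwise u would be constant along the lattice points of a sequence of
-- slowly shifted translates of K, although the shifts move u without bound.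
-- A set of lattice vectors with this property contains v₁, …, v_d such that
-- some basis a₁, …, a_d of ℤᵈ lies in the zonotope {Σⱼ tⱼ vⱼ : 0 ≤ tⱼ ≤ 1}.
-- Writing vⱼ = s (xⱼ − yⱼ) and b = s Σⱼ yⱼ, the points b and b + aᵢ are sums of
-- d points of s K, so they lie in s d K.
--
-- With s = (1 + h) / d this is (2) for the dilate (1 + h) K.  With
-- s = (1 + h) / 2d the points lie in ½ (1 + h) K, and adding a suitable point of
-- ½ (1 + h) K makes b integral, which is (1) for (1 + h) K.  As h → 0 only
-- finitely many matrices occur, and compactness of K gives a limit.  The
-- hypotheses yield the strict inequality s · width(K) > Flt(d) because
-- Flt(d) > 0, as a small cube shows.

module Submission where

open import Defs
open import Level using (0ℓ)
open import Axiom.ExcludedMiddle using (ExcludedMiddle)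
open import Algebra.Bundles using (CommutativeRing)
import Algebra.Construct.NaturalChoice.Max as NaturalMax
import Algebra.Construct.NaturalChoice.MaxOp as MaxOp
import Algebra.Properties.Ring as RingProperties
import Algebra.Properties.Semiring.Mult as SemiringMult
import Algebra.Properties.Semiring.Mult.TCOptimised as SemiringMult′
import Algebra.Properties.Semiring.Sum as SemiringSum
import Algebra.Solver.Ring as RingSolver
open import Algebra.Solver.Ring.AlmostCommutativeRing using (_-Raw-AlmostCommutative⟶_; fromCommutativeRing)
open import Data.Bool.Base using (true; false; if_then_else_)
open import Data.Empty using (⊥-elim)
open import Data.Fin.Base using (Fin; zero; suc; toℕ; punchIn)
open import Data.Fin.Properties using (_≟_)
open import Data.Integer.Base as ℤ using (ℤ; +_)
import Data.Integer.DivMod as ℤ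
import Data.Integer.Properties as ℤₚ
open import Data.Integer.Tactic.RingSolver using (solve-∀)
open import Data.List.Base as List using (List)
open import Data.List.Relation.Unary.Any using (Any; here; there)
import Data.List.Relation.Unary.Any as Any
import Data.List.Relation.Unary.Any.Properties as Any
import Data.Maybe.Base as Maybe
open import Data.Nat.Base as ℕ using (ℕ; zero; suc) renaming (_≤_ to _≤ᴺ_)
open import Data.Nat.Induction using (<-wellFounded)
import Data.Nat.Properties as ℕₚ
open import Data.Product.Base using (Σ-syntax; ∃; ∃-syntax; _×_; _,_; proj₁; proj₂)
open import Data.Sum.Base using (_⊎_; inj₁; inj₂)
open import Data.Unit.Base using (⊤; tt)
open import Data.Vec.Functional using (Vector; _∷_; tail)
open import Function.Base using (_∘_; id)
open import Induction.WellFounded using (Acc; acc)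
open import Relation.Binary.Consequences using (dec⇒weaklyDec)
open import Relation.Binary.Definitions using (_Respects_)
open import Relation.Binary.PropositionalEquality
  using (_≡_; _≗_; refl; sym; trans; cong; cong₂; subst; module ≡-Reasoning)
open import Relation.Binary.Structures using (IsTotalOrder)
open import Relation.Nullary using (¬_; yes; no)
open import Relation.Nullary.Decidable.Core using (does)
open import Relation.Unary using (Pred; _∈_; _⊆_; Satisfiable)

-- Linearly independent vectors of `s (K − K)` may generate only a proper sublattice, so they cannot
-- in general be the edges of the simplex themselves. Passing to the zonotope costs nothing: b + Σⱼ
-- tⱼ vⱼ = s Σⱼ (yⱼ + tⱼ (xⱼ - yⱼ)) replaces each yⱼ by a point of the segment from yⱼ to xⱼ, so the
-- number of summands stays d. This is the origin of the factor d, and the reason for insisting on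
-- coefficients in [0, 1].
--
-- A supremum forces lattice points only in bodies whose width is strictly larger. That strict
-- surplus pays for the slow shifts: half of it is given up to shrink the body a little, and the
-- room gained is exactly what lets two consecutive lattice points differ by an element of
-- `s (K − K)`. The dilation by 1 + h manufactures the surplus when the width hypothesis is an
-- equality.

module ℤΣ = SemiringSum (CommutativeRing.semiring ℤₚ.+-*-commutativeRing)

-- Determinants

ℤ+-congˡ : ∀ x {y z} → y ≡ z → x ℤ.+ y ≡ x ℤ.+ z
ℤ+-congˡ x = cong (λ t → x ℤ.+ t)

sgn : ∀ {n} → Fin n → ℤ
sgn j = ℤ.-1ℤ ℤ.^ toℕ j

det-cong : ∀ {d} {A B : Matrix d} → (∀ i j → A i j ≡ B i j) → det A ≡ det B
det-cong {zero}  A≗B = refl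
det-cong {suc d} A≗B = ℤΣ.sum-cong-≗ λ j →
  cong₂ ℤ._*_ (cong (sgn j ℤ.*_) (A≗B zero j)) (det-cong λ i k → A≗B (suc i) (punchIn j k))

det-zeroColumn : ∀ {d} (A : Matrix (suc d)) → (∀ i → A i zero ≡ ℤ.0ℤ) → det A ≡ ℤ.0ℤ
det-zeroColumn {d} A A≗0 = trans (ℤΣ.sum-cong-≗ term≡0) (ℤΣ.sum-replicate-zero (suc d))
  where
  term≡0 : ∀ j → sgn j ℤ.* A zero j ℤ.* det (λ i k → A (suc i) (punchIn j k)) ≡ ℤ.0ℤ
  term≡0 zero    = cong (ℤ._* det (λ i k → A (suc i) (suc k)))
                     (trans (cong (ℤ.1ℤ ℤ.*_) (A≗0 zero)) refl)
  term≡0 (suc {suc n} j) = trans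
    (cong (sgn (suc j) ℤ.* A zero (suc j) ℤ.*_) (det-zeroColumn (λ i k → A (suc i) (punchIn (suc j) k)) (A≗0 ∘ suc)))
    (ℤₚ.*-zeroʳ (sgn (suc j) ℤ.* A zero (suc j)))

-- Minors that omit a later column keep column `zero`, which vanishes below the top row, so one term
-- of the expansion survives. This evaluates the determinant when a lower-dimensional basis is
-- extended by `e₁`.
det-blockTriangular : ∀ {d} (A : Matrix (suc d)) → (∀ i → A (suc i) zero ≡ ℤ.0ℤ) →
  det A ≡ A zero zero ℤ.* det (λ i k → A (suc i) (suc k))
det-blockTriangular {d} A A≡0 = begin
  ℤ.1ℤ ℤ.* A zero zero ℤ.* D ℤ.+ sumℤ (λ j → term (suc j))
    ≡⟨ cong₂ ℤ._+_ (cong (ℤ._* D) (ℤₚ.*-identityˡ (A zero zero)))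
         (trans (ℤΣ.sum-cong-≗ term≡0) (ℤΣ.sum-replicate-zero d)) ⟩
  A zero zero ℤ.* D ℤ.+ ℤ.0ℤ
    ≡⟨ ℤₚ.+-identityʳ _ ⟩
  A zero zero ℤ.* D ∎
  where
  open ≡-Reasoning
  D = det (λ i k → A (suc i) (suc k))
  term : Fin (suc d) → ℤ
  term j = sgn j ℤ.* A zero j ℤ.* det (λ i k → A (suc i) (punchIn j k))
  zeroMinor : ∀ {d} (A : Fin d → Fin (suc d) → ℤ) → (∀ i → A i zero ≡ ℤ.0ℤ) →
    ∀ j → det (λ i k → A i (punchIn (suc j) k)) ≡ ℤ.0ℤ
  zeroMinor {suc d} A A≡0 j = det-zeroColumn (λ i k → A i (punchIn (suc j) k)) A≡0
  term≡0 : ∀ j → term (suc j) ≡ ℤ.0ℤ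
  term≡0 j = trans (cong (sgn (suc j) ℤ.* A zero (suc j) ℤ.*_) (zeroMinor (A ∘ suc) A≡0 j))
                   (ℤₚ.*-zeroʳ (sgn (suc j) ℤ.* A zero (suc j)))

-- Double Laplace expansion along two rows r and s; m j k is the minor that
-- omits column j and then column k of the remaining ones.
laplace₂ : ∀ {n} → (r s : Vector ℤ (suc (suc n))) → (Fin (suc (suc n)) → Fin (suc n) → ℤ) → ℤ
laplace₂ r s m = sumℤ λ j → sgn j ℤ.* r j ℤ.* sumℤ λ k → sgn k ℤ.* s (punchIn j k) ℤ.* m j k

-- The indices `j k` encode the ordered pair of distinct columns `j` and `punchIn j k`. The
-- recursion compares both orders of each pair, those containing column `zero` first: the reverse of
-- `zero , k` is `suc k , zero`.
Symmetric₂ : ∀ {n} → (Fin (suc (suc n)) → Fin (suc n) → ℤ) → Set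
Symmetric₂ {zero}  g = g zero zero ≡ g (suc zero) zero
Symmetric₂ {suc n} g = (∀ k → g zero k ≡ g (suc k) zero) × Symmetric₂ (λ j k → g (suc j) (suc k))

-- The later of two columns moves down one place once the earlier is removed, so the two orders of a
-- pair carry opposite signs and their equal values cancel.
alternatingSum-symmetric : ∀ {n} (g : Fin (suc (suc n)) → Fin (suc n) → ℤ) → Symmetric₂ g →
  (sumℤ λ j → sumℤ λ k → sgn j ℤ.* sgn k ℤ.* g j k) ≡ ℤ.0ℤ
alternatingSum-symmetric {zero} g eq = begin
  _ ≡⟨ (lemma (g zero zero) (g (suc zero) zero)) ⟩
  g zero zero ℤ.- g (suc zero) zero ≡⟨ ℤₚ.i≡j⇒i-j≡0 eq ⟩
  ℤ.0ℤ ∎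
  where
  open ≡-Reasoning
  lemma : ∀ a b → (ℤ.1ℤ ℤ.* a ℤ.+ ℤ.0ℤ) ℤ.+ ((ℤ.-1ℤ ℤ.* b ℤ.+ ℤ.0ℤ) ℤ.+ ℤ.0ℤ) ≡ a ℤ.- b
  lemma = solve-∀
alternatingSum-symmetric {suc n} g (eq , sym-g) = begin
  sumℤ (λ k → ℤ.1ℤ ℤ.* sgn k ℤ.* g zero k) ℤ.+
    sumℤ (λ j → sgn (suc j) ℤ.* ℤ.1ℤ ℤ.* g (suc j) zero ℤ.+
               sumℤ (λ k → sgn (suc j) ℤ.* sgn (suc k) ℤ.* g (suc j) (suc k)))
    ≡⟨ ℤ+-congˡ X (ℤΣ.∑-distrib-+ Y Z) ⟩
  X ℤ.+ (sumℤ Y ℤ.+ sumℤ Z)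
    ≡⟨ ℤₚ.+-assoc X (sumℤ Y) (sumℤ Z) ⟨
  X ℤ.+ sumℤ Y ℤ.+ sumℤ Z
    ≡⟨ cong₂ ℤ._+_ (sym (ℤΣ.∑-distrib-+ (λ k → ℤ.1ℤ ℤ.* sgn k ℤ.* g zero k) Y)) (ℤΣ.sum-cong-≗ λ j → ℤΣ.sum-cong-≗ λ k →
         signs (sgn j) (sgn k) (g (suc j) (suc k))) ⟩
  sumℤ (λ k → ℤ.1ℤ ℤ.* sgn k ℤ.* g zero k ℤ.+ Y k) ℤ.+
    sumℤ (λ j → sumℤ λ k → sgn j ℤ.* sgn k ℤ.* g (suc j) (suc k))
    ≡⟨ cong₂ ℤ._+_ (trans (ℤΣ.sum-cong-≗ cancel) (ℤΣ.sum-replicate-zero (suc (suc n))))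
                   (alternatingSum-symmetric _ sym-g) ⟩
  ℤ.0ℤ ∎
  where
  open ≡-Reasoning
  X = sumℤ (λ k → ℤ.1ℤ ℤ.* sgn k ℤ.* g zero k)
  Y = λ j → sgn (suc j) ℤ.* ℤ.1ℤ ℤ.* g (suc j) zero
  Z = λ j → sumℤ (λ k → sgn (suc j) ℤ.* sgn (suc k) ℤ.* g (suc j) (suc k))
  signs : ∀ a b c → (ℤ.-1ℤ ℤ.* a) ℤ.* (ℤ.-1ℤ ℤ.* b) ℤ.* c ≡ a ℤ.* b ℤ.* c
  signs = solve-∀
  flip : ∀ a b → ℤ.1ℤ ℤ.* a ℤ.* b ℤ.+ (ℤ.-1ℤ ℤ.* a) ℤ.* ℤ.1ℤ ℤ.* b ≡ ℤ.0ℤ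
  flip = solve-∀
  cancel : ∀ k → ℤ.1ℤ ℤ.* sgn k ℤ.* g zero k ℤ.+ Y k ≡ ℤ.0ℤ
  cancel k rewrite eq k = flip (sgn k) (g (suc k) zero)

∑-combine : ∀ {n} a (f g : Vector ℤ n) → (sumℤ λ i → f i ℤ.+ a ℤ.* g i) ≡ (sumℤ f) ℤ.+ (a ℤ.* sumℤ g)
∑-combine a f g = trans (ℤΣ.∑-distrib-+ f _) (ℤ+-congˡ (sumℤ f) (sym (ℤΣ.*-distribˡ-sum a g)))

laplace₂-linearˡ : ∀ {n} a (r r′ s : Vector ℤ (suc (suc n))) m →
  laplace₂ (λ i → r i ℤ.+ a ℤ.* r′ i) s m ≡ laplace₂ r s m ℤ.+ a ℤ.* laplace₂ r′ s m
laplace₂-linearˡ a r r′ s m = trans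
  (ℤΣ.sum-cong-≗ λ j → expand (sgn j) (r j) a (r′ j) (inner j))
  (∑-combine a (λ j → sgn j ℤ.* r j ℤ.* inner j) (λ j → sgn j ℤ.* r′ j ℤ.* inner j))
  where
  inner : Vector ℤ _
  inner j = sumℤ λ k → sgn k ℤ.* s (punchIn j k) ℤ.* m j k
  expand : ∀ ε x a y z → ε ℤ.* (x ℤ.+ a ℤ.* y) ℤ.* z ≡ ε ℤ.* x ℤ.* z ℤ.+ a ℤ.* (ε ℤ.* y ℤ.* z)
  expand = solve-∀

laplace₂-linearʳ : ∀ {n} a (r s s′ : Vector ℤ (suc (suc n))) m →
  laplace₂ r (λ i → s i ℤ.+ a ℤ.* s′ i) m ≡ laplace₂ r s m ℤ.+ a ℤ.* laplace₂ r s′ m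
laplace₂-linearʳ a r s s′ m = trans
  (ℤΣ.sum-cong-≗ λ j → trans
    (cong (sgn j ℤ.* r j ℤ.*_) (trans
      (ℤΣ.sum-cong-≗ λ k → expand (sgn k) (s (punchIn j k)) a (s′ (punchIn j k)) (m j k))
      (∑-combine a (term s j) (term s′ j))))
    (distribute (sgn j ℤ.* r j) (sumℤ (term s j)) a (sumℤ (term s′ j))))
  (∑-combine a (λ j → sgn j ℤ.* r j ℤ.* sumℤ (term s j)) (λ j → sgn j ℤ.* r j ℤ.* sumℤ (term s′ j)))
  where
  term : Vector ℤ _ → ∀ j → Vector ℤ _
  term t j k = sgn k ℤ.* t (punchIn j k) ℤ.* m j k
  expand : ∀ ε x a y z → ε ℤ.* (x ℤ.+ a ℤ.* y) ℤ.* z ≡ ε ℤ.* x ℤ.* z ℤ.+ a ℤ.* (ε ℤ.* y ℤ.* z)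
  expand = solve-∀
  distribute : ∀ c x a y → c ℤ.* (x ℤ.+ a ℤ.* y) ≡ c ℤ.* x ℤ.+ a ℤ.* (c ℤ.* y)
  distribute = solve-∀

laplace₂-diagonal : ∀ {n} (r : Vector ℤ (suc (suc n))) m →
  Symmetric₂ (λ j k → r j ℤ.* r (punchIn j k) ℤ.* m j k) → laplace₂ r r m ≡ ℤ.0ℤ
laplace₂-diagonal r m sym-m = trans
  (ℤΣ.sum-cong-≗ λ j → trans (ℤΣ.*-distribˡ-sum (sgn j ℤ.* r j) (λ k → sgn k ℤ.* r (punchIn j k) ℤ.* m j k))
    (ℤΣ.sum-cong-≗ λ k → rearrange (sgn j) (r j) (sgn k) (r (punchIn j k)) (m j k)))
  (alternatingSum-symmetric _ sym-m)
  where
  rearrange : ∀ a x b y z → a ℤ.* x ℤ.* (b ℤ.* y ℤ.* z) ≡ a ℤ.* b ℤ.* (x ℤ.* y ℤ.* z)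
  rearrange = solve-∀

-- Deleting two columns in either order leaves the same map of surviving columns. The minor is
-- generalised to an extensional function `μ` of that map because, for pairs avoiding column `zero`,
-- this column survives and the induction passes to `μ (zero ∷ (suc ∘ φ))`.
minors₂-symmetric : ∀ {n} (r : Vector ℤ (suc (suc n))) (μ : (Fin n → Fin (suc (suc n))) → ℤ) →
  (∀ {φ ψ} → φ ≗ ψ → μ φ ≡ μ ψ) →
  Symmetric₂ (λ j k → r j ℤ.* r (punchIn j k) ℤ.* μ (λ l → punchIn j (punchIn k l)))
minors₂-symmetric {zero} r μ μ-cong =
  cong₂ ℤ._*_ (ℤₚ.*-comm (r zero) (r (suc zero))) (μ-cong λ ())
minors₂-symmetric {suc n} r μ μ-cong =
  (λ k → cong (ℤ._* μ (λ l → suc (punchIn k l))) (ℤₚ.*-comm (r zero) (r (suc k)))) ,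
  symmetric-tail (minors₂-symmetric (r ∘ suc) (λ φ → μ (zero ∷ (suc ∘ φ)))
    (λ φ≗ψ → μ-cong λ { zero → refl ; (suc l) → cong suc (φ≗ψ l) }))
  where
  transport : ∀ {n} {g h : Fin (suc (suc n)) → Fin (suc n) → ℤ} →
    (∀ j k → g j k ≡ h j k) → Symmetric₂ g → Symmetric₂ h
  transport {zero}  g≗h p = trans (sym (g≗h _ _)) (trans p (g≗h _ _))
  transport {suc n} g≗h (p , q) =
    (λ k → trans (sym (g≗h _ _)) (trans (p k) (g≗h _ _))) , transport (λ j k → g≗h (suc j) (suc k)) q
  symmetric-tail = transport λ j k → cong (r (suc j) ℤ.* r (suc (punchIn j k)) ℤ.*_)
    (μ-cong λ { zero → refl ; (suc l) → refl })

-- Alternation in the first two rows is enough for all row operations below: deeper rows are reached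
-- through `lift`, where expansion along the first row transfers the claim to the minors.
laplace₂-minors-diagonal : ∀ {n} (r : Vector ℤ (suc (suc n))) (rest : Fin n → Vector ℤ (suc (suc n))) →
  laplace₂ r r (λ j k → det λ i l → rest i (punchIn j (punchIn k l))) ≡ ℤ.0ℤ
laplace₂-minors-diagonal r rest = laplace₂-diagonal r _
  (minors₂-symmetric r (λ φ → det λ i l → rest i (φ l)) λ φ≗ψ → det-cong λ i l → cong (rest i) (φ≗ψ l))

-- Integral functionals, unimodular transformations and lattice bases

-- Additivity and homogeneity are fused into the shape `x + a y` of a row operation; taking `a = −1`
-- and `x = y = 0` gives the value at zero, from which the usual laws follow.
record IsFunctional {d} (f : Vector ℤ d → ℤ) : Set where
  field
    cong-≗ : ∀ {x y} → x ≗ y → f x ≡ f y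
    linear : ∀ x a y → f (λ i → x i ℤ.+ a ℤ.* y i) ≡ f x ℤ.+ a ℤ.* f y

  zero-homo : f (λ _ → ℤ.0ℤ) ≡ ℤ.0ℤ
  zero-homo = trans (linear (λ _ → ℤ.0ℤ) ℤ.-1ℤ (λ _ → ℤ.0ℤ)) (cancel (f (λ _ → ℤ.0ℤ)))
    where
    cancel : ∀ a → a ℤ.+ ℤ.-1ℤ ℤ.* a ≡ ℤ.0ℤ
    cancel = solve-∀

  *-homo : ∀ a y → f (λ i → a ℤ.* y i) ≡ a ℤ.* f y
  *-homo a y = begin
    f (λ i → a ℤ.* y i)             ≡⟨ cong-≗ (λ i → sym (ℤₚ.+-identityˡ (a ℤ.* y i))) ⟩
    f (λ i → ℤ.0ℤ ℤ.+ a ℤ.* y i)    ≡⟨ linear (λ _ → ℤ.0ℤ) a y ⟩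
    f (λ _ → ℤ.0ℤ) ℤ.+ a ℤ.* f y    ≡⟨ cong (λ t → t ℤ.+ a ℤ.* f y) zero-homo ⟩
    ℤ.0ℤ ℤ.+ a ℤ.* f y              ≡⟨ ℤₚ.+-identityˡ (a ℤ.* f y) ⟩
    a ℤ.* f y                       ∎
    where open ≡-Reasoning

  ∑-homo : ∀ {n} (c : Vector ℤ n) (V : Fin n → Vector ℤ d) →
    f (λ i → sumℤ λ j → c j ℤ.* V j i) ≡ (sumℤ λ j → c j ℤ.* f (V j))
  ∑-homo {zero}  c V = zero-homo
  ∑-homo {suc n} c V = begin
    f (λ i → c zero ℤ.* V zero i ℤ.+ rest i)  ≡⟨ cong-≗ (λ i → ℤₚ.+-comm (c zero ℤ.* V zero i) (rest i)) ⟩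
    f (λ i → rest i ℤ.+ c zero ℤ.* V zero i)  ≡⟨ linear rest (c zero) (V zero) ⟩
    f rest ℤ.+ c zero ℤ.* f (V zero)          ≡⟨ ℤₚ.+-comm (f rest) _ ⟩
    c zero ℤ.* f (V zero) ℤ.+ f rest          ≡⟨ ℤ+-congˡ (c zero ℤ.* f (V zero)) (∑-homo (c ∘ suc) (V ∘ suc)) ⟩
    c zero ℤ.* f (V zero) ℤ.+ (sumℤ λ j → c (suc j) ℤ.* f (V (suc j))) ∎
    where
    open ≡-Reasoning
    rest : Vector ℤ d
    rest i = sumℤ λ j → c (suc j) ℤ.* V (suc j) i

IsLinear : ∀ {m n} → (Vector ℤ m → Vector ℤ n) → Set
IsLinear F = ∀ i → IsFunctional (λ x → F x i)

projection : ∀ {d} (i : Fin d) → IsFunctional (λ x → x i)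
projection i = record { cong-≗ = λ x≗y → x≗y i ; linear = λ _ _ _ → refl }

∘-functional : ∀ {m n} {f : Vector ℤ n → ℤ} {F : Vector ℤ m → Vector ℤ n} →
  IsFunctional f → IsLinear F → IsFunctional (f ∘ F)
∘-functional {F = F} ϕ Φ = record
  { cong-≗ = λ x≗y → f.cong-≗ λ i → IsFunctional.cong-≗ (Φ i) x≗y
  ; linear = λ x a y → trans (f.cong-≗ λ i → IsFunctional.linear (Φ i) x a y) (f.linear (F x) a (F y))
  }
  where module f = IsFunctional ϕ

-- A pair of inverse linear maps takes the place of a matrix. `det-from` says that acting on every
-- column preserves the determinant; stated this way it composes directly, without multiplicativity
-- of `det`. All transformations built here have determinant 1, so no sign appears.
record Unimodular (d : ℕ) : Set where
  field
    to from     : Vector ℤ d → Vector ℤ d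
    to-linear   : IsLinear to
    from-linear : IsLinear from
    to∘from     : ∀ x → to (from x) ≗ x
    from∘to     : ∀ x → from (to x) ≗ x
    det-from    : ∀ A → det (λ i j → from (λ k → A k j) i) ≡ det A

identity : ∀ {d} → Unimodular d
identity = record
  { to = id ; from = id ; to-linear = projection ; from-linear = projection
  ; to∘from = λ _ _ → refl ; from∘to = λ _ _ → refl ; det-from = λ _ → refl }

infixr 9 _⊚_

_⊚_ : ∀ {d} → Unimodular d → Unimodular d → Unimodular d
Θ ⊚ Ψ = record
  { to = Θ.to ∘ Ψ.to
  ; from = Ψ.from ∘ Θ.from
  ; to-linear = λ i → ∘-functional (Θ.to-linear i) Ψ.to-linear
  ; from-linear = λ i → ∘-functional (Ψ.from-linear i) Θ.from-linear
  ; to∘from = λ x i → trans (IsFunctional.cong-≗ (Θ.to-linear i) (Ψ.to∘from (Θ.from x))) (Θ.to∘from x i)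
  ; from∘to = λ x i → trans (IsFunctional.cong-≗ (Ψ.from-linear i) (Θ.from∘to (Ψ.to x))) (Ψ.from∘to x i)
  ; det-from = λ A → trans (Ψ.det-from (λ i j → Θ.from (λ k → A k j) i)) (Θ.det-from A)
  }
  where module Θ = Unimodular Θ ; module Ψ = Unimodular Ψ

onTail : ∀ {d} → (Vector ℤ d → Vector ℤ d) → Vector ℤ (suc d) → Vector ℤ (suc d)
onTail F x = x zero ∷ F (tail x)

onTail-linear : ∀ {d} {F : Vector ℤ d → Vector ℤ d} → IsLinear F → IsLinear (onTail F)
onTail-linear F-linear zero    = projection zero
onTail-linear F-linear (suc i) = ∘-functional (F-linear i) (projection ∘ suc)

lift : ∀ {d} → Unimodular d → Unimodular (suc d)
lift Φ = record
  { to = onTail Φ.to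
  ; from = onTail Φ.from
  ; to-linear = onTail-linear Φ.to-linear
  ; from-linear = onTail-linear Φ.from-linear
  ; to∘from = λ { x zero → refl ; x (suc i) → Φ.to∘from (tail x) i }
  ; from∘to = λ { x zero → refl ; x (suc i) → Φ.from∘to (tail x) i }
  ; det-from = λ A → ℤΣ.sum-cong-≗ λ j →
      cong (sgn j ℤ.* A zero j ℤ.*_) (Φ.det-from λ i k → A (suc i) (punchIn j k))
  }
  where module Φ = Unimodular Φ

addRow↑ : ∀ {d} → ℤ → Vector ℤ (suc (suc d)) → Vector ℤ (suc (suc d))
addRow↑ c x = (x zero ℤ.+ c ℤ.* x (suc zero)) ∷ tail x

addRow↓ : ∀ {d} → ℤ → Vector ℤ (suc (suc d)) → Vector ℤ (suc (suc d))
addRow↓ c x = x zero ∷ (x (suc zero) ℤ.+ c ℤ.* x zero) ∷ tail (tail x)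

combination-functional : ∀ {d} (i j : Fin d) c → IsFunctional (λ x → x i ℤ.+ c ℤ.* x j)
combination-functional i j c = record
  { cong-≗ = λ x≗y → cong₂ (λ s t → s ℤ.+ c ℤ.* t) (x≗y i) (x≗y j)
  ; linear = λ x a y → expand c (x i) a (y i) (x j) (y j) }
  where
  expand : ∀ c x a y x′ y′ → x ℤ.+ a ℤ.* y ℤ.+ c ℤ.* (x′ ℤ.+ a ℤ.* y′) ≡
                              x ℤ.+ c ℤ.* x′ ℤ.+ a ℤ.* (y ℤ.+ c ℤ.* y′)
  expand = solve-∀

addRow↑-linear : ∀ {d} c → IsLinear (addRow↑ {d} c)
addRow↑-linear c zero    = combination-functional zero (suc zero) c
addRow↑-linear c (suc i) = projection (suc i)

addRow↓-linear : ∀ {d} c → IsLinear (addRow↓ {d} c)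
addRow↓-linear c zero          = projection zero
addRow↓-linear c (suc zero)    = combination-functional (suc zero) zero c
addRow↓-linear c (suc (suc i)) = projection (suc (suc i))

minors₂ : ∀ {n} → Matrix (suc (suc n)) → Fin (suc (suc n)) → Fin (suc n) → ℤ
minors₂ A j k = det λ i l → A (suc (suc i)) (punchIn j (punchIn k l))

cancel-+ : ∀ a c → a ℤ.+ c ℤ.* ℤ.0ℤ ≡ a
cancel-+ = solve-∀

det-addRow↑ : ∀ {d} c (A : Matrix (suc (suc d))) → det (λ i j → addRow↑ c (λ k → A k j) i) ≡ det A
det-addRow↑ c A = begin
  laplace₂ (λ j → A zero j ℤ.+ c ℤ.* A (suc zero) j) (A (suc zero)) (minors₂ A)
    ≡⟨ laplace₂-linearˡ c (A zero) (A (suc zero)) (A (suc zero)) (minors₂ A) ⟩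
  det A ℤ.+ c ℤ.* laplace₂ (A (suc zero)) (A (suc zero)) (minors₂ A)
    ≡⟨ cong (λ t → det A ℤ.+ c ℤ.* t) (laplace₂-minors-diagonal (A (suc zero)) (λ i → A (suc (suc i)))) ⟩
  det A ℤ.+ c ℤ.* ℤ.0ℤ
    ≡⟨ cancel-+ (det A) c ⟩
  det A ∎
  where open ≡-Reasoning

det-addRow↓ : ∀ {d} c (A : Matrix (suc (suc d))) → det (λ i j → addRow↓ c (λ k → A k j) i) ≡ det A
det-addRow↓ c A = begin
  laplace₂ (A zero) (λ j → A (suc zero) j ℤ.+ c ℤ.* A zero j) (minors₂ A)
    ≡⟨ laplace₂-linearʳ c (A zero) (A (suc zero)) (A zero) (minors₂ A) ⟩
  det A ℤ.+ c ℤ.* laplace₂ (A zero) (A zero) (minors₂ A)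
    ≡⟨ cong (λ t → det A ℤ.+ c ℤ.* t) (laplace₂-minors-diagonal (A zero) (λ i → A (suc (suc i)))) ⟩
  det A ℤ.+ c ℤ.* ℤ.0ℤ
    ≡⟨ cancel-+ (det A) c ⟩
  det A ∎
  where open ≡-Reasoning

undo : ∀ c a b → a ℤ.+ ℤ.- c ℤ.* b ℤ.+ c ℤ.* b ≡ a
undo = solve-∀

undo′ : ∀ c a b → a ℤ.+ c ℤ.* b ℤ.+ ℤ.- c ℤ.* b ≡ a
undo′ = solve-∀

shear↑ shear↓ : ∀ {d} → ℤ → Unimodular (suc (suc d))
shear↑ c = record
  { to = addRow↑ c ; from = addRow↑ (ℤ.- c)
  ; to-linear = addRow↑-linear c ; from-linear = addRow↑-linear (ℤ.- c)
  ; to∘from = λ { x zero → undo c (x zero) (x (suc zero)) ; x (suc i) → refl }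
  ; from∘to = λ { x zero → undo′ c (x zero) (x (suc zero)) ; x (suc i) → refl }
  ; det-from = det-addRow↑ (ℤ.- c) }
shear↓ c = record
  { to = addRow↓ c ; from = addRow↓ (ℤ.- c)
  ; to-linear = addRow↓-linear c ; from-linear = addRow↓-linear (ℤ.- c)
  ; to∘from = λ { x zero → refl ; x (suc zero) → undo c (x (suc zero)) (x zero) ; x (suc (suc i)) → refl }
  ; from∘to = λ { x zero → refl ; x (suc zero) → undo′ c (x (suc zero)) (x zero) ; x (suc (suc i)) → refl }
  ; det-from = det-addRow↓ (ℤ.- c) }

-- Euclid's algorithm on the first two coordinates.
reduce₂ : ∀ {d} (x : Vector ℤ (suc (suc d))) → Acc ℕ._<_ ℤ.∣ x (suc zero) ∣ →
  Σ[ Φ ∈ Unimodular (suc (suc d)) ] Unimodular.to Φ x (suc zero) ≡ ℤ.0ℤ ×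
    (∀ i → Unimodular.to Φ x (suc (suc i)) ≡ x (suc (suc i)))
reduce₂ x (acc rec) with x (suc zero) ℤₚ.≟ ℤ.0ℤ
... | yes x₁≡0 = identity , x₁≡0 , λ _ → refl
... | no  x₁≢0 = step
  where
  instance x₁-nonZero = ℤ.≢-nonZero x₁≢0
  q = x zero ℤ./ x (suc zero)
  r = x zero ℤ.% x (suc zero)
  y = addRow↑ (ℤ.- q) x
  subtract : ∀ a q b → a ℤ.+ q ℤ.* b ℤ.+ ℤ.- q ℤ.* b ≡ a
  subtract = solve-∀
  y₀≡r : y zero ≡ + r
  y₀≡r = trans (cong (λ t → t ℤ.+ ℤ.- q ℤ.* x (suc zero)) (ℤ.a≡a%n+[a/n]*n (x zero) (x (suc zero))))
               (subtract (+ r) q (x (suc zero)))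
  step : _
  step with y zero ℤₚ.≟ ℤ.0ℤ
  -- The vector is now `(0 , b)`. Two more shears send it to `(b , b)` and then `(b , 0)`; a
  -- transposition would flip the sign of the determinant.
  ... | yes y₀≡0 = shear↓ ℤ.-1ℤ ⊚ shear↑ ℤ.1ℤ ⊚ shear↑ (ℤ.- q) ,
        trans (cong (λ t → x (suc zero) ℤ.+ ℤ.-1ℤ ℤ.* (t ℤ.+ ℤ.1ℤ ℤ.* x (suc zero))) y₀≡0) (vanish (x (suc zero))) ,
        λ _ → refl
    where
    vanish : ∀ a → a ℤ.+ ℤ.-1ℤ ℤ.* (ℤ.0ℤ ℤ.+ ℤ.1ℤ ℤ.* a) ≡ ℤ.0ℤ
    vanish = solve-∀
  -- Both coordinates are divided before recursing, so that the measure is again the second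
  -- coordinate: it falls below `r`, which is below its old absolute value.
  ... | no  y₀≢0 = proj₁ next ⊚ shear↓ (ℤ.- q′) ⊚ shear↑ (ℤ.- q) , proj₂ next
    where
    instance y₀-nonZero = ℤ.≢-nonZero y₀≢0
    q′ = y (suc zero) ℤ./ y zero
    r′ = y (suc zero) ℤ.% y zero
    z = addRow↓ (ℤ.- q′) y
    z₁≡r′ : z (suc zero) ≡ + r′
    z₁≡r′ = trans (cong (λ t → t ℤ.+ ℤ.- q′ ℤ.* y zero) (ℤ.a≡a%n+[a/n]*n (y (suc zero)) (y zero)))
                  (subtract (+ r′) q′ (y zero))
    open ℕₚ.≤-Reasoning
    decreasing : ℤ.∣ z (suc zero) ∣ ℕ.< ℤ.∣ x (suc zero) ∣
    decreasing = begin-strict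
      ℤ.∣ z (suc zero) ∣ ≡⟨ cong ℤ.∣_∣ z₁≡r′ ⟩
      r′                 <⟨ ℤ.n%d<d (y (suc zero)) (y zero) ⟩
      ℤ.∣ y zero ∣       ≡⟨ cong ℤ.∣_∣ y₀≡r ⟩
      r                  <⟨ ℤ.n%d<d (x zero) (x (suc zero)) ⟩
      ℤ.∣ x (suc zero) ∣ ∎
    next = reduce₂ z (rec decreasing)

reduce : ∀ {d} (x : Vector ℤ (suc d)) →
  Σ[ Φ ∈ Unimodular (suc d) ] (∀ i → Unimodular.to Φ x (suc i) ≡ ℤ.0ℤ)
reduce {zero}  x = identity , λ ()
reduce {suc d} x with reduce (tail x)
... | Ψ , Ψx≡0 with reduce₂ (onTail (Unimodular.to Ψ) x) (<-wellFounded _)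
... | Θ , first , rest = Θ ⊚ lift Ψ , λ
  { zero    → first
  ; (suc i) → trans (rest i) (Ψx≡0 i) }

-- Lattice bases inside zonotopes of spanning sets

Symmetric : ∀ {d} → Pred (Vector ℤ d) 0ℓ → Set
Symmetric S = ∀ {v} → v ∈ S → (λ i → ℤ.-1ℤ ℤ.* v i) ∈ S

-- This says that `S` spans ℚᵈ. The dual form passes to projections of `S`, since functionals pull
-- back along them, and it can be proved by refuting a functional that vanishes on `S`.
Spanning : ∀ {d} → Pred (Vector ℤ d) 0ℓ → Set
Spanning S = ∀ {f} → IsFunctional f → (∃[ w ] ¬ f w ≡ ℤ.0ℤ) → ∃[ v ] v ∈ S × ¬ f v ≡ ℤ.0ℤ

-- A lattice basis, the columns of matrix, contained in the zonotope
-- {Σⱼ tⱼ vⱼ : 0 ≤ tⱼ ≤ 1} spanned by d elements of S.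
record ZonotopeBasis {d} (S : Pred (Vector ℤ d) 0ℓ) : Set where
  field
    matrix      : Matrix d
    unimodular  : det matrix ≡ ℤ.1ℤ
    denominator : ℕ
    positive    : 0 ℕ.< denominator
    generator   : Fin d → Vector ℤ d
    generator∈  : ∀ j → generator j ∈ S
    coefficient : Fin d → Fin d → ℕ
    bounded     : ∀ i j → coefficient i j ℕ.≤ denominator
    relation    : ∀ i k → + denominator ℤ.* matrix k i ≡ sumℤ λ j → + coefficient i j ℤ.* generator j k

-- Induction on `d`. In coordinates where some element of `S` is `G e₁`, dropping the first
-- coordinate projects `S` to ℤᵈ⁻¹, and the basis found there is lifted and completed by `e₁`. A
-- lift is determined only up to multiples of `e₁`, and this freedom brings the coefficient of the
-- new generator into [0, 1].
zonotopeBasis : ∀ {d} (S : Pred (Vector ℤ d) 0ℓ) → Symmetric S → Spanning S → ZonotopeBasis S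
zonotopeBasis {zero}  S S-symmetric S-spanning = record
  { matrix = λ () ; unimodular = refl ; denominator = 1 ; positive = ℕ.s≤s ℕ.z≤n
  ; generator = λ () ; generator∈ = λ () ; coefficient = λ () ; bounded = λ () ; relation = λ () }
zonotopeBasis {suc d} S S-symmetric S-spanning
  -- Any nonzero element of `S` would do; the first coordinate is a convenient functional that
  -- detects one.
  with S-spanning (projection zero) ((λ _ → ℤ.1ℤ) , λ ())
... | v , v∈S , v₀≢0 with reduce v
... | Φ , Φv≡0 = record
  { matrix = λ k i → from (λ l → M l i) k
  ; unimodular = trans (det-from M) det-M
  ; denominator = N
  ; positive = ℕₚ.*-mono-< B.positive (ℕ.s≤s ℕ.z≤n)
  ; generator = generator
  ; generator∈ = λ { zero → proj₁ (proj₂ u) ; (suc j) → proj₁ (proj₂ (B.generator∈ j)) }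
  ; coefficient = coefficient
  ; bounded = bounded
  ; relation = relation
  }
  where
  open Unimodular Φ
  module to i = IsFunctional (to-linear i)
  module from i = IsFunctional (from-linear i)

  -- Symmetry of `S` allows a change of sign, so that `to u = G e₁` with `G > 0` and `e₁` itself has
  -- the admissible coefficient `1 / G`. The remaining case `to v = 0` would force `v = 0`.
  u : ∃[ u ] u ∈ S × ∃[ m ] to u zero ≡ ℤ.+[1+ m ] × (∀ i → to u (suc i) ≡ ℤ.0ℤ)
  u with to v zero in Φv₀
  ... | ℤ.+[1+ m ]   = v , v∈S , m , Φv₀ , Φv≡0
  ... | ℤ.-[1+ m ]   = (λ i → ℤ.-1ℤ ℤ.* v i) , S-symmetric v∈S , m ,
    trans (to.*-homo zero ℤ.-1ℤ v) (trans (cong (ℤ.-1ℤ ℤ.*_) Φv₀) (cong ℤ.+[1+_] (ℕₚ.+-identityʳ m))) ,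
    λ i → trans (to.*-homo (suc i) ℤ.-1ℤ v) (cong (ℤ.-1ℤ ℤ.*_) (Φv≡0 i))
  ... | ℤ.+0 = ⊥-elim (v₀≢0 (begin
    v zero                   ≡⟨ from∘to v zero ⟨
    from (to v) zero         ≡⟨ from.cong-≗ zero (λ { zero → Φv₀ ; (suc i) → Φv≡0 i }) ⟩
    from (λ _ → ℤ.0ℤ) zero   ≡⟨ from.zero-homo zero ⟩
    ℤ.0ℤ                     ∎))
    where open ≡-Reasoning

  G : ℕ
  G = suc (proj₁ (proj₂ (proj₂ u)))

  S′ : Pred (Vector ℤ d) 0ℓ
  S′ w = ∃[ s ] s ∈ S × (∀ i → to s (suc i) ≡ w i)

  S′-symmetric : Symmetric S′
  S′-symmetric (s , s∈S , eq) = (λ i → ℤ.-1ℤ ℤ.* s i) , S-symmetric s∈S ,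
    λ i → trans (to.*-homo (suc i) ℤ.-1ℤ s) (cong (ℤ.-1ℤ ℤ.*_) (eq i))

  S′-spanning : Spanning S′
  S′-spanning {f} f-functional (w , fw≢0)
    with S-spanning (∘-functional f-functional (to-linear ∘ suc))
           (from (ℤ.0ℤ ∷ w) , λ eq → fw≢0 (trans
             (sym (IsFunctional.cong-≗ f-functional (λ i → to∘from (ℤ.0ℤ ∷ w) (suc i)))) eq))
  ... | s , s∈S , fs≢0 = (λ i → to s (suc i)) , (s , s∈S , λ _ → refl) , fs≢0

  module B = ZonotopeBasis (zonotopeBasis S′ S′-symmetric S′-spanning)

  instance denominator-nonZero = ℕ.>-nonZero B.positive

  N : ℕ
  N = B.denominator ℕ.* G

  generator : Fin (suc d) → Vector ℤ (suc d)
  generator zero    = proj₁ u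
  generator (suc j) = proj₁ (B.generator∈ j)

  -- `height i` is the first coordinate already fixed by the lower-dimensional coefficients,
  -- multiplied by their denominator. Adding `remainder i` turns it into `−quotient i` times that
  -- denominator, so dividing gives an integer, the top entry of `M`. Since `e₁ = u / G`, the
  -- coefficient of `u` is `remainder i / N`, which is below `1 / G`.
  height : Fin d → ℤ
  height i = sumℤ λ j → + B.coefficient i j ℤ.* to (generator (suc j)) zero

  remainder : Fin d → ℕ
  remainder i = (ℤ.- height i) ℤ.%ℕ B.denominator

  quotient : Fin d → ℤ
  quotient i = (ℤ.- height i) ℤ./ℕ B.denominator

  M : Matrix (suc d)
  M zero    zero    = ℤ.1ℤ
  M (suc k) zero    = ℤ.0ℤ
  M zero    (suc i) = ℤ.- quotient i
  M (suc k) (suc i) = B.matrix k i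

  det-M : det M ≡ ℤ.1ℤ
  det-M = trans (det-blockTriangular M (λ _ → refl)) (trans (ℤₚ.*-identityˡ (det B.matrix)) B.unimodular)

  coefficient : Fin (suc d) → Fin (suc d) → ℕ
  coefficient zero    zero    = B.denominator
  coefficient zero    (suc j) = 0
  coefficient (suc i) zero    = remainder i
  coefficient (suc i) (suc j) = B.coefficient i j ℕ.* G

  bounded : ∀ i j → coefficient i j ℕ.≤ N
  bounded zero    zero    = ℕₚ.m≤m*n B.denominator G
  bounded zero    (suc j) = ℕ.z≤n
  bounded (suc i) zero    = ℕₚ.≤-trans (ℕₚ.<⇒≤ (ℤ.n%ℕd<d (ℤ.- height i) B.denominator))
                                       (ℕₚ.m≤m*n B.denominator G)
  bounded (suc i) (suc j) = ℕₚ.*-monoˡ-≤ G (B.bounded i j)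

  ∑0 : ∀ l → (sumℤ λ j → ℤ.0ℤ ℤ.* to (generator (suc j)) l) ≡ ℤ.0ℤ
  ∑0 l = ℤΣ.sum-replicate-zero d

  scale : ∀ i l → (sumℤ λ j → + (B.coefficient i j ℕ.* G) ℤ.* to (generator (suc j)) l) ≡
                  + G ℤ.* (sumℤ λ j → + B.coefficient i j ℤ.* to (generator (suc j)) l)
  scale i l = trans
    (ℤΣ.sum-cong-≗ λ j → trans
      (cong (ℤ._* to (generator (suc j)) l) (ℤₚ.pos-* (B.coefficient i j) G))
      (swap (+ B.coefficient i j) (+ G) (to (generator (suc j)) l)))
    (sym (ℤΣ.*-distribˡ-sum (+ G) (λ j → + B.coefficient i j ℤ.* to (generator (suc j)) l)))
    where
    swap : ∀ a b c → a ℤ.* b ℤ.* c ≡ b ℤ.* (a ℤ.* c)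
    swap = solve-∀

  relationΦ : ∀ i l → + N ℤ.* M l i ≡ sumℤ λ j → + coefficient i j ℤ.* to (generator j) l
  relationΦ zero zero = sym (begin
    + B.denominator ℤ.* to (generator zero) zero ℤ.+ (sumℤ λ j → ℤ.0ℤ ℤ.* to (generator (suc j)) zero)
      ≡⟨ cong₂ (λ s t → + B.denominator ℤ.* s ℤ.+ t) (proj₁ (proj₂ (proj₂ (proj₂ u)))) (∑0 zero) ⟩
    + B.denominator ℤ.* + G ℤ.+ ℤ.0ℤ
      ≡⟨ ℤₚ.+-identityʳ _ ⟩
    + B.denominator ℤ.* + G
      ≡⟨ ℤₚ.pos-* B.denominator G ⟨
    + N
      ≡⟨ ℤₚ.*-identityʳ (+ N) ⟨
    + N ℤ.* ℤ.1ℤ ∎)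
    where open ≡-Reasoning
  relationΦ zero (suc l) = sym (begin
    + B.denominator ℤ.* to (generator zero) (suc l) ℤ.+ (sumℤ λ j → ℤ.0ℤ ℤ.* to (generator (suc j)) (suc l))
      ≡⟨ cong₂ (λ s t → + B.denominator ℤ.* s ℤ.+ t) (proj₂ (proj₂ (proj₂ (proj₂ u))) l) (∑0 (suc l)) ⟩
    + B.denominator ℤ.* ℤ.0ℤ ℤ.+ ℤ.0ℤ
      ≡⟨ vanish (+ B.denominator) (+ N) ⟩
    + N ℤ.* ℤ.0ℤ ∎)
    where
    open ≡-Reasoning
    vanish : ∀ a b → a ℤ.* ℤ.0ℤ ℤ.+ ℤ.0ℤ ≡ b ℤ.* ℤ.0ℤ
    vanish = solve-∀
  relationΦ (suc i) zero = sym (begin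
    + remainder i ℤ.* to (generator zero) zero ℤ.+
      (sumℤ λ j → + (B.coefficient i j ℕ.* G) ℤ.* to (generator (suc j)) zero)
      ≡⟨ cong₂ (λ s t → + remainder i ℤ.* s ℤ.+ t) (proj₁ (proj₂ (proj₂ (proj₂ u)))) (scale i zero) ⟩
    + remainder i ℤ.* + G ℤ.+ + G ℤ.* height i
      ≡⟨ collect (+ remainder i) (+ G) (height i) ⟩
    + G ℤ.* (+ remainder i ℤ.- ℤ.- height i)
      ≡⟨ cong (λ t → + G ℤ.* (+ remainder i ℤ.- t)) (ℤ.a≡a%ℕn+[a/ℕn]*n (ℤ.- height i) B.denominator) ⟩
    + G ℤ.* (+ remainder i ℤ.- (+ remainder i ℤ.+ quotient i ℤ.* + B.denominator))
      ≡⟨ cancel (+ G) (+ remainder i) (quotient i) (+ B.denominator) ⟩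
    + B.denominator ℤ.* + G ℤ.* (ℤ.- quotient i)
      ≡⟨ cong (ℤ._* (ℤ.- quotient i)) (ℤₚ.pos-* B.denominator G) ⟨
    + N ℤ.* (ℤ.- quotient i) ∎)
    where
    open ≡-Reasoning
    collect : ∀ r g h → r ℤ.* g ℤ.+ g ℤ.* h ≡ g ℤ.* (r ℤ.- ℤ.- h)
    collect = solve-∀
    cancel : ∀ g r q n → g ℤ.* (r ℤ.- (r ℤ.+ q ℤ.* n)) ≡ n ℤ.* g ℤ.* (ℤ.- q)
    cancel = solve-∀
  relationΦ (suc i) (suc l) = sym (begin
    + remainder i ℤ.* to (generator zero) (suc l) ℤ.+
      (sumℤ λ j → + (B.coefficient i j ℕ.* G) ℤ.* to (generator (suc j)) (suc l))
      ≡⟨ cong₂ (λ s t → + remainder i ℤ.* s ℤ.+ t) (proj₂ (proj₂ (proj₂ (proj₂ u))) l) (scale i (suc l)) ⟩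
    + remainder i ℤ.* ℤ.0ℤ ℤ.+ + G ℤ.* (sumℤ λ j → + B.coefficient i j ℤ.* to (generator (suc j)) (suc l))
      ≡⟨ cong (λ t → + remainder i ℤ.* ℤ.0ℤ ℤ.+ + G ℤ.* t) (trans
           (ℤΣ.sum-cong-≗ λ j → cong (+ B.coefficient i j ℤ.*_) (proj₂ (proj₂ (B.generator∈ j)) l))
           (sym (B.relation i l))) ⟩
    + remainder i ℤ.* ℤ.0ℤ ℤ.+ + G ℤ.* (+ B.denominator ℤ.* B.matrix l i)
      ≡⟨ collect (+ remainder i) (+ G) (+ B.denominator) (B.matrix l i) ⟩
    + B.denominator ℤ.* + G ℤ.* B.matrix l i
      ≡⟨ cong (ℤ._* B.matrix l i) (ℤₚ.pos-* B.denominator G) ⟨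
    + N ℤ.* B.matrix l i ∎)
    where
    open ≡-Reasoning
    collect : ∀ r g n b → r ℤ.* ℤ.0ℤ ℤ.+ g ℤ.* (n ℤ.* b) ≡ n ℤ.* g ℤ.* b
    collect = solve-∀

  relation : ∀ i k → + N ℤ.* from (λ l → M l i) k ≡ sumℤ λ j → + coefficient i j ℤ.* generator j k
  relation i k = begin
    + N ℤ.* from (λ l → M l i) k
      ≡⟨ from.*-homo k (+ N) (λ l → M l i) ⟨
    from (λ l → + N ℤ.* M l i) k
      ≡⟨ from.cong-≗ k (relationΦ i) ⟩
    from (λ l → sumℤ λ j → + coefficient i j ℤ.* to (generator j) l) k
      ≡⟨ from.∑-homo k (λ j → + coefficient i j) (λ j → to (generator j)) ⟩
    (sumℤ λ j → + coefficient i j ℤ.* from (to (generator j)) k)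
      ≡⟨ ℤΣ.sum-cong-≗ (λ j → cong (+ coefficient i j ℤ.*_) (from∘to (generator j) k)) ⟩
    (sumℤ λ j → + coefficient i j ℤ.* generator j k) ∎
    where open ≡-Reasoning

module Flatness (em : ExcludedMiddle 0ℓ) (ℝ : CompleteOrderedField) where

  open Geometry ℝ

  private
    module R = CommutativeRing commutativeRing
    module ≤ = IsTotalOrder isTotalOrder
    module × = SemiringMult R.semiring
    module ×′ = SemiringMult′ R.semiring
    module -‿ = RingProperties R.ring
    module ∑ = SemiringSum R.semiring

  open import Relation.Binary.Reasoning.Setoid R.setoid

  -- Arithmetic and order of ℝ and the embedding of ℤ

  fromℕ-+ : ∀ m n → fromℕ (m ℕ.+ n) ≈ fromℕ m + fromℕ n
  fromℕ-+ = ×.×-homo-+ 1#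

  fromℕ-* : ∀ m n → fromℕ (m ℕ.* n) ≈ fromℕ m * fromℕ n
  fromℕ-* = ×.×1-homo-*

  fromℤ-⊖ : ∀ m n → fromℤ (m ℤ.⊖ n) ≈ fromℕ m + - fromℕ n
  fromℤ-⊖ m       zero    = R.sym (R.trans (R.+-congˡ -‿.-0#≈0#) (R.+-identityʳ (fromℕ m)))
  fromℤ-⊖ zero    (suc n) = R.sym (R.+-identityˡ (- fromℕ (suc n)))
  fromℤ-⊖ (suc m) (suc n) = begin
    fromℤ (suc m ℤ.⊖ suc n)                  ≡⟨ cong fromℤ (ℤₚ.[1+m]⊖[1+n]≡m⊖n m n) ⟩
    fromℤ (m ℤ.⊖ n)                          ≈⟨ fromℤ-⊖ m n ⟩
    fromℕ m + - fromℕ n                      ≈⟨ R.+-congʳ (R.+-identityʳ (fromℕ m)) ⟨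
    fromℕ m + 0# + - fromℕ n                 ≈⟨ R.+-congʳ (R.+-congˡ (R.-‿inverseʳ 1#)) ⟨
    fromℕ m + (1# + - 1#) + - fromℕ n        ≈⟨ R.+-congʳ (R.+-assoc (fromℕ m) 1# (- 1#)) ⟨
    fromℕ m + 1# + - 1# + - fromℕ n          ≈⟨ R.+-assoc (fromℕ m + 1#) (- 1#) (- fromℕ n) ⟩
    fromℕ m + 1# + (- 1# + - fromℕ n)        ≈⟨ R.+-cong (R.+-comm (fromℕ m) 1#) (-‿.-‿+-comm 1# (fromℕ n)) ⟩
    fromℕ (suc m) + - fromℕ (suc n)          ∎

  fromℤ-neg : ∀ a → fromℤ (ℤ.- a) ≈ - fromℤ a
  fromℤ-neg ℤ.+0       = R.sym -‿.-0#≈0#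
  fromℤ-neg ℤ.+[1+ n ] = R.refl
  fromℤ-neg ℤ.-[1+ n ] = R.sym (-‿.-‿involutive (fromℕ (suc n)))

  fromℤ-+ : ∀ a b → fromℤ (a ℤ.+ b) ≈ fromℤ a + fromℤ b
  fromℤ-+ (+ m)      (+ n)      = fromℕ-+ m n
  fromℤ-+ (+ m)      ℤ.-[1+ n ] = fromℤ-⊖ m (suc n)
  fromℤ-+ ℤ.-[1+ m ] (+ n)      = R.trans (fromℤ-⊖ n (suc m)) (R.+-comm _ _)
  fromℤ-+ ℤ.-[1+ m ] ℤ.-[1+ n ] = begin
    - fromℕ (suc (suc (m ℕ.+ n)))          ≡⟨ cong (λ k → - fromℕ (suc k)) (ℕₚ.+-suc m n) ⟨
    - fromℕ (suc m ℕ.+ suc n)              ≈⟨ R.-‿cong (fromℕ-+ (suc m) (suc n)) ⟩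
    - (fromℕ (suc m) + fromℕ (suc n))      ≈⟨ -‿.-‿+-comm (fromℕ (suc m)) (fromℕ (suc n)) ⟨
    - fromℕ (suc m) + - fromℕ (suc n)      ∎

  fromℤ-* : ∀ a b → fromℤ (a ℤ.* b) ≈ fromℤ a * fromℤ b
  fromℤ-* a b = signs a b
    where
    pos : ∀ m b → fromℤ (+ m ℤ.* b) ≈ fromℕ m * fromℤ b
    pos m (+ n) = begin
      fromℤ (+ m ℤ.* + n) ≡⟨ cong fromℤ (ℤₚ.pos-* m n) ⟨
      fromℕ (m ℕ.* n)     ≈⟨ fromℕ-* m n ⟩
      fromℕ m * fromℕ n   ∎
    pos m ℤ.-[1+ n ] = begin
      fromℤ (+ m ℤ.* ℤ.-[1+ n ])        ≡⟨ cong fromℤ (ℤₚ.neg-distribʳ-* (+ m) (+ suc n)) ⟨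
      fromℤ (ℤ.- (+ m ℤ.* + suc n))     ≈⟨ fromℤ-neg (+ m ℤ.* + suc n) ⟩
      - fromℤ (+ m ℤ.* + suc n)         ≈⟨ R.-‿cong (pos m (+ suc n)) ⟩
      - (fromℕ m * fromℕ (suc n))       ≈⟨ -‿.-‿distribʳ-* (fromℕ m) (fromℕ (suc n)) ⟩
      fromℕ m * - fromℕ (suc n)         ∎
    signs : ∀ a b → fromℤ (a ℤ.* b) ≈ fromℤ a * fromℤ b
    signs (+ m)      b = pos m b
    signs ℤ.-[1+ m ] b = begin
      fromℤ (ℤ.-[1+ m ] ℤ.* b)          ≡⟨ cong fromℤ (ℤₚ.neg-distribˡ-* (+ suc m) b) ⟨
      fromℤ (ℤ.- (+ suc m ℤ.* b))       ≈⟨ fromℤ-neg (+ suc m ℤ.* b) ⟩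
      - fromℤ (+ suc m ℤ.* b)           ≈⟨ R.-‿cong (pos (suc m) b) ⟩
      - (fromℕ (suc m) * fromℤ b)       ≈⟨ -‿.-‿distribˡ-* (fromℕ (suc m)) (fromℤ b) ⟩
      - fromℕ (suc m) * fromℤ b         ∎

  -- fromℤ with its numerals normalised, so that the solver's constant 1 is 1#
  -- and not 1# + 0#.
  numeral : ℤ → Carrier
  numeral (+ n)      = n ×′.× 1#
  numeral ℤ.-[1+ n ] = - (suc n ×′.× 1#)

  fromℤ≈numeral : ∀ a → fromℤ a ≈ numeral a
  fromℤ≈numeral (+ n)      = ×′.×ᵤ≈× n 1#
  fromℤ≈numeral ℤ.-[1+ n ] = R.-‿cong (×′.×ᵤ≈× (suc n) 1#)

  numeral-homomorphism : CommutativeRing.rawRing ℤₚ.+-*-commutativeRing -Raw-AlmostCommutative⟶ fromCommutativeRing commutativeRing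
  numeral-homomorphism = record
    { ⟦_⟧    = numeral
    ; +-homo = λ a b → via (a ℤ.+ b) (R.trans (fromℤ-+ a b) (R.+-cong (fromℤ≈numeral a) (fromℤ≈numeral b)))
    ; *-homo = λ a b → via (a ℤ.* b) (R.trans (fromℤ-* a b) (R.*-cong (fromℤ≈numeral a) (fromℤ≈numeral b)))
    ; -‿homo = λ a → via (ℤ.- a) (R.trans (fromℤ-neg a) (R.-‿cong (fromℤ≈numeral a)))
    ; 0-homo = R.refl
    ; 1-homo = R.refl
    }
    where
    via : ∀ a {x} → fromℤ a ≈ x → numeral a ≈ x
    via a = R.trans (R.sym (fromℤ≈numeral a))

  numeral-≟ : ∀ a b → Maybe.Maybe (numeral a ≈ numeral b)
  numeral-≟ a b = Maybe.map (λ { refl → R.refl }) (dec⇒weaklyDec ℤₚ._≟_ a b)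

  open RingSolver (CommutativeRing.rawRing ℤₚ.+-*-commutativeRing) (fromCommutativeRing commutativeRing)
    numeral-homomorphism numeral-≟ using (Polynomial; solve; con; _:+_; _:*_; :-_; _:=_)

  :0 :1 : ∀ {n} → Polynomial n
  :0 = con ℤ.0ℤ
  :1 = con ℤ.1ℤ

  private variable
    w x y z c ε δ : Carrier
    d : ℕ

  diff : x ≤ y → 0# ≤ y + - x
  diff {x} {y} x≤y = ≤.≤-respˡ-≈ (R.-‿inverseʳ x) (+-mono-≤ (- x) x≤y)

  undiff : 0# ≤ y + - x → x ≤ y
  undiff {y} {x} 0≤ = ≤.≤-respˡ-≈ (R.+-identityˡ x)
    (≤.≤-respʳ-≈ (solve 2 (λ x y → (y :+ :- x) :+ x := y) R.refl x y) (+-mono-≤ x 0≤))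

  -- Most inequalities x ≤ y below are certified by an expression of y − x as a
  -- combination of nonnegative terms, built with _⊞_ and _⊠_.
  ≤-by : 0# ≤ z → z ≈ y + - x → x ≤ y
  ≤-by 0≤z z≈ = undiff (≤.≤-respʳ-≈ z≈ 0≤z)

  infixl 6 _⊞_
  infixl 7 _⊠_

  _⊞_ : 0# ≤ x → 0# ≤ y → 0# ≤ x + y
  _⊞_ {x} {y} 0≤x 0≤y = ≤.trans 0≤y (≤.≤-respˡ-≈ (R.+-identityˡ y) (+-mono-≤ y 0≤x))

  _⊠_ : 0# ≤ x → 0# ≤ y → 0# ≤ x * y
  _⊠_ = *-nonNegative

  ≤∨> : ∀ x y → x ≤ y ⊎ y < x
  ≤∨> x y with em {x ≤ y}
  ... | yes x≤y = inj₁ x≤y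
  ... | no  x≰y with ≤.total x y
  ... | inj₁ x≤y = inj₁ x≤y
  ... | inj₂ y≤x = inj₂ (y≤x , λ y≈x → x≰y (≤.reflexive (R.sym y≈x)))

  <⇒≤ : x < y → x ≤ y
  <⇒≤ = proj₁

  <⇒≱ : x < y → ¬ y ≤ x
  <⇒≱ (x≤y , x≉y) y≤x = x≉y (≤.antisym x≤y y≤x)

  ≰⇒> : ¬ x ≤ y → y < x
  ≰⇒> {x} {y} x≰y with ≤∨> x y
  ... | inj₁ x≤y = ⊥-elim (x≰y x≤y)
  ... | inj₂ y<x = y<x

  ≮⇒≥ : ¬ x < y → y ≤ x
  ≮⇒≥ {x} {y} x≮y with ≤∨> y x
  ... | inj₁ y≤x = y≤x
  ... | inj₂ x<y = ⊥-elim (x≮y x<y)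

  <-≤-trans : x < y → y ≤ z → x < z
  <-≤-trans x<y y≤z = ≤.trans (<⇒≤ x<y) y≤z , λ x≈z → <⇒≱ x<y (≤.trans y≤z (≤.reflexive (R.sym x≈z)))

  ≤-<-trans : x ≤ y → y < z → x < z
  ≤-<-trans x≤y y<z = ≤.trans x≤y (<⇒≤ y<z) , λ x≈z → <⇒≱ y<z (≤.trans (≤.reflexive (R.sym x≈z)) x≤y)

  <-respʳ-≈ : x ≈ y → w < x → w < y
  <-respʳ-≈ x≈y w<x = <-≤-trans w<x (≤.reflexive x≈y)

  diff< : x < y → 0# < y + - x
  diff< {x} {y} x<y = ≰⇒> λ y-x≤0 → <⇒≱ x<y (≤-by (diff y-x≤0)
    (solve 2 (λ x y → :0 :+ :- (y :+ :- x) := x :+ :- y) R.refl x y))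

  <-by : 0# < z → z ≈ y + - x → x < y
  <-by {z} {y} {x} 0<z z≈ = ≰⇒> λ y≤x → <⇒≱ 0<z (≤-by (diff y≤x)
    (R.trans (solve 2 (λ x y → x :+ :- y := :0 :+ :- (y :+ :- x)) R.refl x y) (R.+-congˡ (R.-‿cong (R.sym z≈)))))

  +-positive : 0# < x → 0# ≤ y → 0# < x + y
  +-positive {x} {y} 0<x 0≤y = <-≤-trans 0<x (≤-by 0≤y (solve 2 (λ x y → y := (x :+ y) :+ :- x) R.refl x y))

  0≤1 : 0# ≤ 1#
  0≤1 with ≤.total 0# 1#
  ... | inj₁ 0≤1 = 0≤1
  ... | inj₂ 1≤0 = ≤.≤-respʳ-≈ (solve 0 ((:0 :+ :- :1) :* (:0 :+ :- :1) := :1) R.refl) (diff 1≤0 ⊠ diff 1≤0)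

  0<1 : 0# < 1#
  0<1 = 0≤1 , 0≉1

  opaque
    inverse : 0# < x → ∃[ y ] 0# < y × x * y ≈ 1#
    inverse {x} 0<x with *-inverse x (λ x≈0 → proj₂ 0<x (R.sym x≈0))
    ... | y , xy≈1 = y , ≰⇒> y≰0 , xy≈1
      where
      y≰0 : ¬ y ≤ 0#
      y≰0 y≤0 = <⇒≱ 0<1 (≤-by (<⇒≤ 0<x ⊠ diff y≤0) (R.trans
        (solve 2 (λ x y → x :* (:0 :+ :- y) := :0 :+ :- (x :* y)) R.refl x y) (R.+-congˡ (R.-‿cong xy≈1))))

  *-positive : 0# < x → 0# < y → 0# < x * y
  *-positive {x} {y} 0<x 0<y with inverse 0<x
  ... | x⁻¹ , 0<x⁻¹ , eq = ≰⇒> λ xy≤0 → <⇒≱ 0<y (≤-by (<⇒≤ 0<x⁻¹ ⊠ diff xy≤0) (begin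
    x⁻¹ * (0# + - (x * y))   ≈⟨ solve 3 (λ x y x⁻¹ → x⁻¹ :* (:0 :+ :- (x :* y)) := :0 :+ :- ((x :* x⁻¹) :* y)) R.refl x y x⁻¹ ⟩
    0# + - ((x * x⁻¹) * y)   ≈⟨ R.+-congˡ (R.-‿cong (R.trans (R.*-congʳ eq) (R.*-identityˡ y))) ⟩
    0# + - y                 ∎))

  *-monoˡ-≤ : 0# ≤ c → x ≤ y → c * x ≤ c * y
  *-monoˡ-≤ {c} {x} {y} 0≤c x≤y = ≤-by (0≤c ⊠ diff x≤y)
    (solve 3 (λ c x y → c :* (y :+ :- x) := c :* y :+ :- (c :* x)) R.refl c x y)

  +-mono : ∀ {a b} → a ≤ x → b ≤ y → a + b ≤ x + y
  +-mono {x} {y} {a} {b} p q = ≤-by (diff p ⊞ diff q)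
    (solve 4 (λ a x b y → (x :+ :- a) :+ (y :+ :- b) := (x :+ y) :+ :- (a :+ b)) R.refl a x b y)

  0≤fromℕ : ∀ n → 0# ≤ fromℕ n
  0≤fromℕ zero    = ≤.refl
  0≤fromℕ (suc n) = 0≤1 ⊞ 0≤fromℕ n

  0<fromℕ : ∀ {n} → 0 ℕ.< n → 0# < fromℕ n
  0<fromℕ {suc n} _ = +-positive 0<1 (0≤fromℕ n)

  fromℕ-mono : ∀ {m n} → m ℕ.≤ n → fromℕ m ≤ fromℕ n
  fromℕ-mono {n = n} ℕ.z≤n = 0≤fromℕ n
  fromℕ-mono (ℕ.s≤s m≤n) = +-mono ≤.refl (fromℕ-mono m≤n)

  -- If the numerals were bounded, with supremum `s`, then `n + 1 ≤ s` for all `n` would make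
  -- `s − 1` an upper bound as well.
  archimedean : ∀ x → ∃[ n ] x ≤ fromℕ n
  archimedean x with em {∃[ n ] x ≤ fromℕ n}
  ... | yes p = p
  ... | no ¬p with supremum (λ y → ∃[ n ] y ≈ fromℕ n) (0# , 0 , R.refl)
                     (x , λ { y (n , y≈n) → ≤.trans (≤.reflexive y≈n) (<⇒≤ (≰⇒> λ x≤n → ¬p (n , x≤n))) })
  ... | s , upper , least = ⊥-elim (<⇒≱ (<-by 0<1 (solve 1 (λ s → :1 := s :+ :- (s :+ :- :1)) R.refl s))
          (least (s + - 1#) λ { y (n , y≈n) → ≤-by (diff (upper (fromℕ (suc n)) (suc n , R.refl)))
            (R.trans (solve 2 (λ s n → s :+ :- (:1 :+ n) := (s :+ :- :1) :+ :- n) R.refl s (fromℕ n))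
                     (R.+-congˡ (R.-‿cong (R.sym y≈n)))) }))

  opaque
    harmonic : ∀ n → ∃[ y ] 0# < y × fromℕ (suc n) * y ≈ 1#
    harmonic n = inverse (0<fromℕ {suc n} (ℕ.s≤s ℕ.z≤n))

  -- The null sequence 1 / (n + 1), along which the limits h → 0 and ε → 0 are taken.
  η : ℕ → Carrier
  η n = proj₁ (harmonic n)

  0<η : ∀ n → 0# < η n
  0<η n = proj₁ (proj₂ (harmonic n))

  η≤ : 0# < ε → ∃[ N ] ∀ n → N ℕ.≤ n → η n ≤ ε
  η≤ {ε} 0<ε with inverse 0<ε
  ... | ε⁻¹ , 0<ε⁻¹ , eq with archimedean ε⁻¹
  ... | N , ε⁻¹≤N = N , λ n N≤n →
    ≤-by (<⇒≤ 0<ε ⊠ <⇒≤ (0<η n) ⊠ diff (≤.trans ε⁻¹≤N (fromℕ-mono (ℕₚ.m≤n⇒m≤1+n N≤n)))) (begin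
      ε * η n * (fromℕ (suc n) + - ε⁻¹)
        ≈⟨ solve 4 (λ ε h n ε⁻¹ → ε :* h :* (n :+ :- ε⁻¹) := ε :* (n :* h) :+ :- (h :* (ε :* ε⁻¹)))
             R.refl ε (η n) (fromℕ (suc n)) ε⁻¹ ⟩
      ε * (fromℕ (suc n) * η n) + - (η n * (ε * ε⁻¹))
        ≈⟨ R.+-cong (R.trans (R.*-congˡ (proj₂ (proj₂ (harmonic n)))) (R.*-identityʳ ε))
                    (R.-‿cong (R.trans (R.*-congˡ eq) (R.*-identityʳ (η n)))) ⟩
      ε + - η n ∎)

  η≤1 : ∀ n → η n ≤ 1#
  η≤1 n = ≤-by (<⇒≤ (0<η n) ⊠ 0≤fromℕ n) (begin
    η n * fromℕ n
      ≈⟨ solve 2 (λ h n → h :* n := (:1 :+ n) :* h :+ :- h) R.refl (η n) (fromℕ n) ⟩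
    fromℕ (suc n) * η n + - η n
      ≈⟨ R.+-congʳ (proj₂ (proj₂ (harmonic n))) ⟩
    1# + - η n ∎)

  ≤-if-approx : (∀ ε → 0# < ε → x ≤ y + ε) → x ≤ y
  ≤-if-approx {x} {y} h with ≤∨> x y
  ... | inj₁ x≤y = x≤y
  ... | inj₂ y<x with inverse (0<fromℕ {2} (ℕ.s≤s ℕ.z≤n))
  ... | ½ , 0<½ , eq = ⊥-elim (<⇒≱ (*-positive 0<½ (diff< y<x)) (≤-by
    (diff (h (½ * (x + - y)) (*-positive 0<½ (diff< y<x)))) (begin
      (y + ½ * (x + - y)) + - x
        ≈⟨ solve 3 (λ x y h → (y :+ h :* (x :+ :- y)) :+ :- x := ((:1 :+ (:1 :+ :0)) :* h :+ :- :1) :* (x :+ :- y) :+ (:0 :+ :- (h :* (x :+ :- y)))) R.refl x y ½ ⟩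
      (fromℕ 2 * ½ + - 1#) * (x + - y) + (0# + - (½ * (x + - y)))
        ≈⟨ R.+-congʳ (R.trans (R.*-congʳ (R.trans (R.+-congʳ eq) (R.-‿inverseʳ 1#))) (R.zeroˡ (x + - y))) ⟩
      0# + (0# + - (½ * (x + - y)))
        ≈⟨ R.+-identityˡ _ ⟩
      0# + - (½ * (x + - y)) ∎)))

  ∣∣≤ : x ≤ c → - x ≤ c → ∣ x ∣ ≤ c
  ∣∣≤ = MaxOp.⊔-lub (NaturalMax.maxOperator totalOrder)

  x≤∣x∣ : ∀ x → x ≤ ∣ x ∣
  x≤∣x∣ x = MaxOp.x≤x⊔y (NaturalMax.maxOperator totalOrder) x (- x)

  -x≤∣x∣ : ∀ x → - x ≤ ∣ x ∣
  -x≤∣x∣ x = MaxOp.x≤y⊔x (NaturalMax.maxOperator totalOrder) x (- x)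

  ∣∣-cong : x ≈ y → ∣ x ∣ ≈ ∣ y ∣
  ∣∣-cong x≈y = MaxOp.⊔-cong (NaturalMax.maxOperator totalOrder) x≈y (R.-‿cong x≈y)

  fromℤ-mono : ∀ {a b} → a ℤ.≤ b → fromℤ a ≤ fromℤ b
  fromℤ-mono {a} {b} a≤b = undiff (≤.≤-respʳ-≈ (R.trans (fromℤ-+ b (ℤ.- a)) (R.+-congˡ (fromℤ-neg a)))
    (nonNegative (ℤₚ.i≤j⇒0≤j-i a≤b)))
    where
    nonNegative : ∀ {c} → ℤ.0ℤ ℤ.≤ c → 0# ≤ fromℤ c
    nonNegative (ℤ.+≤+ {n = n} _) = 0≤fromℕ n

  fromℤ-cancel-≤ : ∀ {a b} → fromℤ a < fromℤ b + 1# → a ℤ.≤ b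
  fromℤ-cancel-≤ {a} {b} p = ℤₚ.≮⇒≥ λ b<a → <⇒≱ p (≤.≤-respˡ-≈
    (R.trans (fromℤ-+ ℤ.1ℤ b) (R.trans (R.+-congʳ (R.+-identityʳ 1#)) (R.+-comm 1# (fromℤ b))))
    (fromℤ-mono (ℤₚ.i<j⇒suc[i]≤j b<a)))

  fromℤ-∑ : ∀ {n} (v : Fin n → ℤ) → fromℤ (sumℤ v) ≈ sum (λ i → fromℤ (v i))
  fromℤ-∑ {zero}  v = R.refl
  fromℤ-∑ {suc n} v = R.trans (fromℤ-+ (v zero) (sumℤ λ i → v (suc i))) (R.+-congˡ (fromℤ-∑ λ i → v (suc i)))

  -- Compactness and subsequences

  -- Closed balls of the maximum norm, written as pairs of linear inequalities so that estimates can
  -- be certified by `≤-by` without absolute values.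
  Near : Carrier → Point d → Point d → Set
  Near ε x y = ∀ i → x i ≤ y i + ε × y i ≤ x i + ε

  near-sym : ∀ {x y : Point d} → Near ε x y → Near ε y x
  near-sym x~y i = proj₂ (x~y i) , proj₁ (x~y i)

  near-refl : ∀ {x y : Point d} → 0# ≤ ε → x ≋ y → Near ε x y
  near-refl {ε = ε} {x} {y} 0≤ε x≋y i = below (x i) (y i) (x≋y i) , below (y i) (x i) (R.sym (x≋y i))
    where
    below : ∀ a b → a ≈ b → a ≤ b + ε
    below a b a≈b = ≤.trans (≤.reflexive a≈b) (≤-by 0≤ε (solve 2 (λ b ε → ε := (b :+ ε) :+ :- b) R.refl b ε))

  near-trans : ∀ {x y z : Point d} → Near ε x y → Near δ y z → Near (ε + δ) x z
  near-trans {ε = ε} {δ} {x} {y} {z} x~y y~z i =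
    ≤-by (diff (proj₁ (x~y i)) ⊞ diff (proj₁ (y~z i)))
      (solve 5 (λ x y z ε δ → ((y :+ ε) :+ :- x) :+ ((z :+ δ) :+ :- y) := (z :+ (ε :+ δ)) :+ :- x)
        R.refl (x i) (y i) (z i) ε δ) ,
    ≤-by (diff (proj₂ (x~y i)) ⊞ diff (proj₂ (y~z i)))
      (solve 5 (λ x y z ε δ → ((x :+ ε) :+ :- y) :+ ((y :+ δ) :+ :- z) := (x :+ (ε :+ δ)) :+ :- z)
        R.refl (x i) (y i) (z i) ε δ)

  near-mono : ∀ {x y : Point d} → ε ≤ δ → Near ε x y → Near δ x y
  near-mono ε≤δ x~y i = ≤.trans (proj₁ (x~y i)) (+-mono ≤.refl ε≤δ) , ≤.trans (proj₂ (x~y i)) (+-mono ≤.refl ε≤δ)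

  near-cong : ∀ {x x′ y y′ : Point d} → x ≋ x′ → y ≋ y′ → Near ε x y → Near ε x′ y′
  near-cong x≋x′ y≋y′ x~y i =
    ≤.≤-respˡ-≈ (x≋x′ i) (≤.≤-respʳ-≈ (R.+-congʳ (y≋y′ i)) (proj₁ (x~y i))) ,
    ≤.≤-respˡ-≈ (y≋y′ i) (≤.≤-respʳ-≈ (R.+-congʳ (x≋x′ i)) (proj₂ (x~y i)))

  near-all⇒≋ : ∀ {x y : Point d} → (∀ ε → 0# < ε → Near ε x y) → x ≋ y
  near-all⇒≋ h i = ≤.antisym (≤-if-approx λ ε 0<ε → proj₁ (h ε 0<ε i)) (≤-if-approx λ ε 0<ε → proj₂ (h ε 0<ε i))

  ball⇒near : ∀ {x y : Point d} → (∀ i → ∣ y i + - x i ∣ < ε) → Near ε y x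
  ball⇒near {ε = ε} {x} {y} h i =
    ≤-by (diff (≤.trans (x≤∣x∣ _) (<⇒≤ (h i))))
      (solve 3 (λ x y ε → ε :+ :- (y :+ :- x) := (x :+ ε) :+ :- y) R.refl (x i) (y i) ε) ,
    ≤-by (diff (≤.trans (-x≤∣x∣ _) (<⇒≤ (h i))))
      (solve 3 (λ x y ε → ε :+ :- (:- (y :+ :- x)) := (y :+ ε) :+ :- x) R.refl (x i) (y i) ε)

  near⇒ball : ∀ {x y : Point d} → δ < ε → Near δ y x → ∀ i → ∣ y i + - x i ∣ < ε
  near⇒ball {δ = δ} {x = x} {y} δ<ε y~x i = ≤-<-trans (∣∣≤
    (≤-by (diff (proj₁ (y~x i))) (solve 3 (λ x y ε → (x :+ ε) :+ :- y := ε :+ :- (y :+ :- x)) R.refl (x i) (y i) δ))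
    (≤-by (diff (proj₂ (y~x i))) (solve 3 (λ x y ε → (y :+ ε) :+ :- x := ε :+ :- (:- (y :+ :- x))) R.refl (x i) (y i) δ)))
    δ<ε

  opaque
    half : ∃[ h ] 0# < h × h + h ≈ 1#
    half with inverse (0<fromℕ {2} (ℕ.s≤s ℕ.z≤n))
    ... | h , 0<h , eq = h , 0<h , R.trans (solve 1 (λ h → h :+ h := (:1 :+ (:1 :+ :0)) :* h) R.refl h) eq

  ½ : Carrier
  ½ = proj₁ half

  0<½ : 0# < ½
  0<½ = proj₁ (proj₂ half)

  ½+½ : ½ * x + ½ * x ≈ x
  ½+½ {x} = R.trans (R.sym (R.distribʳ x ½ ½)) (R.trans (R.*-congʳ (proj₂ (proj₂ half))) (R.*-identityˡ x))

  ½x<x : 0# < x → ½ * x < x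
  ½x<x {x} 0<x = <-by (*-positive 0<½ 0<x) (begin
    ½ * x                     ≈⟨ solve 1 (λ h → h := (h :+ h) :+ :- h) R.refl (½ * x) ⟩
    (½ * x + ½ * x) + - (½ * x) ≈⟨ R.+-congʳ ½+½ ⟩
    x + - (½ * x)             ∎)

  Interior : Subset d → Subset d
  Interior S x = ∃[ ε ] 0# < ε × (∀ y → Near ε y x → y ∈ S)

  interior⊆ : ∀ {S : Subset d} → Interior S ⊆ S
  interior⊆ {x = x} (ε , 0<ε , h) = h x (near-refl (<⇒≤ 0<ε) λ _ → R.refl)

  interior-open : ∀ (S : Subset d) → Open (Interior S)
  interior-open S x (ε , 0<ε , h) = ½ * ε , *-positive 0<½ 0<ε , λ y y~x →
    ½ * ε , *-positive 0<½ 0<ε , λ z z~y →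
      h z (near-mono (≤.reflexive ½+½) (near-trans z~y (ball⇒near y~x)))

  open⇒near : ∀ {U : Subset d} → Open U → ∀ {x} → x ∈ U → x ∈ Interior U
  open⇒near U-open {x} x∈U with U-open x x∈U
  ... | ε , 0<ε , h = ½ * ε , *-positive 0<½ 0<ε , λ y y~x → h y (near⇒ball (½x<x 0<ε) y~x)

  -- The sets used for covering below come from non-strict or negated conditions and need not be
  -- open; it suffices that each point of `K` is interior to one of them.
  compact-nbhd : ∀ {K : Subset d} → Compact K → {I : Set} (S : I → Subset d) →
    (∀ x → x ∈ K → ∃[ i ] x ∈ Interior (S i)) → Σ[ is ∈ List I ] (K ⊆ λ x → Any (λ i → x ∈ S i) is)
  compact-nbhd K-compact S cover with K-compact (λ i → Interior (S i)) (λ i → interior-open (S i)) (cover _)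
  ... | is , K⊆ = is , λ x∈K → Any.map interior⊆ (K⊆ x∈K)

  maximum : List ℕ → ℕ
  maximum List.[]       = 0
  maximum (n List.∷ ns) = n ℕ.⊔ maximum ns

  maximum-upper : ∀ {P : ℕ → Set} → (∀ {m n} → m ℕ.≤ n → P m → P n) → ∀ {ns} → Any P ns → P (maximum ns)
  maximum-upper mono {n List.∷ ns} (here p)  = mono (ℕₚ.m≤m⊔n n (maximum ns)) p
  maximum-upper mono {n List.∷ ns} (there p) = mono (ℕₚ.m≤n⊔m n (maximum ns)) (maximum-upper mono p)

  compact-increasing : ∀ {K : Subset d} → Compact K → (S : ℕ → Subset d) →
    (∀ {m n} → m ℕ.≤ n → S m ⊆ S n) → (∀ x → x ∈ K → ∃[ n ] x ∈ Interior (S n)) → ∃[ n ] K ⊆ S n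
  compact-increasing K-compact S mono cover with compact-nbhd K-compact S cover
  ... | ns , K⊆ = maximum ns , λ x∈K → maximum-upper (λ m≤n → mono m≤n) (K⊆ x∈K)

  Bounded : Carrier → Point d → Set
  Bounded M x = ∀ i → x i ≤ M × - x i ≤ M

  uniform : ∀ {n} (P : Fin n → ℕ → Set) → (∀ i {k l} → k ℕ.≤ l → P i k → P i l) →
    (∀ i → ∃[ k ] P i k) → ∃[ k ] ∀ i → P i k
  uniform {zero}  P mono h = 0 , λ ()
  uniform {suc n} P mono h with h zero | uniform (P ∘ suc) (mono ∘ suc) (h ∘ suc)
  ... | k , p | l , q = k ℕ.⊔ l , λ
    { zero    → mono zero (ℕₚ.m≤m⊔n k l) p
    ; (suc i) → mono (suc i) (ℕₚ.m≤n⊔m k l) (q i) }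

  compact⇒bounded : ∀ {K : Subset d} → Compact K → ∃[ n ] ∀ {x} → x ∈ K → Bounded (fromℕ n) x
  compact⇒bounded {K = K} K-compact = compact-increasing K-compact (λ n → Bounded (fromℕ n)) bounded-mono λ x _ → nbhd x
    where
    bounded-mono : ∀ {m n} → m ℕ.≤ n → ∀ {x : Point _} → Bounded (fromℕ m) x → Bounded (fromℕ n) x
    bounded-mono m≤n h i = ≤.trans (proj₁ (h i)) (fromℕ-mono m≤n) , ≤.trans (proj₂ (h i)) (fromℕ-mono m≤n)
    nbhd : ∀ x → ∃[ n ] x ∈ Interior (Bounded (fromℕ n))
    nbhd x with uniform (λ i n → ∣ x i ∣ ≤ fromℕ n) (λ i k≤l p → ≤.trans p (fromℕ-mono k≤l)) (λ i → archimedean ∣ x i ∣)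
    -- The extra 1 accommodates the radius of the neighbourhood.
    ... | n , h = suc n , 1# , 0<1 , λ y y~x i →
      ≤-by (diff (proj₁ (y~x i)) ⊞ diff (≤.trans (x≤∣x∣ (x i)) (h i)))
        (solve 3 (λ x y n → ((x :+ :1) :+ :- y) :+ (n :+ :- x) := (:1 :+ n) :+ :- y) R.refl (x i) (y i) (fromℕ n)) ,
      ≤-by (diff (proj₂ (y~x i)) ⊞ diff (≤.trans (-x≤∣x∣ (x i)) (h i)))
        (solve 3 (λ x y n → ((y :+ :1) :+ :- x) :+ (n :+ :- (:- x)) := (:1 :+ n) :+ :- (:- y)) R.refl (x i) (y i) (fromℕ n))

  Frequently : (ℕ → Set) → Set
  Frequently P = ∀ N → ∃[ n ] N ℕ.≤ n × P n

  -- Every infinite set of indices P can be thinned to an infinite set on which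
  -- one fixed choice c satisfies Q c; this plays the role of a subsequence.
  Selectable : {C : Set} → (C → ℕ → Set) → Set₁
  Selectable {C} Q = (P : ℕ → Set) → Frequently P → Σ[ c ∈ C ] Frequently (λ n → P n × Q c n)

  -- Infinite pigeonhole principle. If the second alternative stops occurring beyond some `N`, every
  -- later element of `P` satisfies the first. Deciding which case holds is a use of excluded
  -- middle.
  frequently-⊎ : ∀ {P Q R : ℕ → Set} → Frequently P → (∀ {n} → P n → Q n ⊎ R n) →
    Frequently (λ n → P n × Q n) ⊎ Frequently (λ n → P n × R n)
  frequently-⊎ {P} {Q} {R} freq split with em {Frequently (λ n → P n × Q n)}
  ... | yes p = inj₁ p
  ... | no ¬p = inj₂ λ N → helper N
    where
    helper : ∀ N → ∃[ n ] N ℕ.≤ n × P n × R n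
    helper N with em {∃[ n ] N ℕ.≤ n × P n × R n}
    ... | yes q = q
    ... | no ¬q = ⊥-elim (¬p λ M → always M)
      where
      always : ∀ M → ∃[ n ] M ℕ.≤ n × P n × Q n
      always M with freq (M ℕ.⊔ N)
      ... | n , le , p with split p
      ... | inj₁ q = n , ℕₚ.≤-trans (ℕₚ.m≤m⊔n M N) le , p , q
      ... | inj₂ r = ⊥-elim (¬q (n , ℕₚ.≤-trans (ℕₚ.m≤n⊔m M N) le , p , r))

  frequently-map : ∀ {P Q : ℕ → Set} → (∀ {n} → P n → Q n) → Frequently P → Frequently Q
  frequently-map f freq N with freq N
  ... | n , N≤n , p = n , N≤n , f p

  -- Descent on the bound: either the top value recurs forever, or the indices below it still form
  -- an infinite set.
  selectable-ℕ : ∀ B (f : ℕ → ℕ) → (∀ n → f n ℕ.≤ B) → Selectable (λ c n → f n ≡ c)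
  selectable-ℕ B f f≤B P freq = descend B P freq id (λ {n} _ → f≤B n)
    where
    top : ∀ {B k} → k ℕ.< suc B ⊎ k ≡ suc B → k ≡ suc B ⊎ k ℕ.≤ B
    top (inj₁ (ℕ.s≤s k≤B)) = inj₂ k≤B
    top (inj₂ k≡)          = inj₁ k≡
    descend : ∀ B (P′ : ℕ → Set) → Frequently P′ → (∀ {n} → P′ n → P n) → (∀ {n} → P′ n → f n ℕ.≤ B) →
      ∃[ c ] Frequently (λ n → P n × f n ≡ c)
    descend zero P′ freq′ P′⇒P bound = 0 , frequently-map (λ p → P′⇒P p , ℕₚ.n≤0⇒n≡0 (bound p)) freq′
    descend (suc B) P′ freq′ P′⇒P bound
      with frequently-⊎ {P′} {λ n → f n ≡ suc B} {λ n → f n ℕ.≤ B} freq′ (λ p → top (ℕₚ.m≤n⇒m<n∨m≡n (bound p)))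
    ... | inj₁ q = suc B , frequently-map (λ (p , eq) → P′⇒P p , eq) q
    ... | inj₂ q = descend B (λ n → P′ n × f n ℕ.≤ B) q (P′⇒P ∘ proj₁) proj₂

  selectable-ℤ : ∀ B (f : ℕ → ℤ) → (∀ n → ℤ.∣ f n ∣ ℕ.≤ B) → Selectable (λ c n → f n ≡ c)
  selectable-ℤ B f f≤B P freq with selectable-ℕ B (λ n → ℤ.∣ f n ∣) f≤B P freq
  ... | m , freq′ with frequently-⊎ {Q = λ n → f n ≡ + m} {R = λ n → f n ≡ ℤ.- (+ m)} freq′ (λ (_ , eq) → signs eq)
    where
    signs : ∀ {a} → ℤ.∣ a ∣ ≡ m → a ≡ + m ⊎ a ≡ ℤ.- (+ m)
    signs {+ n}      refl = inj₁ refl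
    signs {ℤ.-[1+ n ]} refl = inj₂ refl
  ... | inj₁ q = + m , frequently-map (λ ((p , _) , eq) → p , eq) q
  ... | inj₂ q = ℤ.- (+ m) , frequently-map (λ ((p , _) , eq) → p , eq) q

  selectable-Π : ∀ {m} {C : Set} {Q : Fin m → C → ℕ → Set} → (∀ i → Selectable (Q i)) →
    Selectable (λ (c : Fin m → C) n → ∀ i → Q i (c i) n)
  selectable-Π {zero}  h P freq = (λ ()) , frequently-map (λ p → p , λ ()) freq
  selectable-Π {suc m} {C} {Q} h P freq with h zero P freq
  ... | c , freq₀ with selectable-Π {m} {C} {Q ∘ suc} (h ∘ suc) (λ n → P n × Q zero c n) freq₀
  ... | cs , freq₁ = (c ∷ cs) , frequently-map (λ ((p , q) , qs) → p , λ { zero → q ; (suc i) → qs i }) freq₁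

  -- Bolzano-Weierstrass along a prescribed infinite index set `P`, so that it can follow a
  -- selection made earlier. Without a cluster point, each point of `K` has a neighbourhood that the
  -- sequence avoids from some index on; compactness makes this index uniform, and a later term of
  -- the sequence would then have to avoid itself.
  cluster : ∀ {K : Subset d} → Compact K → (k : ℕ → Point d) → (∀ n → k n ∈ K) →
    (P : ℕ → Set) → Frequently P →
    ∃[ x ] x ∈ K × ∀ ε → 0# < ε → Frequently (λ n → P n × Near ε (k n) x)
  cluster {K = K} K-compact k k∈K P freq
    with em {∃[ x ] x ∈ K × ∀ ε → 0# < ε → Frequently (λ n → P n × Near ε (k n) x)}
  ... | yes p = p
  ... | no ¬p with compact-increasing K-compact (λ N y → ∀ n → N ℕ.≤ n → P n → ¬ (k n ≋ y))
                     (λ l≤m h n m≤n → h n (ℕₚ.≤-trans l≤m m≤n)) escapes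
    where
    escapes : ∀ x → x ∈ K → ∃[ N ] x ∈ Interior (λ y → ∀ n → N ℕ.≤ n → P n → ¬ (k n ≋ y))
    escapes x x∈K with em {∃[ N ] x ∈ Interior (λ y → ∀ n → N ℕ.≤ n → P n → ¬ (k n ≋ y))}
    ... | yes q = q
    ... | no ¬q = ⊥-elim (¬p (x , x∈K , λ ε 0<ε N → close ε 0<ε N))
      where
      close : ∀ ε → 0# < ε → ∀ N → ∃[ n ] N ℕ.≤ n × P n × Near ε (k n) x
      close ε 0<ε N with em {∃[ n ] N ℕ.≤ n × P n × Near ε (k n) x}
      ... | yes r = r
      ... | no ¬r = ⊥-elim (¬q (N , ε , 0<ε , λ y y~x n N≤n p k≋y →
                      ¬r (n , N≤n , p , near-cong (λ i → R.sym (k≋y i)) (λ _ → R.refl) y~x)))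
  ... | N , K⊆ with freq N
  ... | n , N≤n , p = ⊥-elim (K⊆ (k∈K n) n N≤n p λ _ → R.refl)

  closed : ∀ {K : Subset d} → K Respects _≋_ → Compact K → ∀ x →
    (∀ ε → 0# < ε → ∃[ k ] k ∈ K × Near ε k x) → x ∈ K
  closed {d} {K} K-respects K-compact x approx = K-respects (near-all⇒≋ close) (proj₁ (proj₂ limit))
    where
    k : ℕ → Point d
    k n = proj₁ (approx (η n) (0<η n))
    k∈K : ∀ n → k n ∈ K
    k∈K n = proj₁ (proj₂ (approx (η n) (0<η n)))
    k~x : ∀ n → Near (η n) (k n) x
    k~x n = proj₂ (proj₂ (approx (η n) (0<η n)))
    limit : ∃[ y ] y ∈ K × ∀ ε → 0# < ε → Frequently (λ n → ⊤ × Near ε (k n) y)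
    limit = cluster K-compact k k∈K (λ _ → ⊤) (λ N → N , ℕₚ.≤-refl , tt)
    x′ : Point d
    x′ = proj₁ limit
    close : ∀ ε → 0# < ε → Near ε x′ x
    close ε 0<ε =
      let N , η≤½ε = η≤ (*-positive 0<½ 0<ε)
          n , N≤n , _ , k~y = proj₂ (proj₂ limit) (½ * ε) (*-positive 0<½ 0<ε) N
      in near-mono {x = x′} {x} (≤.reflexive (½+½ {ε}))
           (near-trans {ε = ½ * ε} {½ * ε} {x′} {k n} {x} (near-sym {x = k n} {x′} k~y)
             (near-mono {ε = η n} {½ * ε} {k n} {x} (η≤½ε n N≤n) (k~x n)))

  -- Convex combinations and copies of the simplex

  sum-0* : ∀ {n} (c : Fin n → Carrier) → sum (λ i → c i * 0#) ≈ 0#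
  sum-0* {n} c = R.trans (∑.sum-cong-≋ λ i → R.zeroʳ (c i)) (∑.sum-replicate-zero n)

  sum-basis : ∀ {n} (c : Fin n → Carrier) j → sum (λ i → c i * basis i j) ≈ c j
  sum-basis {suc n} c zero = begin
    c zero * 1# + sum (λ i → c (suc i) * 0#)  ≈⟨ R.+-cong (R.*-identityʳ (c zero)) (sum-0* (c ∘ suc)) ⟩
    c zero + 0#                               ≈⟨ R.+-identityʳ (c zero) ⟩
    c zero                                    ∎
  sum-basis {suc n} c (suc j) = begin
    c zero * 0# + sum (λ i → c (suc i) * basis i j)  ≈⟨ R.+-cong (R.zeroʳ (c zero)) (sum-basis (c ∘ suc) j) ⟩
    0# + c (suc j)                                   ≈⟨ R.+-identityˡ (c (suc j)) ⟩
    c (suc j)                                        ∎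

  sum-nonNegative : ∀ {n} (c : Fin n → Carrier) → (∀ i → 0# ≤ c i) → 0# ≤ sum c
  sum-nonNegative {zero}  c 0≤c = ≤.refl
  sum-nonNegative {suc n} c 0≤c = 0≤c zero ⊞ sum-nonNegative (c ∘ suc) (0≤c ∘ suc)

  sum-1 : ∀ n → sum {n} (λ _ → 1#) ≈ fromℕ n
  sum-1 n = ∑.sum-replicate n

  -- Leaving the weights unnormalised lets one statement serve barycentric coordinates, with total
  -- 1, and sums of `d` points, with all weights 1. The first point is joined to the point found for
  -- the rest in the ratio given by `c zero` and the total `s`; when `s` is zero this ratio is
  -- undefined, but then `c zero` vanishes too.
  convex-combination : ∀ {K : Subset d} → Convex K → Satisfiable K →
    ∀ {n} (c : Fin n → Carrier) (p : Fin n → Point d) → (∀ j → 0# ≤ c j) → (∀ j → p j ∈ K) →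
    ∃[ k ] k ∈ K × ∀ i → sum (λ j → c j * p j i) ≈ sum c * k i
  convex-combination K-convex (k , k∈K) {zero}  c p 0≤c p∈K = k , k∈K , λ i → R.sym (R.zeroˡ (k i))
  convex-combination {K = K} K-convex K-nonEmpty {suc n} c p 0≤c p∈K
    with convex-combination K-convex K-nonEmpty (c ∘ suc) (p ∘ suc) (0≤c ∘ suc) (p∈K ∘ suc)
  ... | k , k∈K , eq with ≤∨> (c zero + sum (c ∘ suc)) 0#
  ... | inj₁ s≤0 = k , k∈K , λ i → begin
      c zero * p zero i + sum (λ j → c (suc j) * p (suc j) i)
        ≈⟨ R.+-cong (R.trans (R.*-congʳ c₀≈0) (R.zeroˡ (p zero i))) (eq i) ⟩
      0# + sum (c ∘ suc) * k i
        ≈⟨ R.+-congʳ (R.trans (R.*-congʳ c₀≈0) (R.zeroˡ (k i))) ⟨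
      c zero * k i + sum (c ∘ suc) * k i
        ≈⟨ R.distribʳ (k i) (c zero) (sum (c ∘ suc)) ⟨
      (c zero + sum (c ∘ suc)) * k i ∎
    where
    c₀≈0 : c zero ≈ 0#
    c₀≈0 = ≤.antisym
      (≤.trans (≤-by (sum-nonNegative (c ∘ suc) (0≤c ∘ suc))
                     (solve 2 (λ a s → s := (a :+ s) :+ :- a) R.refl (c zero) (sum (c ∘ suc)))) s≤0)
      (0≤c zero)
  ... | inj₂ 0<s = k′ , K-convex (p∈K zero) k∈K (0≤c zero ⊠ <⇒≤ 0<s⁻¹) t≤1 , λ i → begin
      c zero * p zero i + sum (λ j → c (suc j) * p (suc j) i)
        ≈⟨ R.+-congˡ (eq i) ⟩
      c zero * p zero i + S * k i
        ≈⟨ solve 4 (λ a p s k → a :* p :+ s :* k := :1 :* (a :* p) :+ ((a :+ s) :+ :- (:1 :* a)) :* k)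
             R.refl (c zero) (p zero i) S (k i) ⟩
      1# * (c zero * p zero i) + (s + - (1# * c zero)) * k i
        ≈⟨ R.+-cong (R.*-congʳ ss⁻¹≈1) (R.*-congʳ (R.+-congˡ (R.-‿cong (R.*-congʳ ss⁻¹≈1)))) ⟨
      (s * s⁻¹) * (c zero * p zero i) + (s + - ((s * s⁻¹) * c zero)) * k i
        ≈⟨ solve 5 (λ s q a p k → (s :* q) :* (a :* p) :+ (s :+ :- ((s :* q) :* a)) :* k :=
                                  s :* ((a :* q) :* p :+ (:1 :+ :- (a :* q)) :* k))
             R.refl s s⁻¹ (c zero) (p zero i) (k i) ⟩
      s * k′ i ∎
    where
    S = sum (c ∘ suc)
    s = c zero + S
    s⁻¹ = proj₁ (inverse 0<s)
    0<s⁻¹ : 0# < s⁻¹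
    0<s⁻¹ = proj₁ (proj₂ (inverse 0<s))
    ss⁻¹≈1 : s * s⁻¹ ≈ 1#
    ss⁻¹≈1 = proj₂ (proj₂ (inverse 0<s))
    t = c zero * s⁻¹
    k′ = t ⊙ p zero ⊕ (1# + - t) ⊙ k
    t≤1 : t ≤ 1#
    t≤1 = ≤-by (sum-nonNegative (c ∘ suc) (0≤c ∘ suc) ⊠ <⇒≤ 0<s⁻¹) (begin
      S * s⁻¹           ≈⟨ solve 3 (λ a S q → S :* q := (a :+ S) :* q :+ :- (a :* q)) R.refl (c zero) S s⁻¹ ⟩
      s * s⁻¹ + - t     ≈⟨ R.+-congʳ ss⁻¹≈1 ⟩
      1# + - t          ∎)

  column : Matrix d → Point d → Fin d → Point d
  column A b i r = b r + fromℤ (A r i)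

  -- The affine map sends the vertices of the standard simplex to `b` and the points `column A b i`,
  -- and it preserves barycentric coordinates; these are read off from `x` because the extra vertex
  -- is the origin.
  simplex-image⊆ : ∀ {K : Subset d} → K Respects _≋_ → Convex K → (A : Matrix d) (b : Point d) →
    b ∈ K → (∀ i → column A b i ∈ K) → Image (affine A b) (Δ d) ⊆ K
  simplex-image⊆ {d} {K} K-respects K-convex A b b∈K columns∈K {y} (x , (c , 0≤c , ∑c≈1 , x≋) , y≋)
    with convex-combination K-convex (b , b∈K) c vertex 0≤c (λ { zero → b∈K ; (suc i) → columns∈K i })
    where
    vertex : Fin (suc d) → Point d
    vertex = b ∷ column A b
  ... | k , k∈K , eq = K-respects k≋y k∈K
    where
    coordinate : ∀ j → x j ≈ c (suc j)
    coordinate j = begin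
      x j                                                     ≈⟨ x≋ j ⟩
      c zero * 0# + sum (λ i → c (suc i) * basis i j)         ≈⟨ R.+-cong (R.zeroʳ (c zero)) (sum-basis (c ∘ suc) j) ⟩
      0# + c (suc j)                                          ≈⟨ R.+-identityˡ (c (suc j)) ⟩
      c (suc j)                                               ∎
    k≋y : k ≋ y
    k≋y r = begin
      k r
        ≈⟨ R.trans (R.*-congʳ ∑c≈1) (R.*-identityˡ (k r)) ⟨
      sum c * k r
        ≈⟨ eq r ⟨
      c zero * b r + sum (λ i → c (suc i) * (b r + fromℤ (A r i)))
        ≈⟨ R.+-congˡ (∑.sum-cong-≋ λ i → solve 3 (λ c b a → c :* (b :+ a) := c :* b :+ a :* c)
             R.refl (c (suc i)) (b r) (fromℤ (A r i))) ⟩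
      c zero * b r + sum (λ i → c (suc i) * b r + fromℤ (A r i) * c (suc i))
        ≈⟨ R.+-congˡ (∑.∑-distrib-+ (λ i → c (suc i) * b r) (λ i → fromℤ (A r i) * c (suc i))) ⟩
      c zero * b r + (sum (λ i → c (suc i) * b r) + sum (λ i → fromℤ (A r i) * c (suc i)))
        ≈⟨ R.+-congˡ (R.+-congʳ (∑.*-distribʳ-sum (b r) (c ∘ suc))) ⟨
      c zero * b r + (sum (c ∘ suc) * b r + sum (λ i → fromℤ (A r i) * c (suc i)))
        ≈⟨ solve 4 (λ c s b a → c :* b :+ (s :* b :+ a) := a :+ (c :+ s) :* b)
             R.refl (c zero) (sum (c ∘ suc)) (b r) (sum (λ i → fromℤ (A r i) * c (suc i))) ⟩
      sum (λ i → fromℤ (A r i) * c (suc i)) + sum c * b r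
        ≈⟨ R.+-cong (∑.sum-cong-≋ λ i → R.*-congˡ (R.sym (coordinate i))) (R.trans (R.*-congʳ ∑c≈1) (R.*-identityˡ (b r))) ⟩
      affine A b x r
        ≈⟨ y≋ r ⟨
      y r ∎

  η*≤ : ∀ m → 0# < ε → ∃[ N ] ∀ n → N ℕ.≤ n → η n * fromℕ m ≤ ε
  η*≤ {ε} m 0<ε =
    let q , 0<q , eq = inverse (0<fromℕ {suc m} (ℕ.s≤s ℕ.z≤n))
        N , h = η≤ (*-positive 0<ε 0<q)
    in N , λ n N≤n → ≤-by (diff (h n N≤n) ⊠ 0≤fromℕ (suc m) ⊞ <⇒≤ (0<η n)) (begin
      (ε * q + - η n) * fromℕ (suc m) + η n
        ≈⟨ solve 4 (λ ε q h m → (ε :* q :+ :- h) :* (:1 :+ m) :+ h := ε :* ((:1 :+ m) :* q) :+ :- (h :* m))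
             R.refl ε q (η n) (fromℕ m) ⟩
      ε * (fromℕ (suc m) * q) + - (η n * fromℕ m)
        ≈⟨ R.+-congʳ (R.trans (R.*-congˡ eq) (R.*-identityʳ ε)) ⟩
      ε + - (η n * fromℕ m) ∎)

  dilation-near : ∀ {M h} {k : Point d} → 0# ≤ h → Bounded M k → Near (h * M) ((1# + h) ⊙ k) k
  dilation-near {M = M} {h} {k} 0≤h k-bounded i =
    ≤-by (0≤h ⊠ diff (proj₁ (k-bounded i)))
      (solve 3 (λ h M k → h :* (M :+ :- k) := (k :+ h :* M) :+ :- ((:1 :+ h) :* k)) R.refl h M (k i)) ,
    ≤-by (0≤h ⊠ diff (proj₂ (k-bounded i)))
      (solve 3 (λ h M k → h :* (M :+ :- (:- k)) := ((:1 :+ h) :* k :+ h :* M) :+ :- k) R.refl h M (k i))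

  fromℤ-cancel : ∀ {a b} → fromℤ a ≤ fromℤ b → a ℤ.≤ b
  fromℤ-cancel {a} {b} p = fromℤ-cancel-≤ (≤-<-trans p (<-by 0<1 (solve 1 (λ y → :1 := (y :+ :1) :+ :- y) R.refl (fromℤ b))))

  ∣∣-bounded : ∀ {a m} → fromℤ a ≤ fromℕ m → - fromℤ a ≤ fromℕ m → ℤ.∣ a ∣ ℕ.≤ m
  ∣∣-bounded {+ n}        {m} p _ = ℤₚ.drop‿+≤+ (fromℤ-cancel {+ n} {+ m} p)
  ∣∣-bounded {ℤ.-[1+ n ]} {m} _ p = ℤₚ.drop‿+≤+ (fromℤ-cancel {+ suc n} {+ m}
    (≤.≤-respˡ-≈ (-‿.-‿involutive (fromℕ (suc n))) p))

  -- The bound is a difference of at most `2 M` times a dilation factor of at most 2. It limits the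
  -- entries of the matrices, which are differences of vertices.
  difference-bounded : ∀ {M h} {k k′ : Carrier} → 0# ≤ h → h ≤ 1# → 0# ≤ M → k′ ≤ M → - k ≤ M →
    (1# + h) * k′ + - ((1# + h) * k) ≤ (M + M) + (M + M)
  difference-bounded {M} {h} {k} {k′} 0≤h h≤1 0≤M k′≤M -k≤M = ≤-by
    ((0≤1 ⊞ 0≤h) ⊠ diff k′≤M ⊞ (0≤1 ⊞ 0≤h) ⊠ diff -k≤M ⊞ diff h≤1 ⊠ (0≤M ⊞ 0≤M))
    (solve 4 (λ M h k k′ → (:1 :+ h) :* (M :+ :- k′) :+ (:1 :+ h) :* (M :+ :- (:- k)) :+ (:1 :+ :- h) :* (M :+ M) :=
        ((M :+ M) :+ (M :+ M)) :+ :- ((:1 :+ h) :* k′ :+ :- ((:1 :+ h) :* k))) R.refl M h k k′)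

  -- The vertices b, b + A e₁, …, b + A e_d of a copy of the simplex, all in s K.
  record SimplexIn (T : Subset d) (s : Carrier) (K : Subset d) : Set where
    field
      matrix      : Matrix d
      base        : Point d
      unimodular  : GL d matrix
      base∈T      : base ∈ T
      vertex₀     : Point d
      vertex₀∈    : vertex₀ ∈ K
      base≈       : base ≋ s ⊙ vertex₀
      vertex      : Fin d → Point d
      vertex∈     : ∀ i → vertex i ∈ K
      column≈     : ∀ i → column matrix base i ≋ s ⊙ vertex i

  Closure : Subset d → Subset d
  Closure T x = ∀ ε → 0# < ε → ∃[ y ] y ∈ T × Near ε y x

  -- `T` carries a property of the base vertex into the limit: no condition for real translations,
  -- lattice points for integral ones. Bounded integer entries make one matrix recur infinitely
  -- often, and among those indices the base vertices cluster at some `b`. The other vertices need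
  -- no further subsequence, since a fixed matrix ties them to the base vertex.
  simplex-limit : ∀ {K T : Subset d} → K Respects _≋_ → Compact K →
    (∀ h → 0# < h → SimplexIn T (1# + h) K) →
    ∃[ A ] ∃[ b ] GL d A × b ∈ Closure T × b ∈ K × (∀ i → column A b i ∈ K)
  simplex-limit {d} {K} {T} K-respects K-compact approx =
    A , b , A-unimodular , b∈closure , proj₁ (proj₂ limit) , columns∈K
    where
    module S n = SimplexIn (approx (η n) (0<η n))
    m = proj₁ (compact⇒bounded K-compact)
    bounded : ∀ {x} → x ∈ K → Bounded (fromℕ m) x
    bounded = proj₂ (compact⇒bounded K-compact)
    M : ℕ
    M = (m ℕ.+ m) ℕ.+ (m ℕ.+ m)
    fromℕ-M : fromℕ M ≈ (fromℕ m + fromℕ m) + (fromℕ m + fromℕ m)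
    fromℕ-M = R.trans (fromℕ-+ (m ℕ.+ m) (m ℕ.+ m)) (R.+-cong (fromℕ-+ m m) (fromℕ-+ m m))
    entry≈ : ∀ n r i → fromℤ (S.matrix n r i) ≈ (1# + η n) * S.vertex n i r + - ((1# + η n) * S.vertex₀ n r)
    entry≈ n r i = begin
      fromℤ (S.matrix n r i)
        ≈⟨ solve 2 (λ a b → a := (b :+ a) :+ :- b) R.refl (fromℤ (S.matrix n r i)) (S.base n r) ⟩
      column (S.matrix n) (S.base n) i r + - S.base n r
        ≈⟨ R.+-cong (S.column≈ n i r) (R.-‿cong (S.base≈ n r)) ⟩
      (1# + η n) * S.vertex n i r + - ((1# + η n) * S.vertex₀ n r) ∎
    entry-bounded : ∀ r i n → ℤ.∣ S.matrix n r i ∣ ℕ.≤ M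
    entry-bounded r i n = ∣∣-bounded {S.matrix n r i} {M}
      (≤.≤-respʳ-≈ (R.sym fromℕ-M) (≤.≤-respˡ-≈ (R.sym (entry≈ n r i))
        (difference-bounded (<⇒≤ (0<η n)) (η≤1 n) (0≤fromℕ m)
          (proj₁ (bounded (S.vertex∈ n i) r)) (proj₂ (bounded (S.vertex₀∈ n) r)))))
      (≤.≤-respʳ-≈ (R.sym fromℕ-M) (≤.≤-respˡ-≈ negated
        (difference-bounded (<⇒≤ (0<η n)) (η≤1 n) (0≤fromℕ m)
          (proj₁ (bounded (S.vertex₀∈ n) r)) (proj₂ (bounded (S.vertex∈ n i) r)))))
      where
      negated : (1# + η n) * S.vertex₀ n r + - ((1# + η n) * S.vertex n i r) ≈ - fromℤ (S.matrix n r i)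
      negated = R.trans (solve 2 (λ x y → x :+ :- y := :- (y :+ :- x)) R.refl ((1# + η n) * S.vertex₀ n r) ((1# + η n) * S.vertex n i r))
                        (R.-‿cong (R.sym (entry≈ n r i)))
    selection : Σ[ A ∈ Matrix d ] Frequently (λ n → ⊤ × (∀ r i → S.matrix n r i ≡ A r i))
    selection = selectable-Π (λ r → selectable-Π (λ i → selectable-ℤ M (λ n → S.matrix n r i) (entry-bounded r i)))
      (λ _ → ⊤) (λ N → N , ℕₚ.≤-refl , tt)
    A : Matrix d
    A = proj₁ selection
    A-unimodular : GL d A
    A-unimodular =
      let n , _ , _ , A≡ = proj₂ selection 0
      in subst (λ D → D ≡ ℤ.1ℤ ⊎ D ≡ ℤ.-1ℤ) (det-cong {A = S.matrix n} {A} A≡) (S.unimodular n)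
    limit : ∃[ x ] x ∈ K × ∀ ε → 0# < ε → Frequently (λ n → (⊤ × (∀ r i → S.matrix n r i ≡ A r i)) × Near ε (S.vertex₀ n) x)
    limit = cluster K-compact S.vertex₀ S.vertex₀∈ (λ n → ⊤ × (∀ r i → S.matrix n r i ≡ A r i)) (proj₂ selection)
    b : Point d
    b = proj₁ limit
    dilated : ∀ {ε k} n → η n * fromℕ m ≤ ε → k ∈ K → Near ε ((1# + η n) ⊙ k) k
    dilated {ε} {k} n small k∈K = near-mono {x = (1# + η n) ⊙ k} {k} small (dilation-near {h = η n} {k} (<⇒≤ (0<η n)) (bounded k∈K))
    close : ∀ ε → 0# < ε → ∃[ n ] (∀ r i → S.matrix n r i ≡ A r i) × Near ε (S.base n) b × (∀ i → Near ε (S.vertex n i) (column A b i))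
    close ε 0<ε =
      let N , small = η*≤ m 0<ε₂
          n , N≤n , (_ , A≡) , v~b = proj₂ (proj₂ limit) ε₂ 0<ε₂ N
          base~b : Near (ε₂ + ε₂) (S.base n) b
          base~b = near-trans {x = S.base n} {S.vertex₀ n} {b}
            (near-cong {x = (1# + η n) ⊙ S.vertex₀ n} {S.base n} {S.vertex₀ n} {S.vertex₀ n} (λ r → R.sym (S.base≈ n r)) (λ _ → R.refl)
              (dilated n (small n N≤n) (S.vertex₀∈ n))) v~b
      in n , A≡ , near-mono {x = S.base n} {b} ε₂+ε₂≤ε base~b ,
         λ i → near-mono {x = S.vertex n i} {column A b i} ε₂+ε₁≤ε
           (near-trans {x = S.vertex n i} {(1# + η n) ⊙ S.vertex n i} {column A b i}
             (near-sym {x = (1# + η n) ⊙ S.vertex n i} {S.vertex n i} (dilated n (small n N≤n) (S.vertex∈ n i)))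
             (shift n A≡ base~b i))
      where
      -- A quarter of ε each: the base vertex spends one on undoing the dilation and one on the
      -- cluster point, and every other vertex spends one more on its own dilation.
      ε₁ = ½ * ε
      ε₂ = ½ * ε₁
      0<ε₁ = *-positive 0<½ 0<ε
      0<ε₂ = *-positive 0<½ 0<ε₁
      ε₂+ε₂≤ε : ε₂ + ε₂ ≤ ε
      ε₂+ε₂≤ε = ≤.trans (≤.reflexive ½+½) (<⇒≤ (½x<x 0<ε))
      ε₂+ε₁≤ε : ε₂ + (ε₂ + ε₂) ≤ ε
      ε₂+ε₁≤ε = ≤.trans (+-mono (<⇒≤ (½x<x 0<ε₁)) (≤.reflexive ½+½)) (≤.reflexive ½+½)
      shift : ∀ n → (∀ r i → S.matrix n r i ≡ A r i) → Near (ε₂ + ε₂) (S.base n) b →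
        ∀ i → Near (ε₂ + ε₂) ((1# + η n) ⊙ S.vertex n i) (column A b i)
      shift n A≡ base~b i r =
        ≤.≤-respˡ-≈ column≈ (≤-by (diff (proj₁ (base~b r)))
          (solve 4 (λ b′ b a e → (b :+ e) :+ :- b′ := ((b :+ a) :+ e) :+ :- (b′ :+ a)) R.refl (S.base n r) (b r) a (ε₂ + ε₂))) ,
        ≤.≤-respʳ-≈ (R.+-congʳ column≈) (≤-by (diff (proj₂ (base~b r)))
          (solve 4 (λ b′ b a e → (b′ :+ e) :+ :- b := ((b′ :+ a) :+ e) :+ :- (b :+ a)) R.refl (S.base n r) (b r) a (ε₂ + ε₂)))
        where
        a = fromℤ (A r i)
        column≈ : S.base n r + a ≈ (1# + η n) * S.vertex n i r
        column≈ = R.trans (R.+-congˡ (R.reflexive (cong fromℤ (sym (A≡ r i))))) (S.column≈ n i r)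
    b∈closure : b ∈ Closure T
    b∈closure ε 0<ε = let n , _ , base~b , _ = close ε 0<ε in S.base n , S.base∈T n , base~b
    columns∈K : ∀ i → column A b i ∈ K
    columns∈K i = closed K-respects K-compact (column A b i) λ ε 0<ε →
      let n , _ , _ , v~ = close ε 0<ε in S.vertex n i , S.vertex∈ n i , v~ i

  -- Dilates, lattice width and integral functionals

  dilate : Point d → Carrier → Subset d → Subset d
  dilate p t K x = ∃[ k ] k ∈ K × x ≋ p ⊕ t ⊙ k

  open-respects : ∀ {U : Subset d} → Open U → U Respects _≋_
  open-respects {U = U} U-open {x} {y} x≋y x∈U =
    let ε , 0<ε , h = open⇒near U-open x∈U in h y (near-refl {x = y} {x} (<⇒≤ 0<ε) (λ i → R.sym (x≋y i)))

  dilate-near : ∀ {t ε : Carrier} (p : Point d) {x y : Point d} → 0# ≤ t → Near ε x y → Near (t * ε) (p ⊕ t ⊙ x) (p ⊕ t ⊙ y)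
  dilate-near {t = t} {ε} p {x} {y} 0≤t x~y i =
    ≤-by (0≤t ⊠ diff (proj₁ (x~y i))) (scaled (x i) (y i)) , ≤-by (0≤t ⊠ diff (proj₂ (x~y i))) (scaled (y i) (x i))
    where
    scaled : ∀ x y → t * ((y + ε) + - x) ≈ ((p i + t * y) + t * ε) + - (p i + t * x)
    scaled x y = solve 5 (λ t ε p x y → t :* ((y :+ ε) :+ :- x) := ((p :+ t :* y) :+ t :* ε) :+ :- (p :+ t :* x))
      R.refl t ε (p i) x y

  -- The cover is pulled back along `k ↦ p + t k`, which multiplies distances by `t`; hence the
  -- radius `t⁻¹ * ε`.
  dilate-compact : ∀ {K : Subset d} {t} (p : Point d) → 0# < t → Compact K → Compact (dilate p t K)
  dilate-compact {K = K} {t} p 0<t K-compact U U-open cover = proj₁ finite , λ (k , k∈K , x≋) →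
    Any.map (λ {i} → open-respects (U-open i) λ j → R.sym (x≋ j)) (proj₂ finite k∈K)
    where
    finite : Σ[ is ∈ List _ ] (K ⊆ λ k → Any (λ i → p ⊕ t ⊙ k ∈ U i) is)
    finite = compact-nbhd K-compact (λ i k → p ⊕ t ⊙ k ∈ U i) λ k k∈K →
      let i , k∈U = cover (k , k∈K , λ _ → R.refl)
          ε , 0<ε , h = open⇒near (U-open i) k∈U
          t⁻¹ , 0<t⁻¹ , tt⁻¹≈1 = inverse 0<t
      in i , t⁻¹ * ε , *-positive 0<t⁻¹ 0<ε , λ y y~k → h (p ⊕ t ⊙ y) (near-mono {x = p ⊕ t ⊙ y} {p ⊕ t ⊙ k}
           (≤.reflexive (R.trans (R.sym (R.*-assoc t t⁻¹ ε)) (R.trans (R.*-congʳ tt⁻¹≈1) (R.*-identityˡ ε))))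
           (dilate-near p {y} {k} (<⇒≤ 0<t) y~k))

  dilate-body : ∀ {K : Subset d} {t} (p : Point d) → 0# < t → IsConvexBody K → IsConvexBody (dilate p t K)
  dilate-body {K = K} {t} p 0<t K-body = record
    { respects = λ x≋y (k , k∈K , x≋) → k , k∈K , λ i → R.trans (R.sym (x≋y i)) (x≋ i)
    ; nonEmpty = p ⊕ t ⊙ proj₁ nonEmpty , proj₁ nonEmpty , proj₂ nonEmpty , λ _ → R.refl
    ; convex   = λ {x} {y} {τ} (k , k∈K , x≋) (k′ , k′∈K , y≋) 0≤τ τ≤1 →
        τ ⊙ k ⊕ (1# + - τ) ⊙ k′ , convex k∈K k′∈K 0≤τ τ≤1 , λ i →
        R.trans (R.+-cong (R.*-congˡ (x≋ i)) (R.*-congˡ (y≋ i)))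
          (solve 5 (λ p t τ k k′ → τ :* (p :+ t :* k) :+ (:1 :+ :- τ) :* (p :+ t :* k′) :=
                                   p :+ t :* (τ :* k :+ (:1 :+ :- τ) :* k′)) R.refl (p i) t τ (k i) (k′ i))
    ; compact  = dilate-compact p 0<t compact
    }
    where open IsConvexBody K-body

  pairing-cong : ∀ (u : Vector ℤ d) {x y} → x ≋ y → ⟨ u , x ⟩ ≈ ⟨ u , y ⟩
  pairing-cong u x≋y = ∑.sum-cong-≋ λ i → R.*-congˡ (x≋y i)

  pairing-linear : ∀ (u : Vector ℤ d) p t x → ⟨ u , p ⊕ t ⊙ x ⟩ ≈ ⟨ u , p ⟩ + t * ⟨ u , x ⟩
  pairing-linear u p t x = begin
    sum (λ i → fromℤ (u i) * (p i + t * x i))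
      ≈⟨ ∑.sum-cong-≋ (λ i → solve 4 (λ u p t x → u :* (p :+ t :* x) := u :* p :+ t :* (u :* x))
           R.refl (fromℤ (u i)) (p i) t (x i)) ⟩
    sum (λ i → fromℤ (u i) * p i + t * (fromℤ (u i) * x i))
      ≈⟨ ∑.∑-distrib-+ (λ i → fromℤ (u i) * p i) (λ i → t * (fromℤ (u i) * x i)) ⟩
    ⟨ u , p ⟩ + sum (λ i → t * (fromℤ (u i) * x i))
      ≈⟨ R.+-congˡ (∑.*-distribˡ-sum t (λ i → fromℤ (u i) * x i)) ⟨
    ⟨ u , p ⟩ + t * ⟨ u , x ⟩ ∎

  0≤∣∣ : ∀ x → 0# ≤ ∣ x ∣
  0≤∣∣ x with ≤.total 0# x
  ... | inj₁ 0≤x = ≤.trans 0≤x (x≤∣x∣ x)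
  ... | inj₂ x≤0 = ≤.trans (≤-by (diff x≤0) (solve 1 (λ x → :0 :+ :- x := :- x :+ :- :0) R.refl x)) (-x≤∣x∣ x)

  ∣∣-scale : 0# ≤ c → ∣ c * x ∣ ≈ c * ∣ x ∣
  ∣∣-scale {c} {x} 0≤c = ≤.antisym
    (∣∣≤ (*-monoˡ-≤ 0≤c (x≤∣x∣ x)) (≤.≤-respˡ-≈ (R.sym (-‿.-‿distribʳ-* c x)) (*-monoˡ-≤ 0≤c (-x≤∣x∣ x)))) below
    where
    below : c * ∣ x ∣ ≤ ∣ c * x ∣
    below with ≤.total 0# x
    ... | inj₁ 0≤x = ≤.trans (*-monoˡ-≤ 0≤c (∣∣≤ ≤.refl
            (≤-by (0≤x ⊞ 0≤x) (solve 1 (λ x → x :+ x := x :+ :- (:- x)) R.refl x)))) (x≤∣x∣ (c * x))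
    ... | inj₂ x≤0 = ≤.trans (*-monoˡ-≤ 0≤c (∣∣≤
            (≤-by (diff x≤0 ⊞ diff x≤0) (solve 1 (λ x → (:0 :+ :- x) :+ (:0 :+ :- x) := :- x :+ :- x) R.refl x)) ≤.refl))
            (≤.≤-respˡ-≈ (-‿.-‿distribʳ-* c x) (-x≤∣x∣ (c * x)))

  extent : Vector ℤ d → Point d → Point d → Carrier
  extent u x y = ∣ ⟨ u , x ⟩ + - ⟨ u , y ⟩ ∣

  extent-dilate : ∀ (u : Vector ℤ d) p {t} → 0# ≤ t → ∀ {x y k k′} → x ≋ p ⊕ t ⊙ k → y ≋ p ⊕ t ⊙ k′ →
    extent u x y ≈ t * extent u k k′
  extent-dilate u p {t} 0≤t {x} {y} {k} {k′} x≋ y≋ = begin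
    ∣ ⟨ u , x ⟩ + - ⟨ u , y ⟩ ∣
      ≈⟨ ∣∣-cong (R.+-cong (R.trans (pairing-cong u x≋) (pairing-linear u p t k))
                           (R.-‿cong (R.trans (pairing-cong u y≋) (pairing-linear u p t k′)))) ⟩
    ∣ (⟨ u , p ⟩ + t * ⟨ u , k ⟩) + - (⟨ u , p ⟩ + t * ⟨ u , k′ ⟩) ∣
      ≈⟨ ∣∣-cong (solve 4 (λ p t k k′ → (p :+ t :* k) :+ :- (p :+ t :* k′) := t :* (k :+ :- k′))
           R.refl ⟨ u , p ⟩ t ⟨ u , k ⟩ ⟨ u , k′ ⟩) ⟩
    ∣ t * (⟨ u , k ⟩ + - ⟨ u , k′ ⟩) ∣
      ≈⟨ ∣∣-scale 0≤t ⟩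
    t * extent u k k′ ∎

  cancel-inverse : ∀ {t s} x → t * s ≈ 1# → s * (t * x) ≈ x
  cancel-inverse {t} {s} x ts≈1 = R.trans (solve 3 (λ t s x → s :* (t :* x) := (t :* s) :* x) R.refl t s x)
    (R.trans (R.*-congʳ ts≈1) (R.*-identityˡ x))

  widthAlong-dilate : ∀ {u : Vector ℤ d} {K : Subset d} {r t} p → 0# < t →
    IsWidthAlong u K r → IsWidthAlong u (dilate p t K) (t * r)
  widthAlong-dilate {u = u} {K} {r} {t} p 0<t ((x , y , x∈K , y∈K , r≈) , upper) =
    (p ⊕ t ⊙ x , p ⊕ t ⊙ y , (x , x∈K , λ _ → R.refl) , (y , y∈K , λ _ → R.refl) ,
     R.trans (R.*-congˡ r≈) (R.sym (extent-dilate u p (<⇒≤ 0<t) {k = x} {y} (λ _ → R.refl) (λ _ → R.refl)))) ,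
    λ r′ (x′ , y′ , (k , k∈K , x′≋) , (k′ , k′∈K , y′≋) , r′≈) → ≤.trans
      (≤.reflexive (R.trans r′≈ (extent-dilate u p (<⇒≤ 0<t) {k = k} {k′} x′≋ y′≋)))
      (*-monoˡ-≤ (<⇒≤ 0<t) (upper (extent u k k′) (k , k′ , k∈K , k′∈K , R.refl)))

  -- The lower-bound half of the lattice width of a dilate starts from an arbitrary functional with
  -- a width on the dilate, which has to be brought back to `K`.
  widthAlong-undilate : ∀ {u : Vector ℤ d} {K : Subset d} {r t s} p → 0# < t → 0# ≤ s → t * s ≈ 1# →
    IsWidthAlong u (dilate p t K) r → IsWidthAlong u K (s * r)
  widthAlong-undilate {u = u} {K} {r} {t} {s} p 0<t 0≤s ts≈1 ((x′ , y′ , (k , k∈K , x′≋) , (k′ , k′∈K , y′≋) , r≈) , upper) =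
    (k , k′ , k∈K , k′∈K , R.trans (R.*-congˡ (R.trans r≈ (extent-dilate u p (<⇒≤ 0<t) {k = k} {k′} x′≋ y′≋)))
                                   (cancel-inverse (extent u k k′) ts≈1)) ,
    λ r′ (x , y , x∈K , y∈K , r′≈) → ≤.trans
      (≤.reflexive (R.trans r′≈ (R.sym (cancel-inverse (extent u x y) ts≈1))))
      (*-monoˡ-≤ 0≤s (upper (t * extent u x y) (p ⊕ t ⊙ x , p ⊕ t ⊙ y , (x , x∈K , λ _ → R.refl) , (y , y∈K , λ _ → R.refl) ,
        R.sym (extent-dilate u p (<⇒≤ 0<t) {k = x} {y} (λ _ → R.refl) (λ _ → R.refl)))))

  latticeWidth-dilate : ∀ {K : Subset d} {w t} p → 0# < t → IsLatticeWidth K w → IsLatticeWidth (dilate p t K) (t * w)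
  latticeWidth-dilate {w = w} {t} p 0<t ((u , u≢0 , along) , lower) =
    let s , 0<s , ts≈1 = inverse 0<t in
    (u , u≢0 , widthAlong-dilate {u = u} p 0<t along) , λ r (u′ , u′≢0 , along′) → ≤.trans
      (*-monoˡ-≤ (<⇒≤ 0<t) (lower (s * r) (u′ , u′≢0 , widthAlong-undilate {u = u′} p 0<t (<⇒≤ 0<s) ts≈1 along′)))
      (≤.reflexive (R.trans (R.sym (R.*-assoc t s r)) (R.trans (R.*-congʳ ts≈1) (R.*-identityˡ r))))

  -- A miss would make the dilate a hollow convex body of lattice width `t * w`, larger than the
  -- supremum.
  dilate-hits-lattice : ∀ {K : Subset d} {Flt w t} → IsConvexBody K → IsFlatnessConstant d Flt → IsLatticeWidth K w →
    0# < t → Flt < t * w → ∀ p → ∃[ z ] lattice z ∈ dilate p t K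
  dilate-hits-lattice {K = K} {t = t} K-body (upper , _) K-width 0<t Flt<tw p with em {∃[ z ] lattice z ∈ dilate p t K}
  ... | yes hit = hit
  ... | no ¬hit = ⊥-elim (<⇒≱ Flt<tw (upper _
          (dilate p t K , dilate-body p 0<t K-body , (λ z z∈ → ¬hit (z , z∈)) , latticeWidth-dilate p 0<t K-width)))

  unit : Fin d → Vector ℤ d
  unit i j = if does (i ≟ j) then ℤ.1ℤ else ℤ.0ℤ

  ∑-unit : ∀ (x : Vector ℤ d) j → x j ≡ sumℤ (λ i → x i ℤ.* unit i j)
  ∑-unit {suc d} x zero = sym (trans
    (cong₂ ℤ._+_ (ℤₚ.*-identityʳ (x zero)) (trans (ℤΣ.sum-cong-≗ λ i → ℤₚ.*-zeroʳ (x (suc i))) (ℤΣ.sum-replicate-zero d)))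
    (ℤₚ.+-identityʳ (x zero)))
  ∑-unit {suc d} x (suc j) = trans (∑-unit (x ∘ suc) j) (sym (trans
    (cong (λ t → t ℤ.+ sumℤ (λ i → x (suc i) ℤ.* unit i j)) (ℤₚ.*-zeroʳ (x zero))) (ℤₚ.+-identityˡ _)))

  functional-coordinates : ∀ {f : Vector ℤ d → ℤ} → IsFunctional f → ∀ x → f x ≡ sumℤ (λ i → x i ℤ.* f (unit i))
  functional-coordinates f-functional x = trans (cong-≗ (∑-unit x)) (∑-homo x unit)
    where open IsFunctional f-functional

  pairing-lattice : ∀ {f : Vector ℤ d → ℤ} → IsFunctional f → ∀ z → ⟨ f ∘ unit , lattice z ⟩ ≈ fromℤ (f z)
  pairing-lattice {f = f} f-functional z = R.sym (begin
    fromℤ (f z)                                          ≡⟨ cong fromℤ (functional-coordinates f-functional z) ⟩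
    fromℤ (sumℤ (λ i → z i ℤ.* f (unit i)))              ≈⟨ fromℤ-∑ (λ i → z i ℤ.* f (unit i)) ⟩
    sum (λ i → fromℤ (z i ℤ.* f (unit i)))               ≈⟨ ∑.sum-cong-≋ (λ i → R.trans (fromℤ-* (z i) (f (unit i)))
                                                              (R.*-comm (fromℤ (z i)) (fromℤ (f (unit i))))) ⟩
    ⟨ f ∘ unit , lattice z ⟩                             ∎)

  product-bounded : ∀ {a x M} → 0# ≤ M → x ≤ M → - x ≤ M → a * x ≤ ∣ a ∣ * M
  product-bounded {a} {x} {M} 0≤M x≤M -x≤M with ≤.total 0# a
  ... | inj₁ 0≤a = ≤-by (0≤a ⊠ diff x≤M ⊞ diff (x≤∣x∣ a) ⊠ 0≤M)
    (solve 4 (λ a x M A → a :* (M :+ :- x) :+ (A :+ :- a) :* M := A :* M :+ :- (a :* x)) R.refl a x M ∣ a ∣)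
  ... | inj₂ a≤0 = ≤-by (diff a≤0 ⊠ diff -x≤M ⊞ diff (-x≤∣x∣ a) ⊠ 0≤M)
    (solve 4 (λ a x M A → (:0 :+ :- a) :* (M :+ :- (:- x)) :+ (A :+ :- (:- a)) :* M := A :* M :+ :- (a :* x)) R.refl a x M ∣ a ∣)

  sum-mono : ∀ {n} (f g : Fin n → Carrier) → (∀ i → f i ≤ g i) → sum f ≤ sum g
  sum-mono {zero}  f g f≤g = ≤.refl
  sum-mono {suc n} f g f≤g = +-mono (f≤g zero) (sum-mono (f ∘ suc) (g ∘ suc) (f≤g ∘ suc))

  pairing-bounded : ∀ (u : Vector ℤ d) {M} → 0# ≤ M → ∀ x → Bounded M x → ⟨ u , x ⟩ ≤ sum (λ i → ∣ fromℤ (u i) ∣ * M)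
  pairing-bounded u {M} 0≤M x h = sum-mono (λ i → fromℤ (u i) * x i) (λ i → ∣ fromℤ (u i) ∣ * M)
    λ i → product-bounded 0≤M (proj₁ (h i)) (proj₂ (h i))

  ∣∣≈0 : x ≈ 0# → ∣ x ∣ ≤ 0#
  ∣∣≈0 {x} x≈0 = ∣∣≤ (≤.reflexive x≈0) (≤.reflexive (R.trans (R.-‿cong x≈0) -‿.-0#≈0#))

  -- If `u` were constant on `K`, its width along `u` would be 0, below the positive lattice width.
  nonconstant : ∀ {K : Subset d} {w} → Satisfiable K → IsLatticeWidth K w → 0# < w → ∀ {u} → NonZero u →
    ∃[ x ] ∃[ y ] x ∈ K × y ∈ K × ⟨ u , x ⟩ < ⟨ u , y ⟩
  nonconstant {K = K} {w} (k , k∈K) (_ , lower) 0<w {u} u≢0 with em {∃[ x ] ∃[ y ] x ∈ K × y ∈ K × ⟨ u , x ⟩ < ⟨ u , y ⟩}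
  ... | yes p = p
  ... | no ¬p = ⊥-elim (<⇒≱ 0<w (lower 0# (u , u≢0 ,
    (k , k , k∈K , k∈K , ≤.antisym (0≤∣∣ _) (∣∣≈0 (R.-‿inverseʳ ⟨ u , k ⟩))) ,
    λ r (x , y , x∈K , y∈K , r≈) → ≤.trans (≤.reflexive r≈) (∣∣≈0
      (R.trans (R.+-congʳ (≤.antisym (≮⇒≥ λ y<x → ¬p (y , x , y∈K , x∈K , y<x)) (≮⇒≥ λ x<y → ¬p (x , y , x∈K , y∈K , x<y))))
               (R.-‿inverseʳ ⟨ u , y ⟩))))))

  -- Lattice differences, the drift argument and simplices in dilates

  Differences : Carrier → Subset d → Pred (Vector ℤ d) 0ℓ
  Differences s K v = ∃[ x ] ∃[ y ] x ∈ K × y ∈ K × ∀ i → fromℤ (v i) ≈ s * (x i + - y i)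

  fromℤ-difference : ∀ a b → fromℤ (a ℤ.+ ℤ.-1ℤ ℤ.* b) ≈ fromℤ a + - fromℤ b
  fromℤ-difference a b = R.trans (fromℤ-+ a (ℤ.-1ℤ ℤ.* b)) (R.+-congˡ (R.trans
    (R.reflexive (cong fromℤ (ℤₚ.-1*i≡-i b))) (fromℤ-neg b)))

  differences-symmetric : ∀ {s} {K : Subset d} → Symmetric (Differences s K)
  differences-symmetric {s = s} {v = v} (x , y , x∈K , y∈K , v≈) = y , x , y∈K , x∈K , λ i → begin
    fromℤ (ℤ.-1ℤ ℤ.* v i)    ≡⟨ cong fromℤ (ℤₚ.-1*i≡-i (v i)) ⟩
    fromℤ (ℤ.- v i)          ≈⟨ fromℤ-neg (v i) ⟩
    - fromℤ (v i)            ≈⟨ R.-‿cong (v≈ i) ⟩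
    - (s * (x i + - y i))    ≈⟨ solve 3 (λ s x y → :- (s :* (x :+ :- y)) := s :* (y :+ :- x)) R.refl s (x i) (y i) ⟩
    s * (y i + - x i)        ∎

  archimedean-* : ∀ c → 0# < x → ∃[ n ] c < fromℕ n * x
  archimedean-* {x} c 0<x =
    let q , 0<q , xq≈1 = inverse 0<x
        n , h = archimedean ((c + 1#) * q)
    in n , <-≤-trans (<-by 0<1 (solve 1 (λ c → :1 := (c :+ :1) :+ :- c) R.refl c)) (≤-by (<⇒≤ 0<x ⊠ diff h) (begin
      x * (fromℕ n + - ((c + 1#) * q))
        ≈⟨ solve 4 (λ x n c q → x :* (n :+ :- (c :* q)) := n :* x :+ :- (c :* (x :* q))) R.refl x (fromℕ n) (c + 1#) q ⟩
      fromℕ n * x + - ((c + 1#) * (x * q))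
        ≈⟨ R.+-congˡ (R.-‿cong (R.trans (R.*-congˡ xq≈1) (R.*-identityʳ (c + 1#)))) ⟩
      fromℕ n * x + - (c + 1#) ∎))

  module _ {d : ℕ} {K : Subset d} {Flt w : Carrier} (K-body : IsConvexBody K)
    (Flt-constant : IsFlatnessConstant d Flt) (K-width : IsLatticeWidth K w) (0≤Flt : 0# ≤ Flt) (0<w : 0# < w) where

    open IsConvexBody K-body

    -- If f vanished on all of S = ℤᵈ ∩ s (K − K), it would be constant along
    -- lattice points zⱼ ∈ jσ (y − x) + t K with σ + t = s, since consecutive ones
    -- differ by an element of S; but their images under f drift to infinity.
    module Walk {s} (Flt<sw : Flt < s * w) {f : Vector ℤ d → ℤ} (f-functional : IsFunctional f)
      (vanishes : ∀ v → v ∈ Differences s K → f v ≡ ℤ.0ℤ) {x y : Point d} (x∈K : x ∈ K) (y∈K : y ∈ K)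
      (x<y : ⟨ f ∘ unit , x ⟩ < ⟨ f ∘ unit , y ⟩) where

      u : Vector ℤ d
      u = f ∘ unit

      w⁻¹ gap σ t : Carrier
      w⁻¹ = proj₁ (inverse 0<w)
      -- Half of the surplus over `Flt`, converted by `w⁻¹` into a step length σ. The shrunken body
      -- of scale `t = s − σ` then has width `gap + Flt`, still strictly above `Flt`.
      gap = ½ * (s * w + - Flt)
      σ = gap * w⁻¹
      t = s + - σ

      ww⁻¹≈1 : w * w⁻¹ ≈ 1#
      ww⁻¹≈1 = proj₂ (proj₂ (inverse 0<w))

      0<gap : 0# < gap
      0<gap = *-positive 0<½ (diff< Flt<sw)

      0<σ : 0# < σ
      0<σ = *-positive 0<gap (proj₁ (proj₂ (inverse 0<w)))

      tw≈ : t * w ≈ gap + Flt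
      tw≈ = begin
        (s + - (gap * w⁻¹)) * w
          ≈⟨ solve 4 (λ s g w⁻¹ w → (s :+ :- (g :* w⁻¹)) :* w := s :* w :+ :- (g :* (w :* w⁻¹))) R.refl s gap w⁻¹ w ⟩
        s * w + - (gap * (w * w⁻¹))
          ≈⟨ R.+-congˡ (R.-‿cong (R.trans (R.*-congˡ ww⁻¹≈1) (R.*-identityʳ gap))) ⟩
        s * w + - gap
          ≈⟨ solve 3 (λ a F g → a :+ :- g := (a :+ :- F) :+ :- g :+ F) R.refl (s * w) Flt gap ⟩
        (s * w + - Flt) + - gap + Flt
          ≈⟨ R.+-congʳ (R.+-congʳ ½+½) ⟨
        (gap + gap) + - gap + Flt
          ≈⟨ R.+-congʳ (solve 1 (λ g → (g :+ g) :+ :- g := g) R.refl gap) ⟩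
        gap + Flt ∎

      Flt<tw : Flt < t * w
      Flt<tw = <-by 0<gap (R.trans (solve 2 (λ g F → g := (g :+ F) :+ :- F) R.refl gap Flt) (R.+-congʳ (R.sym tw≈)))

      0<t : 0# < t
      0<t = <-respʳ-≈ (begin
        (gap + Flt) * w⁻¹  ≈⟨ R.*-congʳ tw≈ ⟨
        t * w * w⁻¹        ≈⟨ R.*-assoc t w w⁻¹ ⟩
        t * (w * w⁻¹)      ≈⟨ R.trans (R.*-congˡ ww⁻¹≈1) (R.*-identityʳ t) ⟩
        t                  ∎) (*-positive (+-positive 0<gap 0≤Flt) (proj₁ (proj₂ (inverse 0<w))))

      0<s : 0# < s
      0<s = <-respʳ-≈ (solve 2 (λ s σ → (s :+ :- σ) :+ σ := s) R.refl s σ) (+-positive 0<t (<⇒≤ 0<σ))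

      p : ℕ → Point d
      p j = (fromℕ j * σ) ⊙ (y ⊕ (- 1#) ⊙ x)

      ζ : ℕ → Vector ℤ d
      ζ j = proj₁ (dilate-hits-lattice K-body Flt-constant K-width 0<t Flt<tw (p j))

      k : ℕ → Point d
      k j = proj₁ (proj₂ (dilate-hits-lattice K-body Flt-constant K-width 0<t Flt<tw (p j)))

      k∈K : ∀ j → k j ∈ K
      k∈K j = proj₁ (proj₂ (proj₂ (dilate-hits-lattice K-body Flt-constant K-width 0<t Flt<tw (p j))))

      ζ≋ : ∀ j → lattice (ζ j) ≋ p j ⊕ t ⊙ k j
      ζ≋ j = proj₂ (proj₂ (proj₂ (dilate-hits-lattice K-body Flt-constant K-width 0<t Flt<tw (p j))))

      step : ℕ → Vector ℤ d
      step j i = ζ (suc j) i ℤ.+ ℤ.-1ℤ ℤ.* ζ j i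

      -- Consecutive lattice points differ by σ (y - x) + t (k′ - k). Since σ + t = s, the weight τ
      -- = σ / s turns this into `s` times the difference of two convex combinations: τ y + (1 - τ)
      -- k′ and τ x + (1 - τ) k.
      step∈ : ∀ j → step j ∈ Differences s K
      step∈ j = τ ⊙ y ⊕ (1# + - τ) ⊙ k (suc j) , τ ⊙ x ⊕ (1# + - τ) ⊙ k j ,
        convex y∈K (k∈K (suc j)) 0≤τ τ≤1 , convex x∈K (k∈K j) 0≤τ τ≤1 , λ i → begin
          fromℤ (step j i)
            ≈⟨ fromℤ-difference (ζ (suc j) i) (ζ j i) ⟩
          fromℤ (ζ (suc j) i) + - fromℤ (ζ j i)
            ≈⟨ R.+-cong (ζ≋ (suc j) i) (R.-‿cong (ζ≋ j i)) ⟩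
          (((1# + fromℕ j) * σ) * (y i + - 1# * x i) + t * k (suc j) i) + - ((fromℕ j * σ) * (y i + - 1# * x i) + t * k j i)
            ≈⟨ solve 7 (λ n σ y x s k′ k →
                 (((:1 :+ n) :* σ) :* (y :+ (:- :1) :* x) :+ (s :+ :- σ) :* k′) :+ :- ((n :* σ) :* (y :+ (:- :1) :* x) :+ (s :+ :- σ) :* k) :=
                 σ :* (y :+ :- x) :+ (s :+ :- σ) :* (k′ :+ :- k)) R.refl (fromℕ j) σ (y i) (x i) s (k (suc j) i) (k j i) ⟩
          σ * (y i + - x i) + (s + - σ) * (k (suc j) i + - k j i)
            ≈⟨ R.+-cong (R.*-congʳ sτ≈σ) (R.*-congʳ (R.+-congˡ (R.-‿cong sτ≈σ))) ⟨
          (s * τ) * (y i + - x i) + (s + - (s * τ)) * (k (suc j) i + - k j i)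
            ≈⟨ solve 6 (λ s τ y x k′ k → (s :* τ) :* (y :+ :- x) :+ (s :+ :- (s :* τ)) :* (k′ :+ :- k) :=
                 s :* ((τ :* y :+ (:1 :+ :- τ) :* k′) :+ :- (τ :* x :+ (:1 :+ :- τ) :* k))) R.refl s τ (y i) (x i) (k (suc j) i) (k j i) ⟩
          s * ((τ * y i + (1# + - τ) * k (suc j) i) + - (τ * x i + (1# + - τ) * k j i)) ∎
        where
        s⁻¹ = proj₁ (inverse 0<s)
        0≤s⁻¹ = <⇒≤ (proj₁ (proj₂ (inverse 0<s)))
        ss⁻¹≈1 : s * s⁻¹ ≈ 1#
        ss⁻¹≈1 = proj₂ (proj₂ (inverse 0<s))
        τ = s⁻¹ * σ
        0≤τ : 0# ≤ τ
        0≤τ = 0≤s⁻¹ ⊠ <⇒≤ 0<σ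
        sτ≈σ : s * τ ≈ σ
        sτ≈σ = R.trans (R.sym (R.*-assoc s s⁻¹ σ)) (R.trans (R.*-congʳ ss⁻¹≈1) (R.*-identityˡ σ))
        τ≤1 : τ ≤ 1#
        τ≤1 = ≤-by (0≤s⁻¹ ⊠ <⇒≤ 0<t) (R.trans
          (solve 3 (λ q s σ → q :* (s :+ :- σ) := s :* q :+ :- (q :* σ)) R.refl s⁻¹ s σ) (R.+-congʳ ss⁻¹≈1))

      constant : ∀ j → f (ζ j) ≡ f (ζ 0)
      constant zero    = refl
      constant (suc j) = trans (ℤₚ.i-j≡0⇒i≡j (f (ζ (suc j))) (f (ζ j)) (trans
        (cong (λ a → f (ζ (suc j)) ℤ.+ a) (sym (ℤₚ.-1*i≡-i (f (ζ j)))))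
        (trans (sym (IsFunctional.linear f-functional (ζ (suc j)) ℤ.-1ℤ (ζ j))) (vanishes (step j) (step∈ j)))))
        (constant j)

      a : Carrier
      a = ⟨ u , y ⟩ + - ⟨ u , x ⟩

      value : ∀ j → fromℤ (f (ζ j)) ≈ (fromℕ j * σ) * a + t * ⟨ u , k j ⟩
      value j = begin
        fromℤ (f (ζ j))                                  ≈⟨ pairing-lattice f-functional (ζ j) ⟨
        ⟨ u , lattice (ζ j) ⟩                            ≈⟨ pairing-cong u (ζ≋ j) ⟩
        ⟨ u , p j ⊕ t ⊙ k j ⟩                            ≈⟨ pairing-linear u (p j) t (k j) ⟩
        ⟨ u , p j ⟩ + t * ⟨ u , k j ⟩                    ≈⟨ R.+-congʳ (drift (fromℕ j * σ)) ⟩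
        (fromℕ j * σ) * a + t * ⟨ u , k j ⟩              ∎
        where
        drift : ∀ c → ⟨ u , c ⊙ (y ⊕ (- 1#) ⊙ x) ⟩ ≈ c * a
        drift c = begin
          ⟨ u , c ⊙ (y ⊕ (- 1#) ⊙ x) ⟩
            ≈⟨ ∑.sum-cong-≋ (λ i → solve 3 (λ u c v → u :* (c :* v) := c :* (u :* v)) R.refl (fromℤ (u i)) c (y i + - 1# * x i)) ⟩
          sum (λ i → c * (fromℤ (u i) * (y i + - 1# * x i)))
            ≈⟨ ∑.*-distribˡ-sum c (λ i → fromℤ (u i) * (y i + - 1# * x i)) ⟨
          c * ⟨ u , y ⊕ (- 1#) ⊙ x ⟩
            ≈⟨ R.*-congˡ (R.trans (pairing-linear u y (- 1#) x) (R.+-congˡ (-‿.-1*x≈-x ⟨ u , x ⟩))) ⟩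
          c * a ∎

      m : ℕ
      m = proj₁ (compact⇒bounded compact)

      bound : Carrier
      bound = sum (λ i → ∣ fromℤ (u i) ∣ * fromℕ m)

      pairing≤ : ∀ j → ⟨ u , k j ⟩ ≤ bound
      pairing≤ j = pairing-bounded u (0≤fromℕ m) (k j) (proj₂ (compact⇒bounded compact) (k∈K j))

      pairing≥ : ∀ j → - ⟨ u , k j ⟩ ≤ bound
      pairing≥ j = ≤.≤-respˡ-≈ (begin
        sum (λ i → fromℤ (u i) * - k j i)        ≈⟨ ∑.sum-cong-≋ (λ i → solve 2 (λ u k → u :* :- k := (:- :1) :* (u :* k)) R.refl (fromℤ (u i)) (k j i)) ⟩
        sum (λ i → - 1# * (fromℤ (u i) * k j i)) ≈⟨ ∑.*-distribˡ-sum (- 1#) (λ i → fromℤ (u i) * k j i) ⟨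
        (- 1# * ⟨ u , k j ⟩)                     ≈⟨ -‿.-1*x≈-x _ ⟩
        (- ⟨ u , k j ⟩)                          ∎)
        (pairing-bounded u (0≤fromℕ m) (λ i → - k j i) λ i →
          proj₂ (bounded i) , ≤.≤-respˡ-≈ (R.sym (-‿.-‿involutive (k j i))) (proj₁ (bounded i)))
        where
        bounded : Bounded (fromℕ m) (k j)
        bounded = proj₂ (compact⇒bounded compact) (k∈K j)

      -- Equality of `f (ζ j)` and `f (ζ 0)` reads j σ a = t (⟨u, k₀⟩ - ⟨u, kⱼ⟩), and the right side
      -- is bounded independently of `j` because `K` is bounded.
      drift-bounded : ∀ j → fromℕ j * (σ * a) ≤ t * (bound + bound)
      drift-bounded j = ≤-by (<⇒≤ 0<t ⊠ (diff (pairing≤ 0) ⊞ diff (pairing≥ j))) (begin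
        t * ((bound + - ⟨ u , k 0 ⟩) + (bound + - (- ⟨ u , k j ⟩)))
          ≈⟨ solve 7 (λ t B v₀ v n σ a → t :* ((B :+ :- v₀) :+ (B :+ :- (:- v))) :=
               t :* (B :+ B) :+ :- (((:0 :* σ) :* a :+ t :* v₀) :+ :- (((n :* σ) :* a :+ t :* v)) :+ n :* (σ :* a)))
               R.refl t bound ⟨ u , k 0 ⟩ ⟨ u , k j ⟩ (fromℕ j) σ a ⟩
        t * (bound + bound) + - (((0# * σ) * a + t * ⟨ u , k 0 ⟩) + - ((fromℕ j * σ) * a + t * ⟨ u , k j ⟩) + fromℕ j * (σ * a))
          ≈⟨ R.+-congˡ (R.-‿cong (R.trans (R.+-congʳ same) (R.+-identityˡ (fromℕ j * (σ * a))))) ⟩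
        t * (bound + bound) + - (fromℕ j * (σ * a)) ∎)
        where
        same : ((0# * σ) * a + t * ⟨ u , k 0 ⟩) + - ((fromℕ j * σ) * a + t * ⟨ u , k j ⟩) ≈ 0#
        same = begin
          ((0# * σ) * a + t * ⟨ u , k 0 ⟩) + - ((fromℕ j * σ) * a + t * ⟨ u , k j ⟩)
            ≈⟨ R.+-cong (value 0) (R.-‿cong (value j)) ⟨
          fromℤ (f (ζ 0)) + - fromℤ (f (ζ j))
            ≡⟨ cong (λ v → fromℤ (f (ζ 0)) + - fromℤ v) (constant j) ⟩
          fromℤ (f (ζ 0)) + - fromℤ (f (ζ 0))
            ≈⟨ R.-‿inverseʳ (fromℤ (f (ζ 0))) ⟩
          0# ∎

      escape : ∃[ n ] t * (bound + bound) < fromℕ n * (σ * a)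
      escape = archimedean-* (t * (bound + bound)) (*-positive 0<σ (diff< x<y))

    differences-spanning : ∀ {s} → Flt < s * w → Spanning (Differences s K)
    differences-spanning {s} Flt<sw {f} f-functional (v , fv≢0)
      with em {∃[ v ] v ∈ Differences s K × ¬ f v ≡ ℤ.0ℤ}
    ... | yes found = found
    ... | no ¬found =
      let x , y , x∈K , y∈K , x<y = nonconstant nonEmpty K-width 0<w {f ∘ unit} nonZero
          n , far = Walk.escape Flt<sw f-functional vanishes x∈K y∈K x<y
      in ⊥-elim (<⇒≱ far (Walk.drift-bounded Flt<sw f-functional vanishes x∈K y∈K x<y n))
      where
      vanishes : ∀ v → v ∈ Differences s K → f v ≡ ℤ.0ℤ
      vanishes v v∈ with f v ℤₚ.≟ ℤ.0ℤ
      ... | yes fv≡0 = fv≡0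
      ... | no  fv≢0 = ⊥-elim (¬found (v , v∈ , fv≢0))
      nonZero : NonZero (f ∘ unit)
      nonZero u≡0 = fv≢0 (trans (functional-coordinates f-functional v) (trans
        (ℤΣ.sum-cong-≗ λ i → trans (cong (v i ℤ.*_) (u≡0 i)) (ℤₚ.*-zeroʳ (v i))) (ℤΣ.sum-replicate-zero d)))

    simplex-in-dilate : ∀ {s} → Flt < s * w → SimplexIn (λ _ → ⊤) (s * fromℕ d) K
    simplex-in-dilate {s} Flt<sw = record
      { matrix     = B.matrix
      ; base       = base
      ; unimodular = inj₁ B.unimodular
      ; base∈T     = tt
      ; vertex₀    = proj₁ (average υ υ∈K)
      ; vertex₀∈   = proj₁ (proj₂ (average υ υ∈K))
      ; base≈      = λ r → R.trans (R.*-congˡ (proj₂ (proj₂ (average υ υ∈K)) r)) (R.sym (R.*-assoc s (fromℕ d) _))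
      ; vertex     = λ i → proj₁ (average (q i) (q∈K i))
      ; vertex∈    = λ i → proj₁ (proj₂ (average (q i) (q∈K i)))
      ; column≈    = λ i r → R.trans (column≈ i r)
                       (R.trans (R.*-congˡ (proj₂ (proj₂ (average (q i) (q∈K i))) r)) (R.sym (R.*-assoc s (fromℕ d) _)))
      }
      where
      module B = ZonotopeBasis (zonotopeBasis (Differences s K) (λ {v} → differences-symmetric {s = s} {K} {v})
        (λ {f} → differences-spanning {s} Flt<sw {f}))

      average : (q : Fin d → Point d) → (∀ j → q j ∈ K) → ∃[ k ] k ∈ K × ∀ r → sum (λ j → q j r) ≈ fromℕ d * k r
      average q q∈K =
        let k , k∈K , eq = convex-combination convex nonEmpty (λ _ → 1#) q (λ _ → 0≤1) q∈K
        in k , k∈K , λ r → R.trans (∑.sum-cong-≋ λ j → R.sym (R.*-identityˡ (q j r)))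
                                   (R.trans (eq r) (R.*-congʳ (sum-1 d)))

      ξ υ : Fin d → Point d
      ξ j = proj₁ (B.generator∈ j)
      υ j = proj₁ (proj₂ (B.generator∈ j))
      ξ∈K : ∀ j → ξ j ∈ K
      ξ∈K j = proj₁ (proj₂ (proj₂ (B.generator∈ j)))
      υ∈K : ∀ j → υ j ∈ K
      υ∈K j = proj₁ (proj₂ (proj₂ (proj₂ (B.generator∈ j))))
      generator≈ : ∀ j r → fromℤ (B.generator j r) ≈ s * (ξ j r + - υ j r)
      generator≈ j = proj₂ (proj₂ (proj₂ (proj₂ (B.generator∈ j))))

      base : Point d
      base r = s * sum (λ j → υ j r)

      N N⁻¹ : Carrier
      N = fromℕ B.denominator
      N⁻¹ = proj₁ (inverse (0<fromℕ B.positive))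
      0≤N⁻¹ : 0# ≤ N⁻¹
      0≤N⁻¹ = <⇒≤ (proj₁ (proj₂ (inverse (0<fromℕ B.positive))))
      NN⁻¹≈1 : N * N⁻¹ ≈ 1#
      NN⁻¹≈1 = proj₂ (proj₂ (inverse (0<fromℕ B.positive)))

      τ : Fin d → Fin d → Carrier
      τ i j = N⁻¹ * fromℕ (B.coefficient i j)

      τ≤1 : ∀ i j → τ i j ≤ 1#
      τ≤1 i j = ≤.≤-respʳ-≈ (R.trans (R.*-comm N⁻¹ N) NN⁻¹≈1) (*-monoˡ-≤ 0≤N⁻¹ (fromℕ-mono (B.bounded i j)))

      -- The point of the segment from `υ j` to `ξ j` that absorbs the `j`-th term of the `i`-th
      -- basis vector. It lies in `K` because the zonotope coefficient lies in [0, 1].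
      q : Fin d → Fin d → Point d
      q i j = τ i j ⊙ ξ j ⊕ (1# + - τ i j) ⊙ υ j

      q∈K : ∀ i j → q i j ∈ K
      q∈K i j = convex (ξ∈K j) (υ∈K j) (0≤N⁻¹ ⊠ 0≤fromℕ (B.coefficient i j)) (τ≤1 i j)

      entry≈ : ∀ i r → fromℤ (B.matrix r i) ≈ sum (λ j → s * (τ i j * (ξ j r + - υ j r)))
      entry≈ i r = begin
        fromℤ (B.matrix r i)
          ≈⟨ cancel-inverse (fromℤ (B.matrix r i)) NN⁻¹≈1 ⟨
        N⁻¹ * (N * fromℤ (B.matrix r i))
          ≈⟨ R.*-congˡ (fromℤ-* (+ B.denominator) (B.matrix r i)) ⟨
        N⁻¹ * fromℤ (+ B.denominator ℤ.* B.matrix r i)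
          ≡⟨ cong (λ v → N⁻¹ * fromℤ v) (B.relation i r) ⟩
        N⁻¹ * fromℤ (sumℤ λ j → + B.coefficient i j ℤ.* B.generator j r)
          ≈⟨ R.*-congˡ (fromℤ-∑ (λ j → + B.coefficient i j ℤ.* B.generator j r)) ⟩
        N⁻¹ * sum (λ j → fromℤ (+ B.coefficient i j ℤ.* B.generator j r))
          ≈⟨ ∑.*-distribˡ-sum N⁻¹ (λ j → fromℤ (+ B.coefficient i j ℤ.* B.generator j r)) ⟩
        sum (λ j → N⁻¹ * fromℤ (+ B.coefficient i j ℤ.* B.generator j r))
          ≈⟨ ∑.sum-cong-≋ (λ j → R.trans
               (R.*-congˡ (R.trans (fromℤ-* (+ B.coefficient i j) (B.generator j r)) (R.*-congˡ (generator≈ j r))))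
               (solve 4 (λ q n s v → q :* (n :* (s :* v)) := s :* ((q :* n) :* v))
                 R.refl N⁻¹ (fromℕ (B.coefficient i j)) s (ξ j r + - υ j r))) ⟩
        sum (λ j → s * (τ i j * (ξ j r + - υ j r))) ∎

      column≈ : ∀ i r → column B.matrix base i r ≈ s * sum (λ j → q i j r)
      column≈ i r = begin
        s * sum (λ j → υ j r) + fromℤ (B.matrix r i)
          ≈⟨ R.+-cong (∑.*-distribˡ-sum s (λ j → υ j r)) (entry≈ i r) ⟩
        sum (λ j → s * υ j r) + sum (λ j → s * (τ i j * (ξ j r + - υ j r)))
          ≈⟨ ∑.∑-distrib-+ (λ j → s * υ j r) (λ j → s * (τ i j * (ξ j r + - υ j r))) ⟨
        sum (λ j → s * υ j r + s * (τ i j * (ξ j r + - υ j r)))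
          ≈⟨ ∑.sum-cong-≋ (λ j → solve 4 (λ s t ξ υ → s :* υ :+ s :* (t :* (ξ :+ :- υ)) := s :* (t :* ξ :+ (:1 :+ :- t) :* υ))
               R.refl s (τ i j) (ξ j r) (υ j r)) ⟩
        sum (λ j → s * q i j r)
          ≈⟨ ∑.*-distribˡ-sum s (λ j → q i j r) ⟨
        s * sum (λ j → q i j r) ∎

  -- Compactness of boxes and positivity of the flatness constant

  Box : Carrier → Carrier → Subset d
  Box l r x = ∀ i → l ≤ x i × x i ≤ r

  -- Abstracts the sets with a finite subcover. The induction on dimension has to change the ideal
  -- from one step to the next, so Heine-Borel is stated for all ideals at once.
  record IsIdeal (C : Subset d → Set) : Set₁ where
    field
      ⊆-closed : ∀ {S S′ : Subset d} → S ⊆ S′ → C S′ → C S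
      ∪-closed : ∀ {S S′ : Subset d} → C S → C S′ → C (λ x → x ∈ S ⊎ x ∈ S′)

  Within : Carrier → Carrier → Carrier → Set
  Within ε a b = a ≤ b + ε × b ≤ a + ε

  slab : Carrier → Carrier → Subset d → Subset (suc d)
  slab ε a S y = Within ε (y zero) a × (λ i → y (suc i)) ∈ S

  -- Let `s` be the supremum of the points reached. The radius at `s` carries `D` from some reached
  -- point just below or at `s` to everything up to `s + ρ`; this includes `r`, or else contradicts
  -- the choice of `s`.
  real-induction : ∀ {l r} → l ≤ r → (D : Carrier → Set) → D l →
    (∀ a → l ≤ a → a ≤ r → ∃[ ε ] 0# < ε × ∀ t t′ → a < t + ε → t′ ≤ a + ε → D t → D t′) → D r
  real-induction {l} {r} l≤r D D-l step = conclude (≤∨> r (s + ρ))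
    where
    Reached : Carrier → Set
    Reached t = (l ≤ t × t ≤ r) × D t
    sup : ∃ (IsSupremum _≤_ Reached)
    sup = supremum Reached (l , (≤.refl , l≤r) , D-l) (r , λ t ((_ , t≤r) , _) → t≤r)
    s : Carrier
    s = proj₁ sup
    upper : IsUpperBound _≤_ Reached s
    upper = proj₁ (proj₂ sup)
    l≤s : l ≤ s
    l≤s = upper l ((≤.refl , l≤r) , D-l)
    local : ∃[ ε ] 0# < ε × ∀ t t′ → s < t + ε → t′ ≤ s + ε → D t → D t′
    local = step s l≤s (proj₂ (proj₂ sup) r λ t ((_ , t≤r) , _) → t≤r)
    ρ : Carrier
    ρ = proj₁ local
    0<ρ : 0# < ρ
    0<ρ = proj₁ (proj₂ local)
    near-sup : ∃[ t ] Reached t × s < t + ρ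
    near-sup with em {∃[ t ] Reached t × s < t + ρ}
    ... | yes found = found
    ... | no ¬found = ⊥-elim (<⇒≱ (<-by 0<ρ (solve 2 (λ s ρ → ρ := s :+ :- (s :+ :- ρ)) R.refl s ρ))
      (proj₂ (proj₂ sup) (s + - ρ) λ t reached → ≤-by (diff (≮⇒≥ λ s<t+ρ → ¬found (t , reached , s<t+ρ)))
        (solve 3 (λ s t ρ → s :+ :- (t :+ ρ) := (s :+ :- ρ) :+ :- t) R.refl s t ρ)))
    s<s+ρ : s < s + ρ
    s<s+ρ = <-by 0<ρ (solve 2 (λ s ρ → ρ := (s :+ ρ) :+ :- s) R.refl s ρ)
    extend : ∀ t′ → t′ ≤ s + ρ → D t′
    extend t′ t′≤ = proj₂ (proj₂ local) (proj₁ near-sup) t′ (proj₂ (proj₂ near-sup)) t′≤ (proj₂ (proj₁ (proj₂ near-sup)))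
    conclude : r ≤ s + ρ ⊎ s + ρ < r → D r
    conclude (inj₁ r≤s+ρ) = extend r r≤s+ρ
    conclude (inj₂ s+ρ<r) = ⊥-elim (<⇒≱ s<s+ρ
      (upper (s + ρ) ((≤.trans l≤s (<⇒≤ s<s+ρ) , <⇒≤ s+ρ<r) , extend (s + ρ) ≤.refl)))

  -- Heine–Borel, by induction on the dimension: each fibre is handled by the
  -- induction hypothesis and the fibres are glued along the first coordinate.
  box-ideal : ∀ {l r} → l ≤ r → ∀ d (C : Subset d → Set) → IsIdeal C →
    (∀ x → x ∈ Box l r → ∃[ ε ] 0# < ε × C (λ y → Near ε y x)) → C (Box l r)
  box-ideal {l} {r} l≤r zero C ideal local =
    let ε , _ , c = local (λ ()) λ ()
    in IsIdeal.⊆-closed ideal {S = Box l r} {λ y → Near ε y (λ ())} (λ _ ()) c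
  box-ideal {l} {r} l≤r (suc d) C ideal local =
    ⊆-closed (λ h → h zero , (h ∘ suc)) (real-induction l≤r Upto Upto-l extend)
    where
    open IsIdeal ideal
    within-mono : ∀ {ε δ a b} → ε ≤ δ → Within ε a b → Within δ a b
    within-mono ε≤δ (p , q) = ≤.trans p (+-mono ≤.refl ε≤δ) , ≤.trans q (+-mono ≤.refl ε≤δ)
    -- Subsets of the fibre over `a` that remain in the ideal after thickening in the first
    -- coordinate. The thickness is what lets neighbouring fibres be glued.
    Fibre : Carrier → Subset d → Set
    Fibre a S = ∃[ ε ] 0# < ε × C (slab ε a S)
    fibre-ideal : ∀ a → IsIdeal (Fibre a)
    fibre-ideal a = record
      { ⊆-closed = λ S⊆S′ (ε , 0<ε , c) → ε , 0<ε , ⊆-closed (λ (p , q) → p , S⊆S′ q) c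
      ; ∪-closed = λ {S} {S′} (ε , 0<ε , c) (ε′ , 0<ε′ , c′) → union {S} {S′} 0<ε c 0<ε′ c′ (≤.total ε ε′) }
      where
      union : ∀ {S S′ : Subset d} {ε ε′} → 0# < ε → C (slab ε a S) → 0# < ε′ → C (slab ε′ a S′) →
        ε ≤ ε′ ⊎ ε′ ≤ ε → Fibre a (λ x → x ∈ S ⊎ x ∈ S′)
      union {ε = ε} 0<ε c 0<ε′ c′ (inj₁ ε≤ε′) = ε , 0<ε , ⊆-closed
        (λ { (p , inj₁ q) → inj₁ (p , q) ; (p , inj₂ q) → inj₂ (within-mono ε≤ε′ p , q) }) (∪-closed c c′)
      union {ε′ = ε′} 0<ε c 0<ε′ c′ (inj₂ ε′≤ε) = ε′ , 0<ε′ , ⊆-closed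
        (λ { (p , inj₁ q) → inj₁ (within-mono ε′≤ε p , q) ; (p , inj₂ q) → inj₂ (p , q) }) (∪-closed c c′)
    fibre : ∀ a → l ≤ a → a ≤ r → Fibre a (Box l r)
    fibre a l≤a a≤r = box-ideal l≤r d (Fibre a) (fibre-ideal a) λ x x∈Box →
      let ε , 0<ε , c = local (a ∷ x) (λ { zero → l≤a , a≤r ; (suc i) → x∈Box i })
      -- One radius in two roles: the ball within the fibre and the thickness of the slab over it.
      in ε , 0<ε , ε , 0<ε , ⊆-closed (λ { (p , q) zero → p ; (p , q) (suc i) → q i }) c
    Upto : Carrier → Set
    Upto t = C (λ y → (l ≤ y zero × y zero ≤ t) × (y ∘ suc) ∈ Box l r)
    enlarge : ∀ {a b ε} → a ≤ b → 0# ≤ ε → a ≤ b + ε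
    enlarge {a} {b} {ε} a≤b 0≤ε = ≤-by (diff a≤b ⊞ 0≤ε)
      (solve 3 (λ a b ε → (b :+ :- a) :+ ε := (b :+ ε) :+ :- a) R.refl a b ε)
    Upto-l : Upto l
    Upto-l = let ε , 0<ε , c = fibre l ≤.refl l≤r in
      ⊆-closed (λ ((l≤y , y≤l) , q) → (enlarge y≤l (<⇒≤ 0<ε) , enlarge l≤y (<⇒≤ 0<ε)) , q) c
    extend : ∀ a → l ≤ a → a ≤ r → ∃[ ε ] 0# < ε × ∀ t t′ → a < t + ε → t′ ≤ a + ε → Upto t → Upto t′
    extend a l≤a a≤r = let ε , 0<ε , c = fibre a l≤a a≤r in
      ε , 0<ε , λ t t′ a<t+ε t′≤a+ε upto → ⊆-closed (λ {y} → split a<t+ε t′≤a+ε {y}) (∪-closed upto c)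
      where
      -- Points with first coordinate at most `t` are already covered; those beyond lie within ε of
      -- `a`, because `a < t + ε`.
      split : ∀ {t t′ ε} → a < t + ε → t′ ≤ a + ε → ∀ {y : Point (suc d)} →
        (l ≤ y zero × y zero ≤ t′) × (y ∘ suc) ∈ Box l r →
        ((l ≤ y zero × y zero ≤ t) × (y ∘ suc) ∈ Box l r) ⊎ y ∈ slab ε a (Box l r)
      split {t} a<t+ε t′≤a+ε {y} ((l≤y , y≤t′) , q) with ≤∨> (y zero) t
      ... | inj₁ y≤t = inj₁ ((l≤y , y≤t) , q)
      ... | inj₂ t<y = inj₂ ((≤.trans y≤t′ t′≤a+ε , ≤.trans (<⇒≤ a<t+ε) (+-mono (<⇒≤ t<y) ≤.refl)) , q)

  box-compact : ∀ {l r} → l ≤ r → Compact (Box {d} l r)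
  box-compact {d} l≤r {I} U U-open cover = box-ideal l≤r d Covered ideal λ x x∈Box →
    let i , x∈U = cover x∈Box
        ε , 0<ε , h = open⇒near (U-open i) x∈U
    in ε , 0<ε , i List.∷ List.[] , λ {y} y~x → here (h y y~x)
    where
    Covered : Subset d → Set
    Covered S = Σ[ is ∈ List I ] (S ⊆ λ x → Any (λ i → x ∈ U i) is)
    ideal : IsIdeal Covered
    ideal = record
      { ⊆-closed = λ S⊆S′ (is , h) → is , λ x∈S → h (S⊆S′ x∈S)
      ; ∪-closed = λ (is , h) (js , h′) → is List.++ js ,
          λ { (inj₁ x∈S) → Any.++⁺ˡ (h x∈S) ; (inj₂ x∈S′) → Any.++⁺ʳ is (h′ x∈S′) } }

  box-body : ∀ {l r} → l ≤ r → IsConvexBody (Box {d} l r)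
  box-body {l = l} {r} l≤r = record
    { respects = λ x≋y h i → ≤.≤-respʳ-≈ (x≋y i) (proj₁ (h i)) , ≤.≤-respˡ-≈ (x≋y i) (proj₂ (h i))
    ; nonEmpty = (λ _ → l) , λ _ → ≤.refl , l≤r
    ; convex   = λ {x} {y} {t} x∈ y∈ 0≤t t≤1 i →
        ≤-by (0≤t ⊠ diff (proj₁ (x∈ i)) ⊞ diff t≤1 ⊠ diff (proj₁ (y∈ i)))
          (solve 4 (λ t x y l → t :* (x :+ :- l) :+ (:1 :+ :- t) :* (y :+ :- l) := (t :* x :+ (:1 :+ :- t) :* y) :+ :- l)
            R.refl t (x i) (y i) l) ,
        ≤-by (0≤t ⊠ diff (proj₂ (x∈ i)) ⊞ diff t≤1 ⊠ diff (proj₂ (y∈ i)))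
          (solve 4 (λ t x y r → t :* (r :+ :- x) :+ (:1 :+ :- t) :* (r :+ :- y) := r :+ :- (t :* x :+ (:1 :+ :- t) :* y))
            R.refl t (x i) (y i) r)
    ; compact  = box-compact l≤r
    }

  ¼ : Carrier
  ¼ = ½ * ½

  0<¼ : 0# < ¼
  0<¼ = *-positive 0<½ 0<½

  ½<1 : ½ < 1#
  ½<1 = ≤-<-trans (≤.reflexive (R.sym (R.*-identityʳ ½))) (½x<x 0<1)

  ¼<½ : ¼ < ½
  ¼<½ = ½x<x 0<½

  -- No integer lies between ¼ and ½. A coordinate must exist for this: in dimension 0 the box is
  -- the single lattice point.
  box-hollow : Hollow (Box {suc d} ¼ ½)
  box-hollow z z∈ = <⇒≱ 0<¼ (≤.trans (proj₁ (z∈ zero)) (fromℤ-mono (fromℤ-cancel-≤ {z zero} {ℤ.0ℤ}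
    (≤-<-trans (proj₂ (z∈ zero)) (<-respʳ-≈ (R.sym (R.+-identityˡ 1#)) ½<1)))))

  basis-bounds : ∀ (i j : Fin d) → 0# ≤ basis i j × basis i j ≤ 1#
  basis-bounds i j with does (i ≟ j)
  ... | true  = 0≤1 , ≤.refl
  ... | false = ≤.refl , 0≤1

  1≤fromℕ : ∀ n → 1# ≤ fromℕ (suc n)
  1≤fromℕ n = ≤-by (0≤fromℕ n) (solve 1 (λ n → n := (:1 :+ n) :+ :- :1) R.refl (fromℕ n))

  1≤∣fromℤ∣ : ∀ {a} → ¬ a ≡ ℤ.0ℤ → 1# ≤ ∣ fromℤ a ∣
  1≤∣fromℤ∣ {ℤ.+0}       a≢0 = ⊥-elim (a≢0 refl)
  1≤∣fromℤ∣ {ℤ.+[1+ n ]} _   = ≤.trans (1≤fromℕ n) (x≤∣x∣ (fromℕ (suc n)))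
  1≤∣fromℤ∣ {ℤ.-[1+ n ]} _   = ≤.trans (1≤fromℕ n)
    (≤.trans (≤.reflexive (R.sym (-‿.-‿involutive (fromℕ (suc n))))) (-x≤∣x∣ (- fromℕ (suc n))))

  nonZero-coordinate : ∀ {u : Vector ℤ d} → NonZero u → ∃[ i ] ¬ u i ≡ ℤ.0ℤ
  nonZero-coordinate {u = u} u≢0 with em {∃[ i ] ¬ u i ≡ ℤ.0ℤ}
  ... | yes found = found
  ... | no ¬found = ⊥-elim (u≢0 vanish)
    where
    vanish : ∀ i → u i ≡ ℤ.0ℤ
    vanish i with u i ℤₚ.≟ ℤ.0ℤ
    ... | yes eq = eq
    ... | no neq = ⊥-elim (¬found (i , neq))

  box-width : IsLatticeWidth (Box {suc d} ¼ ½) ¼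
  box-width {d} = (unit zero , (λ u≡0 → 1≢0 (u≡0 zero)) , attained , upper) , lower
    where
    1≢0 : ¬ ℤ.1ℤ ≡ ℤ.0ℤ
    1≢0 ()
    gap≈ : ½ + - ¼ ≈ ¼
    gap≈ = R.trans (R.+-congʳ (R.sym (½+½ {½}))) (solve 1 (λ q → (q :+ q) :+ :- q := q) R.refl ¼)
    value : ∀ (x : Point (suc d)) → ⟨ unit zero , x ⟩ ≈ x zero
    value x = R.trans
      (R.+-cong (R.trans (R.*-congʳ (R.+-identityʳ 1#)) (R.*-identityˡ (x zero)))
                (R.trans (∑.sum-cong-≋ λ i → R.zeroˡ (x (suc i))) (∑.sum-replicate-zero d)))
      (R.+-identityʳ (x zero))
    extent≈ : ∀ x y → extent (unit zero) x y ≈ ∣ x zero + - y zero ∣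
    extent≈ x y = ∣∣-cong (R.+-cong (value x) (R.-‿cong (value y)))
    0≤x⇒x≈∣x∣ : ∀ {x} → 0# ≤ x → x ≈ ∣ x ∣
    0≤x⇒x≈∣x∣ {x} 0≤x = ≤.antisym (x≤∣x∣ x) (∣∣≤ ≤.refl (≤-by (0≤x ⊞ 0≤x) (solve 1 (λ x → x :+ x := x :+ :- (:- x)) R.refl x)))
    attained : ∃[ x ] ∃[ y ] x ∈ Box {suc d} ¼ ½ × y ∈ Box ¼ ½ × ¼ ≈ extent (unit zero) x y
    attained = (λ _ → ½) , (λ _ → ¼) , (λ _ → <⇒≤ ¼<½ , ≤.refl) , (λ _ → ≤.refl , <⇒≤ ¼<½) ,
      R.trans (0≤x⇒x≈∣x∣ (<⇒≤ 0<¼)) (R.trans (∣∣-cong (R.sym gap≈)) (R.sym (extent≈ (λ _ → ½) (λ _ → ¼))))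
    upper : ∀ r → (∃[ x ] ∃[ y ] x ∈ Box {suc d} ¼ ½ × y ∈ Box ¼ ½ × r ≈ extent (unit zero) x y) → r ≤ ¼
    upper r (x , y , x∈ , y∈ , r≈) = ≤.trans (≤.reflexive (R.trans r≈ (extent≈ x y)))
      (≤.trans (∣∣≤
        (≤-by (diff (proj₂ (x∈ zero)) ⊞ diff (proj₁ (y∈ zero)))
          (solve 4 (λ h q x y → (h :+ :- x) :+ (y :+ :- q) := (h :+ :- q) :+ :- (x :+ :- y)) R.refl ½ ¼ (x zero) (y zero)))
        (≤-by (diff (proj₂ (y∈ zero)) ⊞ diff (proj₁ (x∈ zero)))
          (solve 4 (λ h q x y → (h :+ :- y) :+ (x :+ :- q) := (h :+ :- q) :+ :- (:- (x :+ :- y))) R.refl ½ ¼ (x zero) (y zero))))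
        (≤.reflexive gap≈))
    lower : ∀ r → (∃[ u ] NonZero u × IsWidthAlong u (Box {suc d} ¼ ½) r) → ¼ ≤ r
    -- A nonzero integer has absolute value at least 1. Moving by ¼ along axis `i` from the corner
    -- with all coordinates ¼ stays in the cube and changes `u` by `¼ * fromℤ (u i)`.
    lower r (u , u≢0 , _ , upper) =
      let i , uᵢ≢0 = nonZero-coordinate u≢0
      in ≤.trans (≤.trans (≤.reflexive (R.sym (R.*-identityʳ ¼))) (*-monoˡ-≤ (<⇒≤ 0<¼) (1≤∣fromℤ∣ uᵢ≢0)))
           (upper (¼ * ∣ fromℤ (u i) ∣) (corner i , (λ _ → ¼) , corner∈ i , (λ _ → ≤.refl , <⇒≤ ¼<½) , extent-corner i))
      where
      corner : Fin (suc d) → Point (suc d)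
      corner i = (λ _ → ¼) ⊕ ¼ ⊙ (λ j → basis j i)
      corner∈ : ∀ i → corner i ∈ Box ¼ ½
      corner∈ i j =
        ≤-by (<⇒≤ 0<¼ ⊠ proj₁ (basis-bounds j i)) (solve 2 (λ q e → q :* e := (q :+ q :* e) :+ :- q) R.refl ¼ (basis j i)) ,
        ≤-by (<⇒≤ 0<¼ ⊠ diff (proj₂ (basis-bounds j i))) (R.trans
          (solve 2 (λ q e → q :* (:1 :+ :- e) := (q :+ q) :+ :- (q :+ q :* e)) R.refl ¼ (basis j i)) (R.+-congʳ ½+½))
      extent-corner : ∀ i → ¼ * ∣ fromℤ (u i) ∣ ≈ extent u (corner i) (λ _ → ¼)
      extent-corner i = R.trans (R.sym (∣∣-scale (<⇒≤ 0<¼))) (∣∣-cong (R.sym (begin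
        ⟨ u , corner i ⟩ + - ⟨ u , (λ _ → ¼) ⟩
          ≈⟨ R.+-congʳ (R.trans (pairing-linear u (λ _ → ¼) ¼ (λ j → basis j i))
               (R.+-congˡ (R.*-congˡ (sum-basis (λ j → fromℤ (u j)) i)))) ⟩
        (⟨ u , (λ _ → ¼) ⟩ + ¼ * fromℤ (u i)) + - ⟨ u , (λ _ → ¼) ⟩
          ≈⟨ solve 2 (λ p v → (p :+ v) :+ :- p := v) R.refl _ (¼ * fromℤ (u i)) ⟩
        ¼ * fromℤ (u i) ∎)))

  flatness-positive : ∀ {Flt} → 1 ℕ.≤ d → IsFlatnessConstant d Flt → 0# < Flt
  flatness-positive {suc d} _ (upper , _) =
    <-≤-trans 0<¼ (upper ¼ (Box ¼ ½ , box-body (<⇒≤ ¼<½) , box-hollow , box-width))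

  -- Limits of lattice points and integral base vertices

  Lattice : Subset d
  Lattice x = ∃[ z ] x ≋ lattice z

  -- Two lattice points within ¼ of `x` differ by at most ½ in each coordinate and therefore
  -- coincide, so a single lattice point serves for every smaller ε.
  lattice-closed : ∀ {x : Point d} → x ∈ Closure Lattice → ∃[ z ] lattice z ≋ x
  lattice-closed {d} {x} x∈closure = z₀ , near-all⇒≋ close
    where
    nearest : ∀ ε → 0# < ε → ∃[ z ] Near ε (lattice z) x
    nearest ε 0<ε = let y , (z , y≋z) , y~x = x∈closure ε 0<ε in z , near-cong {x = y} {lattice z} {x} {x} y≋z (λ _ → R.refl) y~x
    z₀ : Vector ℤ d
    z₀ = proj₁ (nearest ¼ 0<¼)
    z₀~x : Near ¼ (lattice z₀) x
    z₀~x = proj₂ (nearest ¼ 0<¼)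
    unique : ∀ z → Near ¼ (lattice z) x → ∀ i → z i ≡ z₀ i
    unique z z~x i = ℤₚ.≤-antisym (below (proj₁ (z~z₀ i))) (below (proj₂ (z~z₀ i)))
      where
      z~z₀ : Near (¼ + ¼) (lattice z) (lattice z₀)
      z~z₀ = near-trans {x = lattice z} {x} {lattice z₀} z~x (near-sym {x = lattice z₀} {x} z₀~x)
      below : ∀ {a b} → fromℤ a ≤ fromℤ b + (¼ + ¼) → a ℤ.≤ b
      below {a} {b} p = fromℤ-cancel-≤ (≤-<-trans p (<-by (diff< ½<1) (R.trans (R.+-congˡ (R.-‿cong (R.sym ½+½)))
        (solve 2 (λ b q → :1 :+ :- (q :+ q) := (b :+ :1) :+ :- (b :+ (q :+ q))) R.refl (fromℤ b) ¼))))
    close : ∀ ε → 0# < ε → Near ε (lattice z₀) x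
    close ε 0<ε = split (≤.total ε ¼)
      where
      split : ε ≤ ¼ ⊎ ¼ ≤ ε → Near ε (lattice z₀) x
      split (inj₂ ¼≤ε) = near-mono {x = lattice z₀} {x} ¼≤ε z₀~x
      split (inj₁ ε≤¼) = let z , z~x = nearest ε 0<ε in
        near-cong {x = lattice z} {lattice z₀} {x} {x}
          (λ i → R.reflexive (cong fromℤ (unique z (near-mono {x = lattice z} {x} ε≤¼ z~x) i))) (λ _ → R.refl) z~x

  rescale : ∀ {T K : Subset d} {s s′} → s ≈ s′ → SimplexIn T s K → SimplexIn T s′ K
  rescale s≈s′ S = record
    { S
    ; base≈   = λ r → R.trans (S.base≈ r) (R.*-congʳ s≈s′)
    ; column≈ = λ i r → R.trans (S.column≈ i r) (R.*-congʳ s≈s′)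
    }
    where module S = SimplexIn S

  midpoint : ∀ {K : Subset d} → K Respects _≋_ → Convex K → ∀ {x y} → x ∈ K → y ∈ K → ½ ⊙ (x ⊕ y) ∈ K
  midpoint K-respects K-convex {x} {y} x∈K y∈K = K-respects
    (λ i → R.trans (R.+-congˡ (R.*-congʳ (R.trans (R.+-congʳ (R.sym (proj₂ (proj₂ half))))
        (solve 1 (λ h → (h :+ h) :+ :- h := h) R.refl ½)))) (R.sym (R.distribˡ ½ (x i) (y i))))
    (K-convex x∈K y∈K (<⇒≤ 0<½) (<⇒≤ ½<1))

  -- Adding a point of s K to the vertices of a simplex in s K keeps them in
  -- 2 s K, and this freedom moves the base vertex to a lattice point.
  move-to-lattice : ∀ {K : Subset d} {h} → K Respects _≋_ → Convex K →
    (S : SimplexIn (λ _ → ⊤) (½ * h) K) → ∃[ z ] lattice z ∈ dilate (SimplexIn.base S) (½ * h) K → SimplexIn Lattice h K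
  move-to-lattice {K = K} {h} K-respects K-convex S (z , k , k∈K , z≋) = record
    { matrix     = S.matrix
    ; base       = lattice z
    ; unimodular = S.unimodular
    ; base∈T     = z , λ _ → R.refl
    ; vertex₀    = ½ ⊙ (S.vertex₀ ⊕ k)
    ; vertex₀∈   = midpoint K-respects K-convex S.vertex₀∈ k∈K
    ; base≈      = λ r → R.trans (z≋ r) (R.trans (R.+-congʳ (S.base≈ r)) (combine (S.vertex₀ r) r))
    ; vertex     = λ i → ½ ⊙ (S.vertex i ⊕ k)
    ; vertex∈    = λ i → midpoint K-respects K-convex (S.vertex∈ i) k∈K
    ; column≈    = λ i r → R.trans (R.+-congʳ (z≋ r)) (R.trans
        (solve 3 (λ b k a → (b :+ k) :+ a := (b :+ a) :+ k) R.refl (S.base r) ((½ * h) * k r) (fromℤ (S.matrix r i)))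
        (R.trans (R.+-congʳ (S.column≈ i r)) (combine (S.vertex i r) r)))
    }
    where
    module S = SimplexIn S
    combine : ∀ v r → (½ * h) * v + (½ * h) * k r ≈ h * (½ * (v + k r))
    combine v r = solve 4 (λ q h v k → (q :* h) :* v :+ (q :* h) :* k := h :* (q :* (v :+ k))) R.refl ½ h v (k r)

  -- The two containments

  module _ {d : ℕ} (1≤d : 1 ℕ.≤ d) {K : Subset d} (K-body : IsConvexBody K) {Flt : Carrier}
    (Flt-constant : IsFlatnessConstant d Flt) {w : Carrier} (K-width : IsLatticeWidth K w) where

    open IsConvexBody K-body

    private
      n q : Carrier
      n = fromℕ d
      q = proj₁ (inverse (0<fromℕ 1≤d))

      0<q : 0# < q
      0<q = proj₁ (proj₂ (inverse (0<fromℕ 1≤d)))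

      nq≈1 : n * q ≈ 1#
      nq≈1 = proj₂ (proj₂ (inverse (0<fromℕ 1≤d)))

      0<Flt : 0# < Flt
      0<Flt = flatness-positive 1≤d Flt-constant

      0<Flt*n : 0# < Flt * n
      0<Flt*n = *-positive 0<Flt (0<fromℕ 1≤d)

      scale-cancel : ∀ c → (c * q) * n ≈ c
      scale-cancel c = R.trans (R.*-assoc c q n) (R.trans (R.*-congˡ (R.trans (R.*-comm q n) nq≈1)) (R.*-identityʳ c))

      -- Here `q` is `1 / d`. The surplus is at least `h * Flt`, which is positive. The variable `v`
      -- is the width in one containment and half of it in the other.
      exceeds : ∀ {h v} → 0# < h → Flt * n ≤ v → Flt < ((1# + h) * q) * v
      exceeds {h} {v} 0<h Fn≤v = <-by
        (+-positive (*-positive 0<h 0<Flt) ((0≤1 ⊞ <⇒≤ 0<h) ⊠ <⇒≤ 0<q ⊠ diff Fn≤v)) (begin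
          h * Flt + (1# + h) * q * (v + - (Flt * n))
            ≈⟨ solve 5 (λ h F q v n → h :* F :+ (:1 :+ h) :* q :* (v :+ :- (F :* n)) :=
                 h :* F :+ (((:1 :+ h) :* q) :* v :+ :- ((:1 :+ h) :* F :* (n :* q)))) R.refl h Flt q v n ⟩
          h * Flt + (((1# + h) * q) * v + - ((1# + h) * Flt * (n * q)))
            ≈⟨ R.+-congˡ (R.+-congˡ (R.-‿cong (R.trans (R.*-congˡ nq≈1) (R.*-identityʳ ((1# + h) * Flt))))) ⟩
          h * Flt + (((1# + h) * q) * v + - ((1# + h) * Flt))
            ≈⟨ solve 3 (λ h F e → h :* F :+ (e :+ :- ((:1 :+ h) :* F)) := e :+ :- F) R.refl h Flt (((1# + h) * q) * v) ⟩
          ((1# + h) * q) * v + - Flt ∎)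

    ℝ-unimodular-copy : Flt * n ≤ w → ContainsℝUnimodularCopy K (Δ d)
    ℝ-unimodular-copy Fn≤w =
      let A , b , A∈GL , _ , b∈K , columns∈K = simplex-limit {T = λ _ → ⊤} respects compact approx
      in A , b , A∈GL , simplex-image⊆ respects convex A b b∈K columns∈K
      where
      approx : ∀ h → 0# < h → SimplexIn (λ _ → ⊤) (1# + h) K
      approx h 0<h = rescale (scale-cancel (1# + h))
        (simplex-in-dilate K-body Flt-constant K-width (<⇒≤ 0<Flt) (<-≤-trans 0<Flt*n Fn≤w) (exceeds 0<h Fn≤w))

    unimodular-copy : fromℕ 2 * Flt * n ≤ w → ContainsUnimodularCopy K (Δ d)
    unimodular-copy 2Fn≤w =
      let A , b , A∈GL , b∈closure , b∈K , columns∈K = simplex-limit {T = Lattice} respects compact approx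
          z , z≋b = lattice-closed b∈closure
      in A , z , A∈GL , simplex-image⊆ respects convex A (lattice z)
           (respects (λ r → R.sym (z≋b r)) b∈K)
           (λ i → respects (λ r → R.+-congʳ (R.sym (z≋b r))) (columns∈K i))
      where
      Fn≤½w : Flt * n ≤ ½ * w
      Fn≤½w = ≤-by (<⇒≤ 0<½ ⊠ diff 2Fn≤w) (begin
        ½ * (w + - (fromℕ 2 * Flt * n))
          ≈⟨ solve 4 (λ h w F n → h :* (w :+ :- ((:1 :+ (:1 :+ :0)) :* F :* n)) := h :* w :+ :- ((h :+ h) :* (F :* n)))
               R.refl ½ w Flt n ⟩
        ½ * w + - ((½ + ½) * (Flt * n))
          ≈⟨ R.+-congˡ (R.-‿cong (R.trans (R.*-congʳ (proj₂ (proj₂ half))) (R.*-identityˡ (Flt * n)))) ⟩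
        ½ * w + - (Flt * n) ∎)
      0<½w : 0# < ½ * w
      0<½w = <-≤-trans 0<Flt*n Fn≤½w
      0<w : 0# < w
      0<w = <-respʳ-≈ ½+½ (+-positive 0<½w (<⇒≤ 0<½w))
      module _ (h : Carrier) (0<h : 0# < h) where
        σ : Carrier
        σ = ½ * (1# + h)
        0<σ : 0# < σ
        0<σ = *-positive 0<½ (+-positive 0<1 (<⇒≤ 0<h))
        small : SimplexIn (λ _ → ⊤) σ K
        small = rescale (scale-cancel σ) (simplex-in-dilate K-body Flt-constant K-width (<⇒≤ 0<Flt) 0<w
          (<-respʳ-≈ (solve 4 (λ h q c w → (c :* q) :* (h :* w) := ((h :* c) :* q) :* w) R.refl ½ q (1# + h) w)
            (exceeds 0<h Fn≤½w)))
        -- The simplex is built from scale σ / d, but the correcting lattice point is sought in a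
        -- translate at the full scale σ. The required inequality is weaker by the factor `d`, which
        -- is where `n − 1 ≥ 0` enters.
        Flt<σw : Flt < σ * w
        Flt<σw = <-by (+-positive (*-positive 0<h 0<Flt)
            ((0≤1 ⊞ <⇒≤ 0<h) ⊠ diff Fn≤½w ⊞ (0≤1 ⊞ <⇒≤ 0<h) ⊠ <⇒≤ 0<Flt ⊠ diff (fromℕ-mono 1≤d)))
          (solve 5 (λ h F w n q → h :* F :+ ((:1 :+ h) :* (q :* w :+ :- (F :* n)) :+ (:1 :+ h) :* F :* (n :+ :- (:1 :+ :0))) :=
               (q :* (:1 :+ h)) :* w :+ :- F) R.refl h Flt w n ½)
        approx : SimplexIn Lattice (1# + h) K
        approx = move-to-lattice respects convex small
          (dilate-hits-lattice K-body Flt-constant K-width 0<σ Flt<σw (SimplexIn.base small))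

theorem2p1 : ExcludedMiddle 0ℓ → (ℝ : CompleteOrderedField) → let open Geometry ℝ in
    (d : ℕ) → 1 ≤ᴺ d → (K : Subset d) → IsConvexBody K →
    (Flt : Carrier) → IsFlatnessConstant d Flt →
    (width : Carrier) → IsLatticeWidth K width →
    (fromℕ 2 * Flt * fromℕ d ≤ width → ContainsUnimodularCopy K (Δ d)) ×
    (Flt * fromℕ d ≤ width → ContainsℝUnimodularCopy K (Δ d))
theorem2p1 em ℝ d 1≤d K K-body Flt Flt-constant width K-width =
  unimodular-copy 1≤d K-body Flt-constant K-width , ℝ-unimodular-copy 1≤d K-body Flt-constant K-width
  where open Flatness em ℝ
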